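{- Let $q\ge 2$. (a) Let $2\le k\le 2q-2$. For every $n$ with $n\ge 2q+1$ if $k$ is even, and $n\ge 2q+2$ if $k$ is odd, there is an $(n,q)$-cactus $Q$ with $\overrightarrow{rvc}(Q)=n-2q+k$. (b) Let $3\le k\le 3q-3$ with $k\ne 3q-4$. For every $n$ with $n\ge 2q+1$ if $k\equiv 0 \pmod 3$, $n\ge 2q+2$ if $k\equiv 1\pmod 3$, and $n\ge 2q+3$ if $k\equiv 2\pmod 3$, there is an $(n,q)$-cactus $Q$ with $\overrightarrow{trc}(Q)=2n-3q+k$. (c) For every $(n,q)$-cactus $Q$, $\overrightarrow{trc}(Q)\ne 2n-4$.
   Context: A cactus is a strongly connected oriented graph (finite, no loops, no multiple arcs, no pair of opposite arcs) in which every arc belongs to exactly one directed cycle; an $(n,q)$-cactus is a cactus with $n$ vertices and $q$ blocks (directed cycles). $\overrightarrow{rvc}(D)$ is the minimum number of colours in a vertex-colouring such that every ordered pair $(x,y)$ is joined by a directed path whose internal vertices have distinct colours. $\overrightarrow{trc}(D)$ is the minimum number of colours in a total-colouring (of vertices and arcs) such that every ordered pair is joined by a directed path whose arcs and internal vertices all receive pairwise distinct colours. -}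

module Defs where

open import Data.Nat using (ℕ; _<_)
open import Data.Fin using (Fin)
open import Data.Bool using (Bool; true; false; T)
open import Data.List using (List; []; _∷_; _++_; [_]; map)
open import Data.List.Relation.Unary.All using (All)
open import Data.List.Relation.Unary.Unique.Propositional using (Unique)
open import Data.List.Membership.Propositional using (_∈_)
open import Data.Product using (Σ; _×_; _,_; ∃; proj₁; proj₂)
open import Relation.Binary.PropositionalEquality using (_≡_; _≢_)
open import Relation.Nullary using (¬_)

pairs : {A : Set} → List A → List (A × A)
pairs [] = []
pairs (x ∷ []) = []
pairs (x ∷ y ∷ xs) = (x , y) ∷ pairs (y ∷ xs)

record Digraph (n : ℕ) : Set where
  field
    adj : Fin n → Fin n → Bool

Arc : ∀ {n} → Digraph n → Fin n → Fin n → Set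
Arc D u v = T (Digraph.adj D u v)

ArcP : ∀ {n} → Digraph n → Fin n × Fin n → Set
ArcP D (u , v) = Arc D u v

Oriented : ∀ {n} → Digraph n → Set
Oriented D = (∀ u → ¬ Arc D u u) × (∀ u v → Arc D u v → ¬ Arc D v u)

record Path {n} (D : Digraph n) (x y : Fin n) : Set where
  field
    inner : List (Fin n)
    distinct : Unique (x ∷ inner ++ [ y ])
    arcs : All (ArcP D) (pairs (x ∷ inner ++ [ y ]))

open Path public

StronglyConnected : ∀ {n} → Digraph n → Set
StronglyConnected D = ∀ x y → x ≢ y → Path D x y

record Cycle {n} (D : Digraph n) : Set where
  field
    start : Fin n
    rest : List (Fin n)
    distinct : Unique (start ∷ rest)
    arcs : All (ArcP D) (pairs (start ∷ rest ++ [ start ]))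

ArcOfCycle : ∀ {n} {D : Digraph n} → Cycle D → Fin n → Fin n → Set
ArcOfCycle C u v = (u , v) ∈ pairs (Cycle.start C ∷ Cycle.rest C ++ [ Cycle.start C ])

SameCycle : ∀ {n} {D : Digraph n} → Cycle D → Cycle D → Set
SameCycle {n} C C' = ∀ (u v : Fin n) →
  (ArcOfCycle C u v → ArcOfCycle C' u v) × (ArcOfCycle C' u v → ArcOfCycle C u v)

HasExactlyCycles : ∀ {n} → Digraph n → ℕ → Set
HasExactlyCycles D q =
  Σ (Fin q → Cycle D) λ C →
    ∀ (Z : Cycle D) → Σ (Fin q) λ i → SameCycle Z (C i) × (∀ j → SameCycle Z (C j) → j ≡ i)

EveryArcInUniqueCycle : ∀ {n} → Digraph n → Set
EveryArcInUniqueCycle D = ∀ u v → Arc D u v →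
  Σ (Cycle D) λ Z → ArcOfCycle Z u v × (∀ Z' → ArcOfCycle Z' u v → SameCycle Z Z')

-- (n,q)-cactus (n is the vertex count, the index of D; q the number of blocks)
Cactus : ∀ {n} → Digraph n → ℕ → Set
Cactus D q = Oriented D × StronglyConnected D × EveryArcInUniqueCycle D × HasExactlyCycles D q

RainbowVertexConnected : ∀ {n} → Digraph n → (k : ℕ) → Set
RainbowVertexConnected {n} D k = Σ (Fin n → Fin k) λ c →
  ∀ x y → x ≢ y → Σ (Path D x y) λ P → Unique (map c (inner P))

-- total rainbow connection with k colours (vertex colouring cv, arc colouring ca
-- defined on all ordered pairs; only its values on arcs matter)
TotalRainbowConnected : ∀ {n} → Digraph n → (k : ℕ) → Set
TotalRainbowConnected {n} D k =
  Σ (Fin n → Fin k) λ cv → Σ (Fin n → Fin n → Fin k) λ ca →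
  ∀ x y → x ≢ y → Σ (Path D x y) λ P →
    Unique (map cv (inner P) ++ map (λ p → ca (proj₁ p) (proj₂ p)) (pairs (x ∷ inner P ++ [ y ])))

rvc≡ : ∀ {n} → Digraph n → ℕ → Set
rvc≡ D m = RainbowVertexConnected D m × (∀ j → j < m → ¬ RainbowVertexConnected D j)

trc≡ : ∀ {n} → Digraph n → ℕ → Set
trc≡ D m = TotalRainbowConnected D m × (∀ j → j < m → ¬ TotalRainbowConnected D j)

{-# OPTIONS --safe #-}
-- A cactus is grown from a point by repeatedly attaching a directed cycle at one vertex. Giving every
-- arc the colour A(h) of its head h and every vertex v its own colour V(v) is a total rainbow colouring
-- with 2n colours, and colours are then saved by identification. If w has a single in-neighbour u and R
-- is a set containing w that can only be left towards u, then every path meeting w after its start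
-- ends in R. Two such vertices with disjoint sets may share both their A- and their V-colours; dually,
-- vertices with single out-neighbours may share their V-colours.
--
-- For (c), attach the cycles one at a time, starting with two cycles at a common vertex. As long as the
-- cactus is a chain whose ends are at distance n - 1, a Hamiltonian path forces 2n - 3 colours; as soon
-- as a cycle is attached elsewhere, five colours can be saved, which gives 2n - 5, and attaching
-- further cycles never destroys savings. So 2n - 4 does not occur.
--
-- For (a) and (b), take a chain made of one long end cycle, t four-cycles with opposite cut vertices and
-- d triangles, ending in r + 1 triangles at a common vertex. The long path forces the vertex colours,
-- the path together with the middle arcs of the last triangles forces the total colours, and the
-- identifications above attain both bounds.
module Submission where

open import Defs
open import Data.Nat using (ℕ; zero; suc; _≤_; _<_; _+_; _*_; _∸_; _%_; _/_; z≤n; s≤s)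
import Data.Nat.Properties as ℕₚ
open import Data.Nat.DivMod using (m≡m%n+[m/n]*n)
open import Data.Nat.Solver using (module +-*-Solver)
open import Data.Fin using (Fin; zero; suc; _≟_; punchOut; _↑ˡ_; _↑ʳ_)
import Data.Fin.Properties as Finₚ
open import Data.Fin.Properties using (punchOut-injective; injective⇒≤; ↑ˡ-injective; ↑ʳ-injective; suc-injective)
open import Data.Bool.Properties using (T?)
open import Data.List using (List; []; _∷_; _++_; [_]; map; length; concat; filter; lookup)
open import Data.List.Properties using (length-map; length-++; ++-assoc; map-∘; map-++; concat-map; ∷-injectiveˡ)
open import Data.List.Relation.Unary.All as All using (All; []; _∷_)
import Data.List.Relation.Unary.All.Properties as Allₚ
open import Data.List.Relation.Unary.Any as Any using (Any; here; there; any?)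
open import Data.List.Relation.Unary.AllPairs using ([]; _∷_)
import Data.List.Relation.Unary.AllPairs.Properties as AllPairsₚ
open import Data.List.Relation.Unary.Unique.Propositional using (Unique)
open import Data.List.Relation.Unary.Unique.Propositional.Properties as Uniqueₚ using (Unique[x∷xs]⇒x∉xs)
open import Data.List.Membership.Propositional using (_∈_; _∉_; lose; find)
open import Data.List.Membership.Propositional.Properties using (∈-++⁺ˡ; ∈-++⁺ʳ; ∈-++⁻; ∈-map⁺; ∈-map⁻; ∈-lookup; ∈-concat⁺′; ∈-filter⁺; ∈-filter⁻; ∈-AllPairs₂)
open import Data.List.Relation.Binary.Disjoint.Propositional using (Disjoint)
open import Data.Product using (Σ; _×_; _,_; ∃; proj₁; proj₂; swap)
open import Data.Product.Properties using (≡-dec)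
open import Data.Sum using (_⊎_; inj₁; inj₂; [_,_]′; map₂)
open import Data.Sum.Properties using (inj₁-injective; inj₂-injective)
open import Data.Empty using (⊥; ⊥-elim)
open import Data.Unit using (tt)
open import Function using (_∘_; flip; case_of_; id)
open import Relation.Binary.PropositionalEquality using (_≡_; _≢_; refl; sym; trans; cong; cong₂; subst; subst₂)
open import Relation.Nullary using (¬_; Dec; yes; no; does)
open import Relation.Nullary.Decidable using (_×-dec_; ¬?; decidable-stable)
open import Relation.Binary.Construct.Closure.ReflexiveTransitive as Star using (Star; ε; _◅_; _◅◅_)

-- Why `2n - 4` is jumped over: merging two vertices with single in-neighbours saves a vertex colour
-- and an arc colour, merging two with single out-neighbours saves a vertex colour only, because a
-- path may end at such a vertex without leaving it, and the arc entering it then needs its own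
-- colour. A chain offers one saving of each kind, three colours. A cycle attached off its ends adds
-- another saving of the first kind, so the total goes from three to five at once. The obstacle to
-- keeping savings is that the vertex `u` where a cycle is attached gains an in- and an
-- out-neighbour and loses its role; the first or the last new vertex takes it over. In (a) and (b),
-- `t` is the residue of `k` modulo 2 or 3 and `d + 1` the quotient; further end triangles adjust
-- `q`, and the length of the long cycle adjusts `n`. The value `k = 3q - 4` left out of (b) would
-- give `2n - 3q + k = 2n - 4`, which (c) excludes.

private variable
  A B : Set
  n : ℕ

-- Lists and consecutive pairs

unique-tail : ∀ {x : A} {xs} → Unique (x ∷ xs) → Unique xs
unique-tail (_ ∷ u) = u

unique-++ˡ : ∀ (xs : List A) {ys} → Unique (xs ++ ys) → Unique xs
unique-++ˡ [] u = []
unique-++ˡ (x ∷ xs) (p ∷ u) = Allₚ.++⁻ˡ xs p ∷ unique-++ˡ xs u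

unique-++ʳ : ∀ (xs : List A) {ys} → Unique (xs ++ ys) → Unique ys
unique-++ʳ [] u = u
unique-++ʳ (x ∷ xs) (p ∷ u) = unique-++ʳ xs u

unique-++-disjoint : ∀ (xs : List A) {ys} → Unique (xs ++ ys) → Disjoint xs ys
unique-++-disjoint (x ∷ xs) (p ∷ u) (here refl , j) = All.lookup (Allₚ.++⁻ʳ xs p) j refl
unique-++-disjoint (x ∷ xs) (p ∷ u) (there i , j) = unique-++-disjoint xs u (i , j)

unique-map : ∀ (f : A → B) {xs} → Unique xs →
  (∀ {v w} → v ∈ xs → w ∈ xs → v ≢ w → f v ≢ f w) → Unique (map f xs)
unique-map f [] h = []
unique-map f (p ∷ u) h =
  Allₚ.map⁺ (All.tabulate λ i → h (here refl) (there i) (All.lookup p i))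
  ∷ unique-map f u λ i j → h (there i) (there j)

lookup-injective : ∀ {xs : List A} → Unique xs → ∀ {i j} → lookup xs i ≡ lookup xs j → i ≡ j
lookup-injective (p ∷ u) {zero} {zero} e = refl
lookup-injective {xs = x ∷ xs} (p ∷ u) {zero} {suc j} e = ⊥-elim (All.lookup p (∈-lookup {xs = xs} j) e)
lookup-injective {xs = x ∷ xs} (p ∷ u) {suc i} {zero} e = ⊥-elim (All.lookup p (∈-lookup {xs = xs} i) (sym e))
lookup-injective (p ∷ u) {suc i} {suc j} e = cong suc (lookup-injective u e)

unique-length : ∀ {xs : List (Fin n)} → Unique xs → length xs ≤ n
unique-length u = injective⇒≤ (lookup-injective u)

covering-length : ∀ {xs : List (Fin n)} → (∀ v → v ∈ xs) → n ≤ length xs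
covering-length {n} {xs} c = injective⇒≤ {f = λ v → index (c v)} λ {v} {w} e →
    trans (sym (at (c v))) (trans (cong (lookup xs) e) (at (c w)))
  where
  open import Data.List.Relation.Unary.Any using (index)
  open import Data.List.Relation.Unary.Any.Properties using (lookup-index)
  at : ∀ {v} (p : v ∈ xs) → lookup xs (index p) ≡ v
  at p = sym (lookup-index p)

pairs-∈ : ∀ (xs : List A) {a b} → (a , b) ∈ pairs xs → a ∈ xs × b ∈ xs
pairs-∈ (x ∷ y ∷ xs) (here refl) = here refl , there (here refl)
pairs-∈ (x ∷ y ∷ xs) (there i) with pairs-∈ (y ∷ xs) i
... | p , q = there p , there q

pairs-head-∈ : ∀ (x : A) xs {a b} → (a , b) ∈ pairs (x ∷ xs) → b ∈ xs
pairs-head-∈ x (y ∷ xs) (here refl) = here refl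
pairs-head-∈ x (y ∷ xs) (there i) = there (pairs-head-∈ y xs i)

pairs-tail-∈ : ∀ (xs : List A) y {a b} → (a , b) ∈ pairs (xs ++ [ y ]) → a ∈ xs
pairs-tail-∈ (x ∷ []) y (here refl) = here refl
pairs-tail-∈ (x ∷ x₁ ∷ xs) y (here refl) = here refl
pairs-tail-∈ (x ∷ x₁ ∷ xs) y (there i) = there (pairs-tail-∈ (x₁ ∷ xs) y i)

pairs-in-unique : ∀ (x : A) {xs} → Unique xs → ∀ {a a' b} →
  (a , b) ∈ pairs (x ∷ xs) → (a' , b) ∈ pairs (x ∷ xs) → a ≡ a'
pairs-in-unique x {y ∷ xs} u (here refl) (here refl) = refl
pairs-in-unique x {y ∷ xs} u (here refl) (there j) = ⊥-elim (Unique[x∷xs]⇒x∉xs u (pairs-head-∈ y xs j))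
pairs-in-unique x {y ∷ xs} u (there i) (here refl) = ⊥-elim (Unique[x∷xs]⇒x∉xs u (pairs-head-∈ y xs i))
pairs-in-unique x {y ∷ xs} (_ ∷ u) (there i) (there j) = pairs-in-unique y u i j

pairs-out-unique : ∀ (xs : List A) y → Unique xs → ∀ {a b b'} →
  (a , b) ∈ pairs (xs ++ [ y ]) → (a , b') ∈ pairs (xs ++ [ y ]) → b ≡ b'
pairs-out-unique (x ∷ []) y u (here refl) (here refl) = refl
pairs-out-unique (x ∷ z ∷ xs) y u (here refl) (here refl) = refl
pairs-out-unique (x ∷ z ∷ xs) y u (here refl) (there j) = ⊥-elim (Unique[x∷xs]⇒x∉xs u (pairs-tail-∈ (z ∷ xs) y j))
pairs-out-unique (x ∷ z ∷ xs) y u (there i) (here refl) = ⊥-elim (Unique[x∷xs]⇒x∉xs u (pairs-tail-∈ (z ∷ xs) y i))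
pairs-out-unique (x ∷ z ∷ xs) y (_ ∷ u) (there i) (there j) = pairs-out-unique (z ∷ xs) y u i j

pairs-has-head : ∀ (x : A) xs {b} → b ∈ xs → ∃ λ a → (a , b) ∈ pairs (x ∷ xs)
pairs-has-head x (y ∷ xs) (here refl) = x , here refl
pairs-has-head x (y ∷ xs) (there i) with pairs-has-head y xs i
... | a , j = a , there j

pairs-has-tail : ∀ (xs : List A) y {a} → a ∈ xs → ∃ λ b → (a , b) ∈ pairs (xs ++ [ y ])
pairs-has-tail (x ∷ []) y (here refl) = y , here refl
pairs-has-tail (x ∷ z ∷ xs) y (here refl) = z , here refl
pairs-has-tail (x ∷ z ∷ xs) y (there i) with pairs-has-tail (z ∷ xs) y i
... | b , j = b , there j

pairs-++ˡ : ∀ (xs ys : List A) {e} → e ∈ pairs xs → e ∈ pairs (xs ++ ys)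
pairs-++ˡ (x ∷ y ∷ xs) ys (here refl) = here refl
pairs-++ˡ (x ∷ y ∷ xs) ys (there i) = there (pairs-++ˡ (y ∷ xs) ys i)

pairs-++ʳ : ∀ (xs ys : List A) {e} → e ∈ pairs ys → e ∈ pairs (xs ++ ys)
pairs-++ʳ [] ys i = i
pairs-++ʳ (x ∷ []) (y ∷ ys) i = there i
pairs-++ʳ (x ∷ z ∷ xs) ys i = there (pairs-++ʳ (z ∷ xs) ys i)

pairs-split : ∀ (xs : List A) y ys {e} → e ∈ pairs (xs ++ y ∷ ys) →
  e ∈ pairs (xs ++ [ y ]) ⊎ e ∈ pairs (y ∷ ys)
pairs-split [] y ys i = inj₂ i
pairs-split (x ∷ []) y ys (here refl) = inj₁ (here refl)
pairs-split (x ∷ []) y ys (there i) = inj₂ i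
pairs-split (x ∷ z ∷ xs) y ys (here refl) = inj₁ (here refl)
pairs-split (x ∷ z ∷ xs) y ys (there i) with pairs-split (z ∷ xs) y ys i
... | inj₁ j = inj₁ (there j)
... | inj₂ j = inj₂ j

map-proj₂-pairs : ∀ (x : A) xs → map proj₂ (pairs (x ∷ xs)) ≡ xs
map-proj₂-pairs x [] = refl
map-proj₂-pairs x (y ∷ xs) = cong (y ∷_) (map-proj₂-pairs y xs)

length-pairs : ∀ (x : A) xs → length (pairs (x ∷ xs)) ≡ length xs
length-pairs x [] = refl
length-pairs x (y ∷ xs) = cong suc (length-pairs y xs)

-- Directed cycles as lists of arcs

cyc : A → List A → List (A × A)
cyc u ws = pairs (u ∷ ws ++ [ u ])

module _ (u : A) (ws : List A) (uq : Unique (u ∷ ws)) where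

  cyc-∈ : ∀ {a b} → (a , b) ∈ cyc u ws → a ∈ u ∷ ws × b ∈ u ∷ ws
  cyc-∈ i = pairs-tail-∈ (u ∷ ws) u i , rot (pairs-head-∈ u (ws ++ [ u ]) i)
    where
    rot : ∀ {b} → b ∈ ws ++ [ u ] → b ∈ u ∷ ws
    rot j with ∈-++⁻ ws j
    ... | inj₁ k = there k
    ... | inj₂ (here refl) = here refl

  cyc-in-unique : ∀ {a a' b} → (a , b) ∈ cyc u ws → (a' , b) ∈ cyc u ws → a ≡ a'
  cyc-in-unique = pairs-in-unique u
    (Uniqueₚ.++⁺ (unique-tail uq) ([] ∷ []) λ { (i , here refl) → Unique[x∷xs]⇒x∉xs uq i })

  cyc-out-unique : ∀ {a b b'} → (a , b) ∈ cyc u ws → (a , b') ∈ cyc u ws → b ≡ b'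
  cyc-out-unique = pairs-out-unique (u ∷ ws) u uq

  cyc-next : ∀ {a} → a ∈ u ∷ ws → ∃ λ b → (a , b) ∈ cyc u ws
  cyc-next = pairs-has-tail (u ∷ ws) u

  -- Induction around a cycle from an arbitrary arc: `P` is carried to the closing arc into `u`,
  -- across `u` to the first arc, and from there through the whole list.
  cyc-closure : (P : A → A → Set) → (∀ {a b c} → P a b → (a , b) ∈ cyc u ws → (b , c) ∈ cyc u ws → P b c) →
    ∀ {a b} → (a , b) ∈ cyc u ws → P a b → ∀ {c d} → (c , d) ∈ cyc u ws → P c d
  cyc-closure P step i p = fromStart
    where
    fwd : ∀ x y ys → (∀ {e} → e ∈ pairs (x ∷ y ∷ ys) → e ∈ cyc u ws) → P x y →
      ∀ {c d} → (c , d) ∈ pairs (x ∷ y ∷ ys) → P c d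
    fwd x y ys h q (here refl) = q
    fwd x y (z ∷ ys) h q (there j) = fwd y z ys (h ∘ there) (step q (h (here refl)) (h (there (here refl)))) j
    toLast : ∀ xs → (∀ {e} → e ∈ pairs (xs ++ [ u ]) → e ∈ cyc u ws) →
      ∀ {a b} → (a , b) ∈ pairs (xs ++ [ u ]) → P a b → ∃ λ z → (z , u) ∈ cyc u ws × P z u
    toLast (x ∷ []) h (here refl) q = x , h (here refl) , q
    toLast (x ∷ y ∷ []) h (here refl) q =
      y , h (there (here refl)) , step q (h (here refl)) (h (there (here refl)))
    toLast (x ∷ y ∷ z ∷ xs) h (here refl) q =
      toLast (y ∷ z ∷ xs) (h ∘ there) (here refl) (step q (h (here refl)) (h (there (here refl))))
    toLast (x ∷ y ∷ xs) h (there j) q = toLast (y ∷ xs) (h ∘ there) j q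
    uncons : ∀ ws → ∃ λ b → Σ (List A) λ ys → ws ++ [ u ] ≡ b ∷ ys
    uncons [] = u , [] , refl
    uncons (w ∷ ws') = w , ws' ++ [ u ] , refl
    fromStart : ∀ {c d} → (c , d) ∈ cyc u ws → P c d
    fromStart j with uncons ws | toLast (u ∷ ws) id i p
    ... | b , ys , eq | z , k , q = subst (λ l → ∀ {c d} → (c , d) ∈ pairs (u ∷ l) → P c d) (sym eq)
        (fwd u b ys (λ {e} m → subst (λ l → e ∈ pairs (u ∷ l)) (sym eq) m)
          (step q k (subst (λ l → (u , b) ∈ pairs (u ∷ l)) (sym eq) (here refl)))) j

SimplePath : (A → A → Set) → A → A → Set
SimplePath {A} R x y = Σ (List A) λ is →
  Unique (x ∷ is ++ [ y ]) × All (λ e → R (proj₁ e) (proj₂ e)) (pairs (x ∷ is ++ [ y ]))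

suffix : ∀ {R : A → A → Set} {x y} z is → Unique (z ∷ is ++ [ y ]) →
  All (λ e → R (proj₁ e) (proj₂ e)) (pairs (z ∷ is ++ [ y ])) → x ∈ z ∷ is → SimplePath R x y
suffix z is u al (here refl) = is , u , al
suffix z (i ∷ is) (_ ∷ u) (_ ∷ al) (there p) = suffix i is u al p

module _ {n} {R : Fin n → Fin n → Set} where
  open import Data.List.Membership.DecPropositional (_≟_ {n}) using (_∈?_)

  loop-erase : ∀ {x y} → Star R x y → x ≢ y → SimplePath R x y
  loop-erase ε x≢y = ⊥-elim (x≢y refl)
  loop-erase {x} {y} (_◅_ {j = z} a s) x≢y with z ≟ y
  ... | yes refl = [] , (x≢y ∷ []) ∷ [] ∷ [] , a ∷ []
  ... | no z≢y with loop-erase s z≢y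
  ... | is , u , al with x ∈? (z ∷ is)
  ... | yes p = suffix z is u al p
  ... | no x∉ = z ∷ is , All.tabulate fresh ∷ u , a ∷ al
    where
    fresh : ∀ {v} → v ∈ (z ∷ is) ++ [ y ] → x ≢ v
    fresh i refl with ∈-++⁻ (z ∷ is) i
    ... | inj₁ j = x∉ j
    ... | inj₂ (here refl) = x≢y refl

walk : ∀ {R : A → A → Set} x is y → All (λ e → R (proj₁ e) (proj₂ e)) (pairs (x ∷ is ++ [ y ])) → Star R x y
walk x [] y (a ∷ []) = a ◅ ε
walk x (i ∷ is) y (a ∷ al) = a ◅ walk i is y al

-- Cacti grown by attaching cycles

ArcIn : List (A × A) → A → A → Set
ArcIn E a b = (a , b) ∈ E

module _ {n : ℕ} where
  open import Data.List.Membership.DecPropositional (_≟_ {n}) public using () renaming (_∈?_ to _∈ᵥ?_)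
  open import Data.List.Membership.DecPropositional (≡-dec (_≟_ {n}) (_≟_ {n})) public using () renaming (_∈?_ to _∈ₐ?_)

reach-from : ∀ (x : A) xs {v} → v ∈ x ∷ xs → Star (ArcIn (pairs (x ∷ xs))) x v
reach-from x xs (here refl) = ε
reach-from x (y ∷ xs) (there i) = here refl ◅ Star.map there (reach-from y xs i)

reach-to : ∀ (xs : List A) y {v} → v ∈ xs ++ [ y ] → Star (ArcIn (pairs (xs ++ [ y ]))) v y
reach-to [] y (here refl) = ε
reach-to (x ∷ []) y (here refl) = here refl ◅ ε
reach-to (x ∷ []) y (there (here refl)) = ε
reach-to (x ∷ z ∷ xs) y (here refl) = here refl ◅ Star.map there (reach-to (z ∷ xs) y (here refl))
reach-to (x ∷ z ∷ xs) y (there i) = Star.map there (reach-to (z ∷ xs) y i)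

cyc-from : ∀ (u : A) ws {v} → v ∈ u ∷ ws → Star (ArcIn (cyc u ws)) u v
cyc-from u ws i = reach-from u (ws ++ [ u ]) (∈-++⁺ˡ i)

cyc-to : ∀ (u : A) ws {v} → v ∈ u ∷ ws → Star (ArcIn (cyc u ws)) v u
cyc-to u ws i = reach-to (u ∷ ws) u (∈-++⁺ˡ i)

pairs-irreflexive : ∀ {xs : List A} → Unique xs → ∀ {a} → (a , a) ∉ pairs xs
pairs-irreflexive {xs = x ∷ y ∷ xs} u (here refl) = Unique[x∷xs]⇒x∉xs u (here refl)
pairs-irreflexive {xs = x ∷ y ∷ xs} (_ ∷ u) (there i) = pairs-irreflexive u i

pairs-asymmetric : ∀ {xs : List A} → Unique xs → ∀ {a b} → (a , b) ∈ pairs xs → (b , a) ∉ pairs xs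
pairs-asymmetric {xs = x ∷ y ∷ xs} u (here refl) (here refl) = Unique[x∷xs]⇒x∉xs u (here refl)
pairs-asymmetric {xs = x ∷ y ∷ xs} u (here refl) (there j) = Unique[x∷xs]⇒x∉xs u (there (pairs-head-∈ y xs j))
pairs-asymmetric {xs = x ∷ y ∷ xs} u (there i) (here refl) = Unique[x∷xs]⇒x∉xs u (there (pairs-head-∈ y xs i))
pairs-asymmetric {xs = x ∷ y ∷ xs} (_ ∷ u) (there i) (there j) = pairs-asymmetric u i j

unique-rotate : ∀ {u : A} {ws} → Unique (u ∷ ws) → Unique (ws ++ [ u ])
unique-rotate uq = Uniqueₚ.++⁺ (unique-tail uq) ([] ∷ []) λ { (i , here refl) → Unique[x∷xs]⇒x∉xs uq i }

cyc-irreflexive : ∀ {u w : A} {ws} → Unique (u ∷ w ∷ ws) → ∀ {a} → (a , a) ∉ cyc u (w ∷ ws)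
cyc-irreflexive uq (here refl) = Unique[x∷xs]⇒x∉xs uq (here refl)
cyc-irreflexive uq (there i) = pairs-irreflexive (unique-rotate uq) i

cyc-asymmetric : ∀ {u w w' : A} {ws} → Unique (u ∷ w ∷ w' ∷ ws) →
  ∀ {a b} → (a , b) ∈ cyc u (w ∷ w' ∷ ws) → (b , a) ∉ cyc u (w ∷ w' ∷ ws)
cyc-asymmetric uq (here refl) (here refl) = Unique[x∷xs]⇒x∉xs uq (here refl)
cyc-asymmetric {u = u} {w} {w'} {ws} uq (here refl) (there j)
  with cyc-out-unique u (w ∷ w' ∷ ws) uq (there (here refl)) (there j)
... | refl = Unique[x∷xs]⇒x∉xs uq (there (here refl))
cyc-asymmetric {u = u} {w} {w'} {ws} uq (there i) (here refl)
  with cyc-out-unique u (w ∷ w' ∷ ws) uq (there (here refl)) (there i)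
... | refl = Unique[x∷xs]⇒x∉xs uq (there (here refl))
cyc-asymmetric uq (there i) (there j) = pairs-asymmetric (unique-rotate uq) i j

-- The two explicit new vertices `w₁` and `w₂` force length at least three on every cycle, which
-- rules out loops and opposite arcs.
data Built {n : ℕ} : List (Fin n) → List (Fin n × Fin n) → ℕ → Set where
  point  : ∀ r → Built [ r ] [] 0
  attach : ∀ {U E q u w₁ w₂ ws} → Built U E q → u ∈ U →
    Unique (w₁ ∷ w₂ ∷ ws) → Disjoint (w₁ ∷ w₂ ∷ ws) U →
    Built ((w₁ ∷ w₂ ∷ ws) ++ U) (cyc u (w₁ ∷ w₂ ∷ ws) ++ E) (suc q)

module _ {n : ℕ} where
  private
    V = Fin n
    variable
      U : List V
      E : List (V × V)
      q : ℕ

  attach-unique : ∀ {u : V} {ws} → u ∈ U → Unique ws → Disjoint ws U → Unique (u ∷ ws)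
  attach-unique u∈ uq dj = All.tabulate (λ { i refl → dj (i , u∈) }) ∷ uq

  built-unique : Built U E q → Unique U
  built-unique (point r) = [] ∷ []
  built-unique (attach b u∈ uq dj) = Uniqueₚ.++⁺ uq (built-unique b) dj

  built-arcs : Built U E q → ∀ {a b} → (a , b) ∈ E → a ∈ U × b ∈ U
  built-arcs (attach {u = u} {w₁} {w₂} {ws} bt u∈ uq dj) i
    with ∈-++⁻ (cyc u (w₁ ∷ w₂ ∷ ws)) i
  ... | inj₂ j = let p , r = built-arcs bt j in ∈-++⁺ʳ (w₁ ∷ w₂ ∷ ws) p , ∈-++⁺ʳ (w₁ ∷ w₂ ∷ ws) r
  ... | inj₁ j = let p , r = cyc-∈ u (w₁ ∷ w₂ ∷ ws) (attach-unique u∈ uq dj) j in up p , up r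
    where
    up : ∀ {v} → v ∈ u ∷ w₁ ∷ w₂ ∷ ws → v ∈ (w₁ ∷ w₂ ∷ ws) ++ _
    up (here refl) = ∈-++⁺ʳ (w₁ ∷ w₂ ∷ ws) u∈
    up (there k) = ∈-++⁺ˡ k

  built-connected : Built U E q → ∀ {a b} → a ∈ U → b ∈ U → Star (ArcIn E) a b
  built-connected (point r) (here refl) (here refl) = ε
  built-connected (attach {u = u} {w₁} {w₂} {ws} bt u∈ uq dj) i j = to i ◅◅ from j
    where
    cs = w₁ ∷ w₂ ∷ ws
    to : ∀ {a} → a ∈ cs ++ _ → Star (ArcIn (cyc u cs ++ _)) a u
    to k with ∈-++⁻ cs k
    ... | inj₁ l = Star.map ∈-++⁺ˡ (cyc-to u cs (there l))
    ... | inj₂ l = Star.map (∈-++⁺ʳ (cyc u cs)) (built-connected bt l u∈)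
    from : ∀ {a} → a ∈ cs ++ _ → Star (ArcIn (cyc u cs ++ _)) u a
    from k with ∈-++⁻ cs k
    ... | inj₁ l = Star.map ∈-++⁺ˡ (cyc-from u cs (there l))
    ... | inj₂ l = Star.map (∈-++⁺ʳ (cyc u cs)) (built-connected bt u∈ l)

  built-irreflexive : Built U E q → ∀ {a} → (a , a) ∉ E
  built-irreflexive (attach {u = u} {w₁} {w₂} {ws} bt u∈ uq dj) i
    with ∈-++⁻ (cyc u (w₁ ∷ w₂ ∷ ws)) i
  ... | inj₁ j = cyc-irreflexive (attach-unique u∈ uq dj) j
  ... | inj₂ j = built-irreflexive bt j

  module _ {u : V} {w₁ w₂ : V} {ws : List V} (u∈ : u ∈ U) (uq : Unique (w₁ ∷ w₂ ∷ ws)) (dj : Disjoint (w₁ ∷ w₂ ∷ ws) U) where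
    private
      cs : List V
      cs = w₁ ∷ w₂ ∷ ws

    cyc-old : ∀ {v} → v ∈ u ∷ cs → v ∈ U → v ≡ u
    cyc-old (here p) _ = p
    cyc-old (there i) j = ⊥-elim (dj (i , j))

    -- Such an arc would be a loop at `u`, the only old vertex of the new cycle. Hence old and new
    -- arcs never coincide.
    cyc-not-old : ∀ {a b} → (a , b) ∈ cyc u cs → a ∈ U → b ∈ U → ⊥
    cyc-not-old i p q with cyc-∈ u cs (attach-unique u∈ uq dj) i
    ... | p' , q' with cyc-old p' p | cyc-old q' q
    ... | refl | refl = cyc-irreflexive (attach-unique u∈ uq dj) i

  built-asymmetric : Built U E q → ∀ {a b} → (a , b) ∈ E → (b , a) ∉ E
  built-asymmetric (attach {u = u} {w₁} {w₂} {ws} bt u∈ uq dj) i j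
    with ∈-++⁻ (cyc u (w₁ ∷ w₂ ∷ ws)) i | ∈-++⁻ (cyc u (w₁ ∷ w₂ ∷ ws)) j
  ... | inj₁ i' | inj₁ j' = cyc-asymmetric (attach-unique u∈ uq dj) i' j'
  ... | inj₂ i' | inj₂ j' = built-asymmetric bt i' j'
  ... | inj₁ i' | inj₂ j' = let p , r = built-arcs bt j' in cyc-not-old u∈ uq dj i' r p
  ... | inj₂ i' | inj₁ j' = let p , r = built-arcs bt i' in cyc-not-old u∈ uq dj j' r p

  -- The ambient `D` may have more arcs than `E`, and `complete` concerns only cycles inside `E`. So
  -- the record serves both the finished constructions and the partially exhausted subgraphs of a
  -- given cactus.
  record Blocks (D : Digraph n) (E : List (V × V)) (q : ℕ) : Set where
    field
      block    : Fin q → Cycle D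
      within   : ∀ i {a b} → ArcOfCycle (block i) a b → (a , b) ∈ E
      cover    : ∀ {a b} → (a , b) ∈ E → ∃ λ i → ArcOfCycle (block i) a b
      disjoint : ∀ {i j a b} → ArcOfCycle (block i) a b → ArcOfCycle (block j) a b → i ≡ j
      complete : ∀ (Z : Cycle D) → (∀ {a b} → ArcOfCycle Z a b → (a , b) ∈ E) → ∃ λ i → SameCycle Z (block i)

  module _ {D : Digraph n} where

    cycle-first : (Z : Cycle D) → ∃ λ b → ArcOfCycle Z (Cycle.start Z) b
    cycle-first Z = cyc-next _ (Cycle.rest Z) (Cycle.distinct Z) (here refl)

    -- At each head of a common arc `Z` continues, and `C` has only one arc to continue with; so
    -- membership in `Z` travels all the way around `C`.
    cycle-⊆⇒same : (Z C : Cycle D) → (∀ {a b} → ArcOfCycle Z a b → ArcOfCycle C a b) → SameCycle Z C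
    cycle-⊆⇒same Z C Z⊆C u v = Z⊆C , λ j →
        let b , i = cycle-first Z in
        cyc-closure _ (Cycle.rest C) (Cycle.distinct C) (ArcOfCycle Z) step (Z⊆C i) i j
      where
      step : ∀ {a b c} → ArcOfCycle Z a b → ArcOfCycle C a b → ArcOfCycle C b c → ArcOfCycle Z b c
      step i _ j with cyc-next _ (Cycle.rest Z) (Cycle.distinct Z)
                             (proj₂ (cyc-∈ _ (Cycle.rest Z) (Cycle.distinct Z) i))
      ... | c' , k with cyc-out-unique _ (Cycle.rest C) (Cycle.distinct C) (Z⊆C k) j
      ... | refl = k

    blocks-point : Blocks D [] 0
    blocks-point = record
      { block = λ () ; within = λ () ; cover = λ () ; disjoint = λ { {()} }
      ; complete = λ Z h → case h (proj₂ (cycle-first Z)) of λ () }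

    module _ {E : List (V × V)} {q : ℕ} {u : V} {w₁ w₂ : V} {ws : List V} (bt : Built U E q)
      (u∈ : u ∈ U) (uq : Unique (w₁ ∷ w₂ ∷ ws)) (dj : Disjoint (w₁ ∷ w₂ ∷ ws) U)
      (E⊆D : ∀ {a b} → (a , b) ∈ cyc u (w₁ ∷ w₂ ∷ ws) ++ E → Arc D a b) (B : Blocks D E q) where
      private
        cs : List V
        cs = w₁ ∷ w₂ ∷ ws
        new : List (V × V)
        new = cyc u cs
        open Blocks B
        uq' = attach-unique u∈ uq dj

      new-block : Cycle D
      new-block = record { start = u ; rest = cs ; distinct = uq'
        ; arcs = All.tabulate λ i → E⊆D (∈-++⁺ˡ i) }

      private
        blk : Fin (suc q) → Cycle D
        blk zero = new-block
        blk (suc i) = block i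

        wth : ∀ i {a b} → ArcOfCycle (blk i) a b → (a , b) ∈ new ++ E
        wth zero i = ∈-++⁺ˡ i
        wth (suc j) i = ∈-++⁺ʳ new (within j i)

        cov : ∀ {a b} → (a , b) ∈ new ++ E → ∃ λ i → ArcOfCycle (blk i) a b
        cov i with ∈-++⁻ new i
        ... | inj₁ j = zero , j
        ... | inj₂ j = let k , l = cover j in suc k , l

        clash : ∀ {a b} → (a , b) ∈ new → (a , b) ∈ E → ⊥
        clash i j = let p , r = built-arcs bt j in cyc-not-old u∈ uq dj i p r

        disj : ∀ i j {a b} → ArcOfCycle (blk i) a b → ArcOfCycle (blk j) a b → i ≡ j
        disj zero zero i j = refl
        disj zero (suc l) i j = ⊥-elim (clash i (within l j))
        disj (suc k) zero i j = ⊥-elim (clash j (within k i))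
        disj (suc k) (suc l) i j = cong suc (disjoint i j)

        comp : ∀ (Z : Cycle D) → (∀ {a b} → ArcOfCycle Z a b → (a , b) ∈ new ++ E) → ∃ λ i → SameCycle Z (blk i)
        -- A cycle can change between old and new arcs only at `u`, which it leaves once. If it
        -- leaves `u` by a new arc it is entirely new; if not, a single old arc makes it entirely
        -- old.
        comp Z Z⊆ = case any? (λ e → (proj₁ e ≟ u) ×-dec (e ∈ₐ? new)) arcsZ of λ where
            (yes p) → case find p of λ { (_ , i , refl , j) → zero , cycle-⊆⇒same Z new-block (all-new i j) }
            (no ¬p) → case any? (_∈ₐ? E) arcsZ of λ where
              (yes p) → let _ , i , j = find p ; k , s = complete Z (all-old (λ i j → ¬p (lose i (refl , j))) i j)
                        in suc k , s
              (no ¬r) → zero , cycle-⊆⇒same Z new-block λ i → case ∈-++⁻ new (Z⊆ i) of λ where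
                (inj₁ j) → j
                (inj₂ j) → ⊥-elim (¬r (lose i j))
          where
          open Cycle Z using (start; rest) renaming (distinct to dZ)
          arcsZ = cyc start rest
          all-new : ∀ {c} → (u , c) ∈ arcsZ → (u , c) ∈ new → ∀ {a b} → (a , b) ∈ arcsZ → (a , b) ∈ new
          all-new {c} i j = cyc-closure start rest dZ (ArcIn new) step i j
            where
            step : ∀ {a b d} → (a , b) ∈ new → (a , b) ∈ arcsZ → (b , d) ∈ arcsZ → (b , d) ∈ new
            step k _ l with ∈-++⁻ new (Z⊆ l)
            ... | inj₁ m = m
            ... | inj₂ m with cyc-old u∈ uq dj (proj₂ (cyc-∈ u cs uq' k)) (proj₁ (built-arcs bt m))
            ... | refl with cyc-out-unique start rest dZ i l
            ... | refl = j
          all-old : (∀ {c} → (u , c) ∈ arcsZ → (u , c) ∉ new) →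
            ∀ {c d} → (c , d) ∈ arcsZ → (c , d) ∈ E → ∀ {a b} → (a , b) ∈ arcsZ → (a , b) ∈ E
          all-old h = cyc-closure start rest dZ (ArcIn E) step
            where
            step : ∀ {a b d} → (a , b) ∈ E → (a , b) ∈ arcsZ → (b , d) ∈ arcsZ → (b , d) ∈ E
            step k _ l with ∈-++⁻ new (Z⊆ l)
            ... | inj₂ m = m
            ... | inj₁ m with cyc-old u∈ uq dj (proj₁ (cyc-∈ u cs uq' m)) (proj₂ (built-arcs bt k))
            ... | refl = ⊥-elim (h l m)

      blocks-attach : Blocks D (new ++ E) (suc q)
      blocks-attach = record { block = blk ; within = wth ; cover = cov
        ; disjoint = λ {i} {j} → disj i j ; complete = comp }

    blocks : Built U E q → (∀ {a b} → (a , b) ∈ E → Arc D a b) → Blocks D E q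
    blocks (point r) E⊆D = blocks-point
    blocks (attach {u = u} {w₁} {w₂} {ws} bt u∈ uq dj) E⊆D =
      blocks-attach bt u∈ uq dj E⊆D (blocks bt (λ i → E⊆D (∈-++⁺ʳ (cyc u (w₁ ∷ w₂ ∷ ws)) i)))

  digraph : List (V × V) → Digraph n
  digraph E = record { adj = λ a b → does ((a , b) ∈ₐ? E) }

  arc⇒∈ : ∀ (E : List (V × V)) {a b} → Arc (digraph E) a b → (a , b) ∈ E
  arc⇒∈ E {a} {b} t with (a , b) ∈ₐ? E
  ... | yes p = p

  ∈⇒arc : ∀ (E : List (V × V)) {a b} → (a , b) ∈ E → Arc (digraph E) a b
  ∈⇒arc E {a} {b} i with (a , b) ∈ₐ? E
  ... | yes p = tt
  ... | no ¬p = ¬p i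

  simple⇒path : ∀ {D : Digraph n} {x y} → SimplePath (Arc D) x y → Path D x y
  simple⇒path (is , u , al) = record { inner = is ; distinct = u ; arcs = All.map id al }

  built-cactus : Built U E q → (∀ v → v ∈ U) → Cactus (digraph E) q
  built-cactus {U = U} {E = E} {q = q} bt full =
      ((λ u t → built-irreflexive bt (arc⇒∈ E t)) , λ u v s t → built-asymmetric bt (arc⇒∈ E s) (arc⇒∈ E t))
    , (λ x y x≢y → simple⇒path (loop-erase (Star.map (∈⇒arc E) (built-connected bt (full x) (full y))) x≢y))
    , (λ u v t → let i , j = cover (arc⇒∈ E t) in block i , j , λ Z' k →
          let l , s = in-block Z' in same-at Z' k l s j)
    , block , λ Z → let i , s = in-block Z in i , s , λ j s' →
          let b , k = cycle-first Z in disjoint (proj₁ (s' _ _) k) (proj₁ (s _ _) k)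
    where
    open Blocks (blocks {D = digraph E} bt (∈⇒arc E))
    in-block : (Z : Cycle (digraph E)) → ∃ λ i → SameCycle Z (block i)
    in-block Z = complete Z λ i → arc⇒∈ E (All.lookup (Cycle.arcs Z) i)
    same-at : ∀ Z' {u v i} → ArcOfCycle Z' u v → ∀ l → SameCycle Z' (block l) →
      ArcOfCycle (block i) u v → SameCycle (block i) Z'
    same-at Z' k l s j with disjoint j (proj₁ (s _ _) k)
    ... | refl = λ a b → proj₂ (s a b) , proj₁ (s a b)

-- Colourings that reuse colours on independent vertices

module _ {n : ℕ} where
  private
    V = Fin n

  -- The relation is a parameter so that `flip` gives the dual notion: `w` has a single
  -- out-neighbour, and `R` can only be entered from it.
  Cert : (V → V → Set) → V → List V → Set
  Cert A w R = w ∈ R × ∃ λ u → (∀ {a} → A a w → a ≡ u) × (∀ {a b} → A a b → a ∈ R → b ∈ R ⊎ b ≡ u)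

  Along : (V → V → Set) → List V → Set
  Along A xs = All (λ e → A (proj₁ e) (proj₂ e)) (pairs xs)

  module _ {A : V → V → Set} {w : V} {R : List V} where

    -- The path reaches `w` directly from `u`, so `u` is used up and the only way out of `R` is
    -- blocked for the rest of the path.
    cert-path : Cert A w R → ∀ x is y → Unique (x ∷ is ++ [ y ]) → Along A (x ∷ is ++ [ y ]) →
      w ∈ is ++ [ y ] → y ∈ R
    cert-path (w∈R , u , only , closed) = go
      where
      stay : ∀ v is y → u ∉ v ∷ is ++ [ y ] → Along A (v ∷ is ++ [ y ]) → v ∈ R → y ∈ R
      stay v [] y u∉ (a ∷ _) v∈ with closed a v∈
      ... | inj₁ p = p
      ... | inj₂ refl = ⊥-elim (u∉ (there (here refl)))
      stay v (i ∷ is) y u∉ (a ∷ al) v∈ with closed a v∈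
      ... | inj₁ p = stay i is y (u∉ ∘ there) al p
      ... | inj₂ refl = ⊥-elim (u∉ (there (here refl)))
      go : ∀ x is y → Unique (x ∷ is ++ [ y ]) → Along A (x ∷ is ++ [ y ]) → w ∈ is ++ [ y ] → y ∈ R
      go x [] y uq al (here refl) = w∈R
      go x (i ∷ is) y uq (a ∷ al) (here refl) with only a
      ... | refl = stay i is y (Unique[x∷xs]⇒x∉xs uq) al w∈R
      go x (i ∷ is) y (_ ∷ uq) (a ∷ al) (there j) = go i is y uq al j

    -- Traced backwards from `w`, the path could come from outside `R` only via `v`; but it steps
    -- from `w` to `v`, so `v` would occur twice.
    cert-path-op : Cert (flip A) w R → ∀ x is y → Unique (x ∷ is ++ [ y ]) → Along A (x ∷ is ++ [ y ]) →
      w ∈ x ∷ is → x ∈ R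
    cert-path-op (w∈R , v , only , closed) = go
      where
      go : ∀ x is y → Unique (x ∷ is ++ [ y ]) → Along A (x ∷ is ++ [ y ]) → w ∈ x ∷ is → x ∈ R
      go x is y uq al (here refl) = w∈R
      go x (i ∷ is) y uq@(_ ∷ uq') (a ∷ al) (there j) with closed a (go i is y uq' al j)
      ... | inj₁ p = p
      ... | inj₂ refl with pairs-has-tail (i ∷ is) y j
      ... | b , k with only (All.lookup al k)
      ... | refl = ⊥-elim (Unique[x∷xs]⇒x∉xs uq (there (pairs-head-∈ i (is ++ [ y ]) k)))

  -- A path meeting both vertices after its start would end in both `R` and `S`. The inclusions in
  -- `U` ensure that vertices attached later are new to both sets.
  Independent : (V → V → Set) → List V → V → V → Set
  Independent A U v w = ∃ λ R → ∃ λ S →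
    Cert A v R × Cert A w S × (∀ {x} → x ∈ R → x ∈ U) × (∀ {x} → x ∈ S → x ∈ U) × Disjoint R S

  Class : (V → V → Set) → List V → Set
  Class I C = ∀ {v w} → v ∈ C → w ∈ C → v ≢ w → I v w

  -- The classes are disjoint altogether, also across the two types, because the vertex colours are
  -- merged along all of them.
  record Savings (U : List V) (E : List (V × V)) : Set where
    field
      sClasses : List (List V)
      pClass   : List V
      unique   : Unique (pClass ++ concat sClasses)
      members  : ∀ {v} → v ∈ pClass ++ concat sClasses → v ∈ U
      sIndep   : All (Class (Independent (ArcIn E) U)) sClasses
      pIndep   : Class (Independent (flip (ArcIn E)) U) pClass

-- Merging colours along classes

excess : List (List A) → ℕ
excess [] = 0
excess (C ∷ Cs) = length C ∸ 1 + excess Cs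

-- `I` bounds which vertices may share a colour; every merging of colours enlarges it.
Quotient : ℕ → (Fin n → Fin n → Set) → Set
Quotient {n} N I = Σ (Fin n → Fin N) λ f → ∀ {v w} → f v ≡ f w → I v w

-- Colour `j` is sent to the slot of `i`, and `punchOut` closes the gap at `j`.
quotient-merge : ∀ {N I} ((f , _) : Quotient {n} N I) {i j : Fin N} → i ≢ j →
  ∃ λ N' → suc N' ≡ N × Quotient {n} N' (λ v w → I v w ⊎ ((f v ≡ i ⊎ f v ≡ j) × (f w ≡ i ⊎ f w ≡ j)))
quotient-merge {n} {suc N} {I} (f , clash) {i} {j} i≢j = N , refl , g , λ {v} {w} → g-clash v w
  where
  g : Fin n → Fin N
  g v with j ≟ f v
  ... | yes _ = punchOut (i≢j ∘ sym)
  ... | no ¬p = punchOut ¬p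
  g-clash : ∀ v w → g v ≡ g w → I v w ⊎ ((f v ≡ i ⊎ f v ≡ j) × (f w ≡ i ⊎ f w ≡ j))
  g-clash v w e with j ≟ f v | j ≟ f w
  ... | yes p | yes q = inj₂ (inj₂ (sym p) , inj₂ (sym q))
  ... | yes p | no ¬q = inj₂ (inj₂ (sym p) , inj₁ (sym (punchOut-injective (i≢j ∘ sym) ¬q e)))
  ... | no ¬p | yes q = inj₂ (inj₁ (punchOut-injective ¬p (i≢j ∘ sym) e) , inj₂ (sym q))
  ... | no ¬p | no ¬q = inj₁ (clash (punchOut-injective ¬p ¬q e))

quotient-class : ∀ {N I} ((f , _) : Quotient {n} N I) C → Unique C →
  (∀ {v y} → y ∈ C → f v ≡ f y → v ≡ y) →
  ∃ λ N' → N' + (length C ∸ 1) ≡ N × Quotient {n} N' (λ v w → I v w ⊎ (v ∈ C × w ∈ C))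
quotient-class {N = N} (f , clash) [] uq single = N , ℕₚ.+-identityʳ N , f , inj₁ ∘ clash
quotient-class {N = N} (f , clash) (z ∷ []) uq single = N , ℕₚ.+-identityʳ N , f , inj₁ ∘ clash
quotient-class {n} {N = N} {I} (f , clash) (z ∷ y ∷ ys) ((z≢y ∷ z≢ys) ∷ y≢ys ∷ uq) single
  -- The enlarged relation remembers the colours under `f`. With it, `single` still shows, after
  -- `z ∷ ys` has been merged, that `y` shares its colour with no other vertex.
  with quotient-class {I = λ v w → f v ≡ f w × I v w} (f , λ e → e , clash e) (z ∷ ys) (z≢ys ∷ uq)
         (λ { (here p) → single (here p) ; (there i) → single (there (there i)) })
... | N₁ , eq₁ , f₁ , clash₁ with quotient-merge (f₁ , clash₁) {f₁ y} {f₁ z} y≁z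
  where
  y≁z : f₁ y ≢ f₁ z
  y≁z e with clash₁ e
  ... | inj₁ (e' , _) = z≢y (sym (single (here refl) e'))
  ... | inj₂ (here p , _) = z≢y (sym p)
  ... | inj₂ (there i , _) = All.lookup y≢ys i refl
... | N₂ , refl , f₂ , clash₂ = N₂ , trans (ℕₚ.+-suc N₂ _) eq₁ , f₂ , λ e → final (clash₂ e)
  where
  widen : ∀ {v} → v ∈ z ∷ ys → v ∈ z ∷ y ∷ ys
  widen (here p) = here p
  widen (there i) = there (there i)
  inC : ∀ {v} → f₁ v ≡ f₁ y ⊎ f₁ v ≡ f₁ z → v ∈ z ∷ y ∷ ys
  inC (inj₁ e) with clash₁ e
  ... | inj₁ (e' , _) with single (there (here refl)) e'
  ... | refl = there (here refl)
  inC (inj₁ e) | inj₂ (i , _) = widen i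
  inC (inj₂ e) with clash₁ e
  ... | inj₁ (e' , _) with single (here refl) e'
  ... | refl = here refl
  inC (inj₂ e) | inj₂ (i , _) = widen i
  final : ∀ {v w} → ((f v ≡ f w × I v w) ⊎ (v ∈ z ∷ ys × w ∈ z ∷ ys)) ⊎
      ((f₁ v ≡ f₁ y ⊎ f₁ v ≡ f₁ z) × (f₁ w ≡ f₁ y ⊎ f₁ w ≡ f₁ z)) →
    I v w ⊎ (v ∈ z ∷ y ∷ ys × w ∈ z ∷ y ∷ ys)
  final (inj₁ (inj₁ (_ , i))) = inj₁ i
  final (inj₁ (inj₂ (i , j))) = inj₂ (widen i , widen j)
  final (inj₂ (i , j)) = inj₂ (inC i , inC j)

quotient-classes : ∀ (Cs : List (List (Fin n))) → Unique (concat Cs) →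
  ∃ λ N → N + excess Cs ≡ n × Quotient {n} N (λ v w → v ≡ w ⊎ Any (λ C → v ∈ C × w ∈ C) Cs)
quotient-classes {n} [] _ = n , ℕₚ.+-identityʳ n , id , inj₁
quotient-classes {n} (C ∷ Cs) uq with quotient-classes Cs (unique-++ʳ C uq)
... | N , eq , f , clash with quotient-class (f , clash) C (unique-++ˡ C uq) single
  where
  single : ∀ {v y} → y ∈ C → f v ≡ f y → v ≡ y
  single i e with clash e
  ... | inj₁ p = p
  ... | inj₂ a with find a
  ... | D , D∈ , _ , y∈ = ⊥-elim (unique-++-disjoint C uq (i , ∈-concat⁺′ y∈ D∈))
... | N' , eq' , g , clash' = N' ,
    trans (sym (ℕₚ.+-assoc N' (length C ∸ 1) (excess Cs))) (trans (cong (_+ excess Cs) eq') eq) ,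
    g , λ e → case clash' e of λ where
      (inj₁ (inj₁ p)) → inj₁ p
      (inj₁ (inj₂ a)) → inj₂ (there a)
      (inj₂ p) → inj₂ (here p)

-- Rainbow colourings from savings

module _ {n : ℕ} {U : List (Fin n)} {E : List (Fin n × Fin n)} {D : Digraph n}
  (D⊆E : ∀ {a b} → Arc D a b → (a , b) ∈ E) (connected : StronglyConnected D) (S : Savings U E) where
  open Savings S
  private
    V = Fin n

    -- Vertex colours are merged along `pClass` too, arc colours are not: a certificate for `flip`
    -- controls a path only if the path leaves the vertex, and a head may be the endpoint.
    qV = quotient-classes (pClass ∷ sClasses) unique
    qA = quotient-classes sClasses (unique-++ʳ pClass unique)
    NV = proj₁ qV
    NA = proj₁ qA

    colV : V → Fin NV
    colV = proj₁ (proj₂ (proj₂ qV))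

    colA : V → Fin NA
    colA = proj₁ (proj₂ (proj₂ qA))

    module _ {x y : V} (P : Path D x y) where
      along : Along (ArcIn E) (x ∷ inner P ++ [ y ])
      along = All.map D⊆E (Path.arcs P)

      s-apart : ∀ {v w} → v ∈ inner P ++ [ y ] → w ∈ inner P ++ [ y ] → v ≢ w →
        ¬ Any (λ C → v ∈ C × w ∈ C) sClasses
      s-apart i j v≢w a with find a
      ... | C , C∈ , v∈ , w∈ with All.lookup sIndep C∈ v∈ w∈ v≢w
      ... | R , S , cR , cS , _ , _ , dj =
        dj (cert-path cR x (inner P) y (Path.distinct P) along i , cert-path cS x (inner P) y (Path.distinct P) along j)

      p-apart : ∀ {v w} → v ∈ x ∷ inner P → w ∈ x ∷ inner P → v ≢ w → ¬ (v ∈ pClass × w ∈ pClass)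
      p-apart i j v≢w (v∈ , w∈) with pIndep v∈ w∈ v≢w
      ... | R , S , cR , cS , _ , _ , dj =
        dj (cert-path-op cR x (inner P) y (Path.distinct P) along i , cert-path-op cS x (inner P) y (Path.distinct P) along j)

      unique-heads : Unique (inner P ++ [ y ])
      unique-heads = unique-tail (Path.distinct P)

      vertex-rainbow : Unique (map colV (inner P))
      vertex-rainbow = unique-map colV (unique-++ˡ (inner P) unique-heads) λ i j v≢w e →
        case proj₂ (proj₂ (proj₂ qV)) e of λ where
          (inj₁ p) → v≢w p
          (inj₂ (here p)) → p-apart (there i) (there j) v≢w p
          (inj₂ (there a)) → s-apart (∈-++⁺ˡ i) (∈-++⁺ˡ j) v≢w a

      arc-rainbow : Unique (map colA (inner P ++ [ y ]))
      arc-rainbow = unique-map colA unique-heads λ i j v≢w e →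
        case proj₂ (proj₂ (proj₂ qA)) e of λ where
          (inj₁ p) → v≢w p
          (inj₂ a) → s-apart i j v≢w a

  -- Every path is rainbow for this colouring, so any path supplied by strong connectivity will do.
  rvc-upper : ∃ λ N → N + excess (pClass ∷ sClasses) ≡ n × RainbowVertexConnected D N
  rvc-upper = NV , proj₁ (proj₂ qV) , colV , λ x y x≢y → connected x y x≢y , vertex-rainbow (connected x y x≢y)

  -- Vertices and arcs get disjoint palettes of sizes `N` and `M`; the excess of `sClasses` is
  -- subtracted in both, that of `pClass` in `N` alone.
  trc-upper : ∃ λ N → ∃ λ M → N + excess (pClass ∷ sClasses) ≡ n × M + excess sClasses ≡ n ×
    TotalRainbowConnected D (N + M)
  trc-upper = NV , NA , proj₁ (proj₂ qV) , proj₁ (proj₂ qA) , (λ v → colV v ↑ˡ NA) , (λ a b → NV ↑ʳ colA b) ,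
    λ x y x≢y → connected x y x≢y , rainbow (connected x y x≢y)
    where
    rainbow : ∀ {x y} (P : Path D x y) → Unique (map (λ v → colV v ↑ˡ NA) (inner P) ++
      map (λ p → NV ↑ʳ colA (proj₂ p)) (pairs (x ∷ inner P ++ [ y ])))
    rainbow {x} {y} P = Uniqueₚ.++⁺
      (subst Unique (sym (map-∘ (inner P))) (Uniqueₚ.map⁺ (↑ˡ-injective NA _ _) (vertex-rainbow P)))
      (subst Unique (trans (trans (sym (map-∘ (inner P ++ [ y ])))
            (cong (map (λ v → NV ↑ʳ colA v)) (sym (map-proj₂-pairs x (inner P ++ [ y ])))))
            (sym (map-∘ (pairs (x ∷ inner P ++ [ y ])))))
          (Uniqueₚ.map⁺ (↑ʳ-injective NV _ _) (arc-rainbow P)))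
      λ { (i , j) → case ∈-map⁻ _ i of λ { (v , _ , refl) → case ∈-map⁻ _ j of λ { (e , _ , eq) →
          ↑ˡ≢↑ʳ (colV v) (colA (proj₂ e)) eq } } }
      where
      ↑ˡ≢↑ʳ : ∀ {k l} (i : Fin k) (j : Fin l) → i ↑ˡ l ≢ k ↑ʳ j
      ↑ˡ≢↑ʳ (suc i) j e = ↑ˡ≢↑ʳ i j (suc-injective e)

-- Independence and distances under attaching a cycle

last⁺ : A → List A → A
last⁺ x [] = x
last⁺ x (y ∷ ys) = last⁺ y ys

last⁺-∈ : ∀ (x : A) xs → last⁺ x xs ∈ x ∷ xs
last⁺-∈ x [] = here refl
last⁺-∈ x (y ∷ ys) = there (last⁺-∈ y ys)

last⁺-closes : ∀ (x : A) xs y → (last⁺ x xs , y) ∈ pairs (x ∷ xs ++ [ y ])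
last⁺-closes x [] y = here refl
last⁺-closes x (z ∷ zs) y = there (last⁺-closes z zs y)

pairs-next : ∀ (x : A) xs {v} → v ∈ x ∷ xs → v ≢ last⁺ x xs → ∃ λ w → (v , w) ∈ pairs (x ∷ xs)
pairs-next x [] (here refl) v≢ = ⊥-elim (v≢ refl)
pairs-next x (y ∷ ys) (here refl) v≢ = y , here refl
pairs-next x (y ∷ ys) (there i) v≢ = let w , j = pairs-next y ys i v≢ in w , there j

pairs-snoc : ∀ (x : A) xs y {a b} → (a , b) ∈ pairs (x ∷ xs ++ [ y ]) → (a , b) ∈ pairs (x ∷ xs) ⊎ b ≡ y
pairs-snoc x [] y (here refl) = inj₂ refl
pairs-snoc x (z ∷ zs) y (here refl) = inj₁ (here refl)
pairs-snoc x (z ∷ zs) y (there i) with pairs-snoc z zs y i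
... | inj₁ j = inj₁ (there j)
... | inj₂ e = inj₂ e

module _ {n : ℕ} where
  private V = Fin n

  position : List V → V → ℕ
  position [] v = 0
  position (x ∷ xs) v with v ≟ x
  ... | yes _ = 0
  ... | no _ = suc (position xs v)

  position-head : ∀ x xs → position (x ∷ xs) x ≡ 0
  position-head x xs with x ≟ x
  ... | yes _ = refl
  ... | no ¬p = ⊥-elim (¬p refl)

  position-tail : ∀ {x xs v} → v ≢ x → position (x ∷ xs) v ≡ suc (position xs v)
  position-tail {x} {xs} {v} v≢x with v ≟ x
  ... | yes p = ⊥-elim (v≢x p)
  ... | no _ = refl

  position-pairs : ∀ {xs : List V} → Unique xs → ∀ {a b} → (a , b) ∈ pairs xs →
    position xs b ≡ suc (position xs a)
  position-pairs {x ∷ y ∷ xs} ((x≢y ∷ _) ∷ _) (here refl)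
    rewrite position-head x (y ∷ xs) | position-tail {x} {y ∷ xs} (x≢y ∘ sym) | position-head y xs = refl
  position-pairs {x ∷ y ∷ xs} (x≢ ∷ uq) {a} {b} (there i)
    rewrite position-tail {x} {y ∷ xs} {a} (λ { refl → All.lookup x≢ (proj₁ (pairs-∈ (y ∷ xs) i)) refl })
          | position-tail {x} {y ∷ xs} {b} (λ { refl → All.lookup x≢ (proj₂ (pairs-∈ (y ∷ xs) i)) refl })
    = cong suc (position-pairs uq i)

  position-last : ∀ x xs → Unique (x ∷ xs) → position (x ∷ xs) (last⁺ x xs) ≡ length xs
  position-last x [] uq = position-head x []
  position-last x (y ∷ ys) (x≢ ∷ uq)
    rewrite position-tail {x} {y ∷ ys} {last⁺ y ys} (λ e → All.lookup x≢ (last⁺-∈ y ys) (sym e))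
    = cong suc (position-last y ys uq)

  position-snoc : ∀ xs {y} → y ∉ xs → position (xs ++ [ y ]) y ≡ length xs
  position-snoc [] {y} y∉ = position-head y []
  position-snoc (x ∷ xs) {y} y∉ rewrite position-tail {x} {xs ++ [ y ]} (λ e → y∉ (here e))
    = cong suc (position-snoc xs (y∉ ∘ there))

  -- φ grows by at most 1 along arcs, so every path from x to y is Hamiltonian on U.
  Spread : List V → List (V × V) → V → V → Set
  Spread U E x y = Σ (V → ℕ) λ φ → (∀ {a b} → (a , b) ∈ E → φ b ≤ suc (φ a)) × length U + φ x ≤ suc (φ y)

  module Attach {U : List V} {E : List (V × V)} {q : ℕ} {u w₁ w₂ : V} {ws : List V} (bt : Built U E q)
    (u∈ : u ∈ U) (uq : Unique (w₁ ∷ w₂ ∷ ws)) (dj : Disjoint (w₁ ∷ w₂ ∷ ws) U) where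

    cs : List V
    cs = w₁ ∷ w₂ ∷ ws

    new E' : List (V × V)
    new = cyc u cs
    E' = new ++ E

    U' : List V
    U' = cs ++ U

    built' : Built U' E' (suc q)
    built' = attach bt u∈ uq dj

    uq' : Unique (u ∷ cs)
    uq' = attach-unique u∈ uq dj

    wₗ : V
    wₗ = last⁺ w₂ ws

    w₁∈ : w₁ ∈ cs
    w₁∈ = here refl

    wₗ∈ : wₗ ∈ cs
    wₗ∈ = there (last⁺-∈ w₂ ws)

    w₁≢wₗ : w₁ ≢ wₗ
    w₁≢wₗ e = Unique[x∷xs]⇒x∉xs uq (subst (_∈ w₂ ∷ ws) (sym e) (last⁺-∈ w₂ ws))

    new-arc : ∀ {a b} → (a , b) ∈ E' → (a , b) ∈ E ⊎ (a , b) ∈ new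
    new-arc i with ∈-++⁻ new i
    ... | inj₁ j = inj₂ j
    ... | inj₂ j = inj₁ j

    apart : ∀ {v w} → v ∈ cs → w ∈ U → v ≢ w
    apart i j refl = dj (i , j)

    in-new : ∀ {a w} → w ∈ cs → (a , w) ∈ E' → (a , w) ∈ new
    in-new i j with new-arc j
    ... | inj₂ k = k
    ... | inj₁ k = ⊥-elim (dj (i , proj₂ (built-arcs bt k)))

    into-w₁ : ∀ {a} → (a , w₁) ∈ E' → a ≡ u
    into-w₁ i = cyc-in-unique u cs uq' (in-new w₁∈ i) (here refl)

    from-wₗ : ∀ {b} → (wₗ , b) ∈ E' → b ≡ u
    from-wₗ i with new-arc i
    ... | inj₁ k = ⊥-elim (dj (wₗ∈ , proj₁ (built-arcs bt k)))
    ... | inj₂ k = cyc-out-unique u cs uq' k (there (there (last⁺-closes w₂ ws u)))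

    -- If a later cycle is attached at `v`, this successor and the first vertex of that cycle are
    -- both entered only from `v`, which yields a new saving.
    next : ∀ {v} → v ∈ cs → v ≢ wₗ → ∃ λ w → w ∈ cs × w ≢ w₁ × w ≢ v × (∀ {a} → (a , w) ∈ E' → a ≡ v)
    next {v} i v≢ with pairs-next w₁ (w₂ ∷ ws) i v≢
    ... | w , j = w , w∈ , w≢w₁ , w≢v , λ k → cyc-in-unique u cs uq' (in-new w∈ k) j'
      where
      w∈ = proj₂ (pairs-∈ cs j)
      j' : (v , w) ∈ new
      j' = there (pairs-++ˡ cs [ u ] j)
      w≢v : w ≢ v
      w≢v refl = pairs-irreflexive uq j
      w≢w₁ : w ≢ w₁
      w≢w₁ refl with cyc-in-unique u cs uq' j' (here refl)
      ... | refl = dj (i , u∈)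

    -- If `u` lies in the set, the new cycle opens an exit from it at `u`; absorbing the cycle
    -- closes this exit again.
    grow : List V → List V
    grow R with u ∈ᵥ? R
    ... | yes _ = cs ++ R
    ... | no _ = R

    grow-old : ∀ {R v} → v ∈ R → v ∈ grow R
    grow-old {R} i with u ∈ᵥ? R
    ... | yes _ = ∈-++⁺ʳ cs i
    ... | no _ = i

    grow-new : ∀ {R v} → u ∈ R → v ∈ cs → v ∈ grow R
    grow-new {R} u∈R i with u ∈ᵥ? R
    ... | yes _ = ∈-++⁺ˡ i
    ... | no ¬p = ⊥-elim (¬p u∈R)

    grow-∈ : ∀ {R v} → v ∈ grow R → v ∈ R ⊎ (v ∈ cs × u ∈ R)
    grow-∈ {R} i with u ∈ᵥ? R
    ... | no _ = inj₁ i
    ... | yes p with ∈-++⁻ cs i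
    ... | inj₁ j = inj₂ (j , p)
    ... | inj₂ j = inj₁ j

    grow-⊆ : ∀ {R} → (∀ {x} → x ∈ R → x ∈ U) → ∀ {x} → x ∈ grow R → x ∈ U'
    grow-⊆ h i with grow-∈ i
    ... | inj₁ j = ∈-++⁺ʳ cs (h j)
    ... | inj₂ (j , _) = ∈-++⁺ˡ j

    grow-disjoint : ∀ {R S} → (∀ {x} → x ∈ R → x ∈ U) → (∀ {x} → x ∈ S → x ∈ U) →
      Disjoint R S → Disjoint (grow R) (grow S)
    grow-disjoint r s d (i , j) with grow-∈ i | grow-∈ j
    ... | inj₁ k | inj₁ l = d (k , l)
    ... | inj₁ k | inj₂ (l , _) = dj (l , r k)
    ... | inj₂ (k , _) | inj₁ l = dj (k , s l)
    ... | inj₂ (_ , k) | inj₂ (_ , l) = d (k , l)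

    -- Certificate set for an old vertex entered only from `u`: what remains of the old part can be
    -- left only towards `u`.
    others : List V
    others = filter (λ v → ¬? (v ≟ u)) U

    -- The two instances are the arc relation and its converse.
    module Certs (A A' : V → V → Set)
      (A⊆U : ∀ {a b} → A a b → a ∈ U × b ∈ U)
      (A'⊆ : ∀ {a b} → A' a b → A a b ⊎ (a ∈ u ∷ cs × b ∈ u ∷ cs)) where

      cert-grow : ∀ {w R} → (∀ {x} → x ∈ R → x ∈ U) → w ≢ u → Cert A w R → Cert A' w (grow R)
      cert-grow {w} {R} R⊆U w≢u (w∈R , v , only , closed) = grow-old w∈R , v , only' , closed'
        where
        only' : ∀ {a} → A' a w → a ≡ v
        only' a with A'⊆ a
        ... | inj₁ o = only o
        ... | inj₂ (_ , k) = ⊥-elim (w≢u (cyc-old u∈ uq dj k (R⊆U w∈R)))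
        closed' : ∀ {a b} → A' a b → a ∈ grow R → b ∈ grow R ⊎ b ≡ v
        closed' a i with A'⊆ a | grow-∈ {R} i
        ... | inj₁ o | inj₁ j = [ inj₁ ∘ grow-old , inj₂ ]′ (closed o j)
        ... | inj₁ o | inj₂ (j , _) = ⊥-elim (dj (j , proj₁ (A⊆U o)))
        ... | inj₂ (_ , here refl) | inj₂ (_ , u∈R) = inj₁ (grow-old u∈R)
        ... | inj₂ (_ , there k) | inj₂ (_ , u∈R) = inj₁ (grow-new u∈R k)
        ... | inj₂ (k , l) | inj₁ j with cyc-old u∈ uq dj k (R⊆U j) | l
        ... | refl | here refl = inj₁ i
        ... | refl | there m = inj₁ (grow-new j m)

      cert-new : ∀ {w} → w ∈ cs → (∀ {a} → A' a w → a ≡ u) → Cert A' w cs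
      cert-new w∈ only = w∈ , u , only , closed
        where
        closed : ∀ {a b} → A' a b → a ∈ cs → b ∈ cs ⊎ b ≡ u
        closed a i with A'⊆ a
        ... | inj₁ o = ⊥-elim (dj (i , proj₁ (A⊆U o)))
        ... | inj₂ (_ , here p) = inj₂ p
        ... | inj₂ (_ , there k) = inj₁ k

      cert-others : ∀ {w} → w ∈ U → w ≢ u → (∀ {a} → A a w → a ≡ u) → Cert A' w others
      cert-others {w} w∈ w≢u only = ∈-filter⁺ _ w∈ w≢u , u , only' , closed
        where
        only' : ∀ {a} → A' a w → a ≡ u
        only' a with A'⊆ a
        ... | inj₁ o = only o
        ... | inj₂ (_ , k) = ⊥-elim (w≢u (cyc-old u∈ uq dj k w∈))
        closed : ∀ {a b} → A' a b → a ∈ others → b ∈ others ⊎ b ≡ u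
        closed {a} {b} r i with A'⊆ r | ∈-filter⁻ (λ v → ¬? (v ≟ u)) {xs = U} i
        ... | inj₂ (k , _) | j , a≢u = ⊥-elim (a≢u (cyc-old u∈ uq dj k j))
        ... | inj₁ o | _ with b ≟ u
        ... | yes p = inj₂ p
        ... | no ¬p = inj₁ (∈-filter⁺ _ (proj₂ (A⊆U o)) ¬p)

      indep-keep : ∀ {v w} → v ≢ u → w ≢ u → Independent A U v w → Independent A' U' v w
      indep-keep v≢ w≢ (R , S , cR , cS , r , s , d) =
        grow R , grow S , cert-grow r v≢ cR , cert-grow s w≢ cS , grow-⊆ r , grow-⊆ s , grow-disjoint r s d

      -- Since `u` is outside `S`, growing adds nothing, and `S` stays disjoint from the new cycle,
      -- which certifies `s`.
      indep-new : ∀ {s w S} → s ∈ cs → (∀ {a} → A' a s → a ≡ u) →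
        (∀ {x} → x ∈ S → x ∈ U) → Cert A w S → u ∉ S → Independent A' U' s w
      indep-new {s} {w} {S} s∈ only S⊆U cS u∉ =
        cs , grow S , cert-new s∈ only , cert-grow S⊆U (λ { refl → u∉ (proj₁ cS) }) cS , ∈-++⁺ˡ , grow-⊆ S⊆U , d
        where
        d : Disjoint cs (grow S)
        d (i , j) with grow-∈ {S} j
        ... | inj₁ k = dj (i , S⊆U k)
        ... | inj₂ (_ , k) = u∉ k

      -- Siblings with common sole in-neighbour `u`: the new vertices certify one, the old vertices
      -- other than `u` the other.
      indep-others : ∀ {s w} → s ∈ cs → (∀ {a} → A' a s → a ≡ u) →
        w ∈ U → w ≢ u → (∀ {a} → A a w → a ≡ u) → Independent A' U' s w
      indep-others {s} {w} s∈ only w∈ w≢ only' = cs , others , cert-new s∈ only , cert-others w∈ w≢ only' ,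
        ∈-++⁺ˡ , (λ i → ∈-++⁺ʳ cs (proj₁ (∈-filter⁻ (λ v → ¬? (v ≟ u)) {xs = U} i))) ,
        λ (i , j) → dj (i , proj₁ (∈-filter⁻ (λ v → ¬? (v ≟ u)) {xs = U} j))

    arcs-split : ∀ {a b} → (a , b) ∈ E' → (a , b) ∈ E ⊎ (a ∈ u ∷ cs × b ∈ u ∷ cs)
    arcs-split i with new-arc i
    ... | inj₁ j = inj₁ j
    ... | inj₂ j = inj₂ (cyc-∈ u cs uq' j)

    module S = Certs (ArcIn E) (ArcIn E') (built-arcs bt) arcs-split
    module P = Certs (flip (ArcIn E)) (flip (ArcIn E')) (swap ∘ built-arcs bt) (map₂ swap ∘ arcs-split)

    -- Only `u` loses its single neighbour in the attachment. Its substitute is `w₁`, entered only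
    -- from `u`, or dually `wₗ`, left only towards `u`.
    replace : V → V → V
    replace s v with v ≟ u
    ... | yes _ = s
    ... | no _ = v

    replace-∈ : ∀ {s v} → s ∈ cs → v ∈ U → replace s v ∈ U'
    replace-∈ {s} {v} s∈ v∈ with v ≟ u
    ... | yes _ = ∈-++⁺ˡ s∈
    ... | no _ = ∈-++⁺ʳ cs v∈

    replace-injective : ∀ {s t v w} → s ∈ cs → t ∈ cs → v ∈ U → w ∈ U → replace s v ≡ replace t w → v ≡ w
    replace-injective {s} {t} {v} {w} s∈ t∈ v∈ w∈ e with v ≟ u | w ≟ u
    ... | yes refl | yes refl = refl
    ... | yes _ | no _ = ⊥-elim (apart s∈ w∈ e)
    ... | no _ | yes _ = ⊥-elim (apart t∈ v∈ (sym e))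
    ... | no _ | no _ = e

    module _ {A A' : V → V → Set} {s : V} (s∈ : s ∈ cs) (onlyu : ∀ {a} → A' a s → a ≡ u)
      (A⊆U : ∀ {a b} → A a b → a ∈ U × b ∈ U)
      (A'⊆ : ∀ {a b} → A' a b → A a b ⊎ (a ∈ u ∷ cs × b ∈ u ∷ cs)) where
      private module C = Certs A A' A⊆U A'⊆

      -- If one vertex is `u`, its own set contains `u`; the disjoint set of the other then avoids
      -- `u`, as `indep-new` requires.
      indep-replace : ∀ {v w} → v ≢ w → Independent A U v w → Independent A' U' (replace s v) (replace s w)
      indep-replace {v} {w} v≢w I@(R , S , cR , cS , r , t , d) with v ≟ u | w ≟ u
      ... | yes refl | yes refl = ⊥-elim (v≢w refl)
      ... | no v≢u | no w≢u = C.indep-keep v≢u w≢u I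
      ... | yes refl | no w≢u = C.indep-new s∈ onlyu t cS λ k → d (proj₁ cR , k)
      ... | no v≢u | yes refl with C.indep-new s∈ onlyu r cR (λ k → d (k , proj₁ cS))
      ... | R' , S' , cR' , cS' , r' , t' , d' = S' , R' , cS' , cR' , t' , r' , λ (i , j) → d' (j , i)

      class-replace : ∀ {C} → Class (Independent A U) C → Class (Independent A' U') (map (replace s) C)
      class-replace h i j v≢w with ∈-map⁻ (replace s) i | ∈-map⁻ (replace s) j
      ... | v , v∈ , refl | w , w∈ , refl = indep-replace (v≢w ∘ cong (replace s)) (h v∈ w∈ (v≢w ∘ cong (replace s)))

    excess-map : ∀ (f : V → V) Cs → excess (map (map f) Cs) ≡ excess Cs
    excess-map f [] = refl
    excess-map f (C ∷ Cs) = cong₂ (λ k l → k ∸ 1 + l) (length-map f C) (excess-map f Cs)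

    -- Class sizes survive because `u` is exchanged for a vertex that did not exist before; as `u`
    -- occurs at most once over all classes, no collision arises between the two kinds of
    -- substitute.
    savings-attach : (S : Savings U E) → Σ (Savings U' E') λ S' →
      excess (Savings.sClasses S') ≡ excess (Savings.sClasses S) ×
      length (Savings.pClass S') ≡ length (Savings.pClass S)
    savings-attach S = record
        { sClasses = map (map (replace w₁)) sClasses
        ; pClass = map (replace wₗ) pClass
        ; unique = subst (λ l → Unique (map (replace wₗ) pClass ++ l)) (sym (concat-map sClasses))
            (Uniqueₚ.++⁺
              (unique-map _ (unique-++ˡ pClass unique) λ i j v≢w e →
                v≢w (replace-injective wₗ∈ wₗ∈ (pIn i) (pIn j) e))
              (unique-map _ (unique-++ʳ pClass unique) λ i j v≢w e →
                v≢w (replace-injective w₁∈ w₁∈ (sIn i) (sIn j) e))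
              cross)
        ; members = mem
        ; sIndep = Allₚ.map⁺ (All.map (class-replace w₁∈ into-w₁ (built-arcs bt) arcs-split) sIndep)
        ; pIndep = class-replace wₗ∈ from-wₗ (swap ∘ built-arcs bt) (map₂ swap ∘ arcs-split) pIndep }
      , excess-map (replace w₁) sClasses , length-map (replace wₗ) pClass
      where
      open Savings S
      pIn : ∀ {v} → v ∈ pClass → v ∈ U
      pIn i = members (∈-++⁺ˡ i)
      sIn : ∀ {v} → v ∈ concat sClasses → v ∈ U
      sIn i = members (∈-++⁺ʳ pClass i)
      cross : Disjoint (map (replace wₗ) pClass) (map (replace w₁) (concat sClasses))
      cross (i , j) with ∈-map⁻ (replace wₗ) i | ∈-map⁻ (replace w₁) j
      ... | v , v∈ , refl | w , w∈ , e with replace-injective wₗ∈ w₁∈ (pIn v∈) (sIn w∈) e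
      ... | refl = unique-++-disjoint pClass unique (v∈ , w∈)
      mem : ∀ {v} → v ∈ map (replace wₗ) pClass ++ concat (map (map (replace w₁)) sClasses) → v ∈ U'
      mem i with ∈-++⁻ (map (replace wₗ) pClass) i
      ... | inj₁ j with ∈-map⁻ (replace wₗ) j
      ... | w , w∈ , refl = replace-∈ wₗ∈ (pIn w∈)
      mem i | inj₂ j with ∈-map⁻ (replace w₁) (subst (_ ∈_) (concat-map sClasses) j)
      ... | w , w∈ , refl = replace-∈ w₁∈ (sIn w∈)

    extend : (V → ℕ) → (V → ℕ) → V → ℕ
    extend ψ φ v with v ∈ᵥ? cs
    ... | yes _ = ψ v
    ... | no _ = φ v

    extend-new : ∀ ψ φ {v} → v ∈ cs → extend ψ φ v ≡ ψ v
    extend-new ψ φ {v} i with v ∈ᵥ? cs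
    ... | yes _ = refl
    ... | no ¬p = ⊥-elim (¬p i)

    extend-old : ∀ ψ φ {v} → v ∈ U → extend ψ φ v ≡ φ v
    extend-old ψ φ {v} i with v ∈ᵥ? cs
    ... | yes p = ⊥-elim (dj (p , i))
    ... | no _ = refl

    extend-lipschitz : ∀ ψ φ → ψ u ≡ φ u → (∀ {a b} → (a , b) ∈ E → φ b ≤ suc (φ a)) →
      (∀ {a b} → (a , b) ∈ new → ψ b ≤ suc (ψ a)) →
      ∀ {a b} → (a , b) ∈ E' → extend ψ φ b ≤ suc (extend ψ φ a)
    extend-lipschitz ψ φ eq old nw = go
      where
      on-cycle : ∀ {v} → v ∈ u ∷ cs → extend ψ φ v ≡ ψ v
      on-cycle (here refl) = trans (extend-old ψ φ u∈) (sym eq)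
      on-cycle (there k) = extend-new ψ φ k
      go : ∀ {a b} → (a , b) ∈ E' → extend ψ φ b ≤ suc (extend ψ φ a)
      go {a} {b} i with new-arc i
      ... | inj₁ j rewrite extend-old ψ φ (proj₁ (built-arcs bt j)) | extend-old ψ φ (proj₂ (built-arcs bt j)) = old j
      ... | inj₂ j rewrite on-cycle (proj₁ (cyc-∈ u cs uq' j)) | on-cycle (proj₂ (cyc-∈ u cs uq' j)) = nw j

    -- The potential goes on rising by one along the new cycle, starting at `u`; its closing arc
    -- back to `u` goes down, which costs nothing.
    spread-back : ∀ {x} → x ∈ U → Spread U E x u → Spread U' E' x wₗ
    spread-back {x} x∈ (φ , lip , len) = extend ψ φ , extend-lipschitz ψ φ ψu lip lip' , goal
      where
      ψ : V → ℕ
      ψ v = φ u + position (u ∷ cs) v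
      ψu : ψ u ≡ φ u
      ψu rewrite position-head u cs = ℕₚ.+-identityʳ (φ u)
      lip' : ∀ {a b} → (a , b) ∈ new → ψ b ≤ suc (ψ a)
      lip' {a} {b} i with pairs-snoc u cs u i
      ... | inj₁ j rewrite position-pairs uq' j = ℕₚ.≤-reflexive (ℕₚ.+-suc (φ u) _)
      ... | inj₂ refl rewrite ψu = ℕₚ.m≤n⇒m≤1+n (ℕₚ.m≤m+n (φ u) _)
      goal : length (cs ++ U) + extend ψ φ x ≤ suc (extend ψ φ wₗ)
      goal = begin
        length (cs ++ U) + extend ψ φ x  ≡⟨ cong₂ _+_ (length-++ cs {U}) (extend-old ψ φ x∈) ⟩
        length cs + length U + φ x       ≡⟨ ℕₚ.+-assoc (length cs) _ _ ⟩
        length cs + (length U + φ x)     ≤⟨ ℕₚ.+-monoʳ-≤ (length cs) len ⟩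
        length cs + suc (φ u)            ≡⟨ ℕₚ.+-comm (length cs) _ ⟩
        suc (φ u) + length cs            ≡⟨ cong (λ k → suc (φ u + k)) (position-last u cs uq') ⟨
        suc (ψ wₗ)                       ≡⟨ cong suc (extend-new ψ φ wₗ∈) ⟨
        suc (extend ψ φ wₗ)              ∎
        where open ℕₚ.≤-Reasoning

    -- The old potential is lifted by the number of new vertices. The new cycle climbs from `w₁` up
    -- to `u`, and the arc from `u` to `w₁` goes down.
    spread-front : ∀ {y} → y ∈ U → Spread U E u y → Spread U' E' w₁ y
    spread-front {y} y∈ (φ , lip , len) =
      extend ψ φ' , extend-lipschitz ψ φ' ψu lipφ' lip' , goal
      where
      ψ φ' : V → ℕ
      ψ v = φ u + position (cs ++ [ u ]) v
      φ' v = length cs + φ v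
      lipφ' : ∀ {a b} → (a , b) ∈ E → φ' b ≤ suc (φ' a)
      lipφ' {a} {b} i = subst (φ' b ≤_) (ℕₚ.+-suc (length cs) (φ a)) (ℕₚ.+-monoʳ-≤ (length cs) (lip i))
      ψu : ψ u ≡ φ' u
      ψu rewrite position-snoc cs (Unique[x∷xs]⇒x∉xs uq') = ℕₚ.+-comm (φ u) (length cs)
      lip' : ∀ {a b} → (a , b) ∈ new → ψ b ≤ suc (ψ a)
      lip' (here refl) rewrite position-head w₁ (w₂ ∷ ws ++ [ u ]) | ℕₚ.+-identityʳ (φ u) = ℕₚ.m≤n⇒m≤1+n (ℕₚ.m≤m+n (φ u) _)
      lip' (there i) rewrite position-pairs (unique-rotate uq') i = ℕₚ.≤-reflexive (ℕₚ.+-suc (φ u) _)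
      goal : length (cs ++ U) + extend ψ φ' w₁ ≤ suc (extend ψ φ' y)
      ψw₁ : ψ w₁ ≡ φ u
      ψw₁ = trans (cong (φ u +_) (position-head w₁ (w₂ ∷ ws ++ [ u ]))) (ℕₚ.+-identityʳ (φ u))
      goal = begin
        length (cs ++ U) + extend ψ φ' w₁  ≡⟨ cong₂ _+_ (length-++ cs {U}) (trans (extend-new ψ φ' w₁∈) ψw₁) ⟩
        length cs + length U + φ u         ≡⟨ ℕₚ.+-assoc (length cs) _ _ ⟩
        length cs + (length U + φ u)       ≤⟨ ℕₚ.+-monoʳ-≤ (length cs) len ⟩
        length cs + suc (φ y)              ≡⟨ ℕₚ.+-suc (length cs) _ ⟩
        suc (φ' y)                         ≡⟨ cong suc (extend-old ψ φ' y∈) ⟨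
        suc (extend ψ φ' y)                ∎
        where open ℕₚ.≤-Reasoning

-- No cactus between a Hamiltonian path and five savings

module _ {n : ℕ} where
  private V = Fin n

  independent-sym : ∀ {A : V → V → Set} {U v w} → Independent A U v w → Independent A U w v
  independent-sym (R , S , cR , cS , r , s , d) = S , R , cS , cR , s , r , λ (i , j) → d (j , i)

  class-pair : ∀ {A : V → V → Set} {U v w} → Independent A U v w → Class (Independent A U) (v ∷ w ∷ [])
  class-pair I (here refl) (here refl) v≢w = ⊥-elim (v≢w refl)
  class-pair I (here refl) (there (here refl)) v≢w = I
  class-pair I (there (here refl)) (here refl) v≢w = independent-sym I
  class-pair I (there (here refl)) (there (here refl)) v≢w = ⊥-elim (v≢w refl)

  class-cons : ∀ {A : V → V → Set} {U v C} → (∀ {w} → w ∈ C → Independent A U v w) →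
    Class (Independent A U) C → Class (Independent A U) (v ∷ C)
  class-cons h c (here refl) (here refl) v≢w = ⊥-elim (v≢w refl)
  class-cons h c (here refl) (there j) v≢w = h j
  class-cons h c (there i) (here refl) v≢w = independent-sym (h i)
  class-cons h c (there i) (there j) v≢w = c i j v≢w

  independent-∈ : ∀ {A : V → V → Set} {U v w} → Independent A U v w → v ∈ U × w ∈ U
  independent-∈ (R , S , cR , cS , r , s , d) = r (proj₁ cR) , s (proj₁ cS)

  -- An end cycle without its cut vertex, entered at `s` and left at `p`. The field `succ` keeps a
  -- sibling ready for a cycle attached inside it.
  record Leaf (U : List V) (E : List (V × V)) (L : List V) (s p : V) : Set where
    field
      s∈   : s ∈ L
      p∈   : p ∈ L
      s≢p  : s ≢ p
      L⊆U  : ∀ {v} → v ∈ L → v ∈ U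
      cs   : Cert (ArcIn E) s L
      cp   : Cert (flip (ArcIn E)) p L
      succ : ∀ {v} → v ∈ L → v ≢ p → ∃ λ w → w ∈ L × w ≢ s × w ≢ v × (∀ {a} → (a , w) ∈ E → a ≡ v)

  record Ends (U : List V) (E : List (V × V)) : Set where
    field
      {L₁ L₂} : List V
      {s₁ p₁ s₂ p₂} : V
      leaf₁   : Leaf U E L₁ s₁ p₁
      leaf₂   : Leaf U E L₂ s₂ p₂
      L₁#L₂   : Disjoint L₁ L₂
      spread₁ : Spread U E s₁ p₂
    module L₁ = Leaf leaf₁
    module L₂ = Leaf leaf₂
    s-indep : Independent (ArcIn E) U s₁ s₂
    s-indep = L₁ , L₂ , L₁.cs , L₂.cs , L₁.L⊆U , L₂.L⊆U , L₁#L₂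
    p-indep : Independent (flip (ArcIn E)) U p₁ p₂
    p-indep = L₁ , L₂ , L₁.cp , L₂.cp , L₁.L⊆U , L₂.L⊆U , L₁#L₂
    L₁≢L₂ : ∀ {v w} → v ∈ L₁ → w ∈ L₂ → v ≢ w
    L₁≢L₂ i j refl = L₁#L₂ (i , j)

  -- The initial state, two cycles at one vertex: here Hamiltonian paths run in both directions, so
  -- either leaf may still become the front or the back of a chain.
  record Pair (U : List V) (E : List (V × V)) : Set where
    field
      ends : Ends U E
    open Ends ends public
    field
      spread₂ : Spread U E s₂ p₁

  -- The direction is now fixed, from `leaf₁` to `leaf₂`. The spare `x` is held in reserve as a
  -- partner of `s₁`; lying outside `L₂`, it is untouched by a cycle attached there.
  record Chain (U : List V) (E : List (V × V)) : Set where
    field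
      ends : Ends U E
    open Ends ends public
    field
      {x}  : V
      {X}  : List V
      cx   : Cert (ArcIn E) x X
      X⊆U  : ∀ {v} → v ∈ X → v ∈ U
      L₁#X : Disjoint L₁ X
      x∉L₂ : x ∉ L₂
    x∈U : x ∈ U
    x∈U = X⊆U (proj₁ cx)
    x-indep : Independent (ArcIn E) U s₁ x
    x-indep = L₁ , X , L₁.cs , cx , L₁.L⊆U , X⊆U , L₁#X
    L₁≢x : ∀ {v} → v ∈ L₁ → v ≢ x
    L₁≢x i refl = L₁#X (i , proj₁ cx)
    L₂≢x : ∀ {v} → v ∈ L₂ → v ≢ x
    L₂≢x i refl = x∉L₂ i

  -- Three vertex colours and two arc colours saved, the five of the target `2n - 5`.
  Saved : List V → List (V × V) → Set
  Saved U E = Σ (Savings U E) λ S → excess (Savings.sClasses S) ≡ 2 × length (Savings.pClass S) ≡ 2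

  saved-pairs : ∀ {U E a b c d p p'} → Independent (ArcIn E) U a b → Independent (ArcIn E) U c d →
    Independent (flip (ArcIn E)) U p p' → Unique (p ∷ p' ∷ a ∷ b ∷ c ∷ d ∷ []) → Saved U E
  saved-pairs {a = a} {b} {c} {d} {p} {p'} I J K uq = record
    { sClasses = (a ∷ b ∷ []) ∷ (c ∷ d ∷ []) ∷ [] ; pClass = p ∷ p' ∷ [] ; unique = uq
    ; members = λ { (here refl) → proj₁ (independent-∈ K)
                  ; (there (here refl)) → proj₂ (independent-∈ K)
                  ; (there (there (here refl))) → proj₁ (independent-∈ I)
                  ; (there (there (there (here refl)))) → proj₂ (independent-∈ I)
                  ; (there (there (there (there (here refl))))) → proj₁ (independent-∈ J)
                  ; (there (there (there (there (there (here refl)))))) → proj₂ (independent-∈ J) }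
    ; sIndep = class-pair I ∷ class-pair J ∷ [] ; pIndep = class-pair K } , refl , refl

  saved-triple : ∀ {U E a b c p p'} → Independent (ArcIn E) U a b → Independent (ArcIn E) U a c →
    Independent (ArcIn E) U b c → Independent (flip (ArcIn E)) U p p' →
    Unique (p ∷ p' ∷ a ∷ b ∷ c ∷ []) → Saved U E
  saved-triple {a = a} {b} {c} {p} {p'} I J H K uq = record
    { sClasses = (a ∷ b ∷ c ∷ []) ∷ [] ; pClass = p ∷ p' ∷ [] ; unique = uq
    ; members = λ { (here refl) → proj₁ (independent-∈ K)
                  ; (there (here refl)) → proj₂ (independent-∈ K)
                  ; (there (there (here refl))) → proj₁ (independent-∈ I)
                  ; (there (there (there (here refl)))) → proj₂ (independent-∈ I)
                  ; (there (there (there (there (here refl))))) → proj₂ (independent-∈ J) }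
    ; sIndep = class-cons (λ { (here refl) → I ; (there (here refl)) → J }) (class-pair H) ∷ []
    ; pIndep = class-pair K } , refl , refl

  State : List V → List (V × V) → Set
  State U E = Pair U E ⊎ Chain U E ⊎ Saved U E

  module Step {U : List V} {E : List (V × V)} {q : ℕ} {u w₁ w₂ : V} {ws : List V} (bt : Built U E q)
    (u∈ : u ∈ U) (uq : Unique (w₁ ∷ w₂ ∷ ws)) (dj : Disjoint (w₁ ∷ w₂ ∷ ws) U) where
    open Attach bt u∈ uq dj

    grow-outside : ∀ {R} → u ∉ R → grow R ≡ R
    grow-outside {R} u∉ with u ∈ᵥ? R
    ... | yes p = ⊥-elim (u∉ p)
    ... | no _ = refl

    only-keep : ∀ {w v} → w ∈ U → w ≢ u → (∀ {a} → (a , w) ∈ E → a ≡ v) → ∀ {a} → (a , w) ∈ E' → a ≡ v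
    only-keep w∈ w≢u only i with arcs-split i
    ... | inj₁ j = only j
    ... | inj₂ (_ , k) = ⊥-elim (w≢u (cyc-old u∈ uq dj k w∈))

    leaf-new : Leaf U' E' cs w₁ wₗ
    leaf-new = record { s∈ = w₁∈ ; p∈ = wₗ∈ ; s≢p = w₁≢wₗ ; L⊆U = ∈-++⁺ˡ
      ; cs = S.cert-new w₁∈ into-w₁ ; cp = P.cert-new wₗ∈ from-wₗ ; succ = next }

    leaf-keep : ∀ {L s p} → u ∉ L → Leaf U E L s p → Leaf U' E' L s p
    leaf-keep {L} {s} {p} u∉ l = record { s∈ = s∈ ; p∈ = p∈ ; s≢p = s≢p ; L⊆U = λ i → ∈-++⁺ʳ cs (L⊆U i)
      ; cs = subst (Cert (ArcIn E') s) (grow-outside u∉) (S.cert-grow L⊆U (≢u s∈) lcs)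
      ; cp = subst (Cert (flip (ArcIn E')) p) (grow-outside u∉) (P.cert-grow L⊆U (≢u p∈) cp)
      ; succ = λ i v≢p → let w , w∈ , w≢s , w≢u , only = succ i v≢p in
          w , w∈ , w≢s , w≢u , only-keep (L⊆U w∈) (≢u w∈) only }
      where
      open Leaf l renaming (cs to lcs)
      ≢u : ∀ {v} → v ∈ L → v ≢ u
      ≢u i refl = u∉ i

    new#old : ∀ {L s p} → Leaf U E L s p → Disjoint cs L
    new#old l (i , j) = dj (i , Leaf.L⊆U l j)

    -- The new cycle is a third leaf, so the three entry vertices are mutually independent and form
    -- one class with excess two.
    step-ends-triple : (e : Ends U E) → u ∉ Ends.L₁ e → u ∉ Ends.L₂ e → Saved U' E'
    step-ends-triple e u∉₁ u∉₂ = saved-triple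
        (S.indep-new w₁∈ into-w₁ L₁.L⊆U L₁.cs u∉₁) (S.indep-new w₁∈ into-w₁ L₂.L⊆U L₂.cs u∉₂)
        (S.indep-keep (≢₁ L₁.s∈) (≢₂ L₂.s∈) s-indep) (P.indep-keep (≢₁ L₁.p∈) (≢₂ L₂.p∈) p-indep)
        ((L₁≢L₂ L₁.p∈ L₂.p∈ ∷ old₁ L₁.p∈ ∷ L₁.s≢p ∘ sym ∷ L₁≢L₂ L₁.p∈ L₂.s∈ ∷ [])
        ∷ (old₂ L₂.p∈ ∷ L₁≢L₂ L₁.s∈ L₂.p∈ ∘ sym ∷ L₂.s≢p ∘ sym ∷ [])
        ∷ (apart w₁∈ (L₁.L⊆U L₁.s∈) ∷ apart w₁∈ (L₂.L⊆U L₂.s∈) ∷ [])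
        ∷ (L₁≢L₂ L₁.s∈ L₂.s∈ ∷ []) ∷ [] ∷ [])
      where
      open Ends e
      ≢₁ : ∀ {v} → v ∈ L₁ → v ≢ u
      ≢₁ i refl = u∉₁ i
      ≢₂ : ∀ {v} → v ∈ L₂ → v ≢ u
      ≢₂ i refl = u∉₂ i
      old₁ : ∀ {v} → v ∈ L₁ → v ≢ w₁
      old₁ i = apart w₁∈ (L₁.L⊆U i) ∘ sym
      old₂ : ∀ {v} → v ∈ L₂ → v ≢ w₁
      old₂ i = apart w₁∈ (L₂.L⊆U i) ∘ sym

    -- The gate of the first leaf moves to u = s₁, so the old successor of s₁ becomes the spare vertex x.
    step-ends-front : (e : Ends U E) → u ≡ Ends.s₁ e → Chain U' E'
    step-ends-front e refl with Leaf.succ (Ends.leaf₁ e) (Ends.L₁.s∈ e) (Ends.L₁.s≢p e)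
    ... | w , w∈ , w≢s , w≢u , only = record
        { ends = record { leaf₁ = leaf-new
                        ; leaf₂ = leaf-keep (λ i → L₁#L₂ (L₁.s∈ , i)) leaf₂
                        ; L₁#L₂ = new#old leaf₂
                        ; spread₁ = spread-front (L₂.L⊆U L₂.p∈) spread₁ }
        ; cx = S.cert-others (L₁.L⊆U w∈) w≢s only
        ; X⊆U = λ i → ∈-++⁺ʳ cs (proj₁ (∈-filter⁻ (λ v → ¬? (v ≟ u)) {xs = U} i))
        ; L₁#X = λ (i , j) → dj (i , proj₁ (∈-filter⁻ (λ v → ¬? (v ≟ u)) {xs = U} j))
        ; x∉L₂ = λ i → L₁#L₂ (w∈ , i) }
      where open Ends e

    -- Attaching at `s₁` prolongs one Hamiltonian path at its front; attaching at `p₁` prolongs the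
    -- other at its back, so the leaves swap roles and `s₁` becomes the spare. Elsewhere `w₁` is
    -- merged with the successor of `u`, and the pair `s₁`, `s₂` survives.
    step-pair-left : (e : Pair U E) → u ∈ Pair.L₁ e → State U' E'
    step-pair-left e u∈L with u ≟ Pair.s₁ e | u ≟ Pair.p₁ e
    ... | yes p | _ = inj₂ (inj₁ (step-ends-front (Pair.ends e) p))
    ... | no u≢s | yes refl = inj₂ (inj₁ record
        { ends = record { leaf₁ = leaf-keep (λ i → L₁#L₂ (u∈L , i)) leaf₂
                        ; leaf₂ = leaf-new
                        ; L₁#L₂ = λ (i , j) → new#old leaf₂ (j , i)
                        ; spread₁ = spread-back (L₂.L⊆U L₂.s∈) spread₂ }
        ; cx = S.cert-grow L₁.L⊆U (u≢s ∘ sym) L₁.cs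
        ; X⊆U = grow-⊆ L₁.L⊆U
        ; L₁#X = λ (i , j) → case grow-∈ j of λ where
            (inj₁ k) → L₁#L₂ (k , i)
            (inj₂ (k , _)) → dj (k , L₂.L⊆U i)
        ; x∉L₂ = λ i → dj (i , L₁.L⊆U L₁.s∈) })
      where open Pair e
    ... | no u≢s | no u≢p with Leaf.succ (Pair.leaf₁ e) u∈L u≢p
    ... | w , w∈ , w≢s , w≢u , only = inj₂ (inj₂ (saved-pairs
        (S.indep-others w₁∈ into-w₁ (L₁.L⊆U w∈) w≢u only)
        (S.indep-keep (u≢s ∘ sym) (≢u L₂.s∈) s-indep)
        (P.indep-new wₗ∈ from-wₗ L₂.L⊆U L₂.cp (λ i → L₁#L₂ (u∈L , i)))
        ((apart wₗ∈ (L₂.L⊆U L₂.p∈) ∷ w₁≢wₗ ∘ sym ∷ apart wₗ∈ (L₁.L⊆U w∈) ∷ apart wₗ∈ (L₁.L⊆U L₁.s∈)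
            ∷ apart wₗ∈ (L₂.L⊆U L₂.s∈) ∷ [])
        ∷ (apart w₁∈ (L₂.L⊆U L₂.p∈) ∘ sym ∷ L₁≢L₂ w∈ L₂.p∈ ∘ sym ∷ L₁≢L₂ L₁.s∈ L₂.p∈ ∘ sym ∷ L₂.s≢p ∘ sym ∷ [])
        ∷ (apart w₁∈ (L₁.L⊆U w∈) ∷ apart w₁∈ (L₁.L⊆U L₁.s∈) ∷ apart w₁∈ (L₂.L⊆U L₂.s∈) ∷ [])
        ∷ (w≢s ∷ L₁≢L₂ w∈ L₂.s∈ ∷ []) ∷ (L₁≢L₂ L₁.s∈ L₂.s∈ ∷ []) ∷ [] ∷ [])))
      where
      open Pair e
      ≢u : ∀ {v} → v ∈ L₂ → v ≢ u
      ≢u i refl = L₁#L₂ (u∈L , i)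

    step-pair : Pair U E → State U' E'
    step-pair e with u ∈ᵥ? Pair.L₁ e | u ∈ᵥ? Pair.L₂ e
    ... | yes i | _ = step-pair-left e i
    ... | no _ | yes j = step-pair-left (record
          { ends = record { leaf₁ = leaf₂ ; leaf₂ = leaf₁ ; L₁#L₂ = λ (k , l) → L₁#L₂ (l , k) ; spread₁ = spread₂ }
          ; spread₂ = spread₁ }) j
      where open Pair e
    ... | no i | no j = inj₂ (inj₂ (step-ends-triple (Pair.ends e) i j))

    step-chain : Chain U E → State U' E'
    step-chain e with u ∈ᵥ? Chain.L₁ e | u ∈ᵥ? Chain.L₂ e
    ... | no i | no j = inj₂ (inj₂ (step-ends-triple (Chain.ends e) i j))
    ... | yes i | _ with u ≟ Chain.s₁ e
    ... | yes p = inj₂ (inj₁ (step-ends-front (Chain.ends e) p))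
    -- This includes `u = p₁`, for a chain has no second direction to prolong. Now `w₁` goes with
    -- `s₂`, and the spare supplies the other pair.
    ... | no u≢s = inj₂ (inj₂ (saved-pairs
        (S.indep-new w₁∈ into-w₁ L₂.L⊆U L₂.cs u∉L₂)
        (S.indep-keep (u≢s ∘ sym) (λ { refl → L₁≢x i refl }) x-indep)
        (P.indep-new wₗ∈ from-wₗ L₂.L⊆U L₂.cp u∉L₂)
        ((apart wₗ∈ (L₂.L⊆U L₂.p∈) ∷ w₁≢wₗ ∘ sym ∷ apart wₗ∈ (L₂.L⊆U L₂.s∈) ∷ apart wₗ∈ (L₁.L⊆U L₁.s∈)
            ∷ apart wₗ∈ x∈U ∷ [])
        ∷ (apart w₁∈ (L₂.L⊆U L₂.p∈) ∘ sym ∷ L₂.s≢p ∘ sym ∷ L₁≢L₂ L₁.s∈ L₂.p∈ ∘ sym ∷ L₂≢x L₂.p∈ ∷ [])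
        ∷ (apart w₁∈ (L₂.L⊆U L₂.s∈) ∷ apart w₁∈ (L₁.L⊆U L₁.s∈) ∷ apart w₁∈ x∈U ∷ [])
        ∷ (L₁≢L₂ L₁.s∈ L₂.s∈ ∘ sym ∷ L₂≢x L₂.s∈ ∷ []) ∷ (L₁≢x L₁.s∈ ∷ []) ∷ [] ∷ [])))
      where
      open Chain e
      u∉L₂ : u ∉ L₂
      u∉L₂ j = L₁#L₂ (i , j)
    step-chain e | no i | yes j with u ≟ Chain.p₂ e
    ... | yes refl = inj₂ (inj₁ record
        { ends = record { leaf₁ = leaf-keep i leaf₁ ; leaf₂ = leaf-new
                        ; L₁#L₂ = λ (k , l) → new#old leaf₁ (l , k)
                        ; spread₁ = spread-back (L₁.L⊆U L₁.s∈) spread₁ }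
        ; cx = S.cert-grow X⊆U (λ { refl → x∉L₂ j }) cx
        ; X⊆U = grow-⊆ X⊆U
        ; L₁#X = λ (k , l) → case grow-∈ l of λ where
            (inj₁ m) → L₁#X (k , m)
            (inj₂ (m , _)) → dj (m , L₁.L⊆U k)
        ; x∉L₂ = λ k → dj (k , x∈U) })
      where open Chain e
    ... | no u≢p with Leaf.succ (Chain.leaf₂ e) j u≢p
    ... | w , w∈ , w≢s , w≢u , only = inj₂ (inj₂ (saved-pairs
        (S.indep-others w₁∈ into-w₁ (L₂.L⊆U w∈) w≢u only)
        (S.indep-keep (λ { refl → i L₁.s∈ }) (λ { refl → x∉L₂ j }) x-indep)
        (P.indep-new wₗ∈ from-wₗ L₁.L⊆U L₁.cp i)
        ((apart wₗ∈ (L₁.L⊆U L₁.p∈) ∷ w₁≢wₗ ∘ sym ∷ apart wₗ∈ (L₂.L⊆U w∈) ∷ apart wₗ∈ (L₁.L⊆U L₁.s∈)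
            ∷ apart wₗ∈ x∈U ∷ [])
        ∷ (apart w₁∈ (L₁.L⊆U L₁.p∈) ∘ sym ∷ L₁≢L₂ L₁.p∈ w∈ ∷ L₁.s≢p ∘ sym ∷ L₁≢x L₁.p∈ ∷ [])
        ∷ (apart w₁∈ (L₂.L⊆U w∈) ∷ apart w₁∈ (L₁.L⊆U L₁.s∈) ∷ apart w₁∈ x∈U ∷ [])
        ∷ (L₁≢L₂ L₁.s∈ w∈ ∘ sym ∷ L₂≢x w∈ ∷ []) ∷ (L₁≢x L₁.s∈ ∷ []) ∷ [] ∷ [])))
      where
      open Chain e

    step : State U E → State U' E'
    step (inj₁ e) = step-pair e
    step (inj₂ (inj₁ e)) = step-chain e
    step (inj₂ (inj₂ (S , e , l))) = let S' , e' , l' = savings-attach S in inj₂ (inj₂ (S' , trans e' e , trans l' l))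

-- Decomposition of a cactus, and part (c)

lipschitz-path : ∀ {R : A → A → Set} (φ : A → ℕ) → (∀ {a b} → R a b → φ b ≤ suc (φ a)) →
  ∀ x is y → All (λ e → R (proj₁ e) (proj₂ e)) (pairs (x ∷ is ++ [ y ])) → φ y ≤ suc (length is) + φ x
lipschitz-path φ lip x [] y (a ∷ []) = lip a
lipschitz-path φ lip x (i ∷ is) y (a ∷ al) = begin
    φ y                        ≤⟨ lipschitz-path φ lip i is y al ⟩
    suc (length is) + φ i      ≤⟨ ℕₚ.+-monoʳ-≤ (suc (length is)) (lip a) ⟩
    suc (length is) + suc (φ x) ≡⟨ ℕₚ.+-suc (suc (length is)) (φ x) ⟩
    suc (suc (length is)) + φ x ∎
  where open ℕₚ.≤-Reasoning

module _ {n : ℕ} {D : Digraph n} where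
  private V = Fin n

  module _ {E : List (V × V)} (D⊆E : ∀ {a b} → Arc D a b → (a , b) ∈ E)
    {φ : V → ℕ} (lip : ∀ {a b} → (a , b) ∈ E → φ b ≤ suc (φ a)) {x y : V} (x≢y : x ≢ y) where

    inner-lower : (P : Path D x y) → φ y ≤ suc (length (inner P)) + φ x
    inner-lower P = lipschitz-path φ lip x (inner P) y (All.map D⊆E (Path.arcs P))

    -- A rainbow path with `k` inner vertices has `k + 1` arcs; the Lipschitz bound on `φ` makes `k`
    -- large.
    trc-lower : ∀ {j} → TotalRainbowConnected D j → ∃ λ k → φ y ≤ suc k + φ x × k + suc k ≤ j
    trc-lower {j} (cv , ca , rainbow) with rainbow x y x≢y
    ... | P , uq = length (inner P) , inner-lower P , subst (_≤ j) size (unique-length uq)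
      where
      arcs' = pairs (x ∷ inner P ++ [ y ])
      size : length (map cv (inner P) ++ map (λ p → ca (proj₁ p) (proj₂ p)) arcs') ≡ length (inner P) + suc (length (inner P))
      size = trans (length-++ (map cv (inner P))) (cong₂ _+_ (length-map cv (inner P))
        (trans (length-map _ arcs') (trans (length-pairs x (inner P ++ [ y ]))
          (trans (length-++ (inner P)) (ℕₚ.+-comm (length (inner P)) 1)))))

first-hit : ∀ {P : A → Set} → (∀ x → Dec (P x)) → ∀ xs {z} → z ∈ xs → P z →
  ∃ λ pre → ∃ λ v → ∃ λ post → xs ≡ pre ++ v ∷ post × All (¬_ ∘ P) pre × P v
first-hit P? (x ∷ xs) i p with P? x
... | yes q = [] , x , xs , refl , [] , q
first-hit P? (x ∷ xs) (here refl) p | no ¬q = ⊥-elim (¬q p)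
first-hit P? (x ∷ xs) (there i) p | no ¬q with first-hit P? xs i p
... | pre , v , post , eq , al , q = x ∷ pre , v , post , cong (x ∷_) eq , ¬q ∷ al , q

module Decomposition {n : ℕ} {D : Digraph n} (oriented : Oriented D) (connected : StronglyConnected D)
  (unique-cycle : EveryArcInUniqueCycle D) where
  private V = Fin n

  record Ear (U : List V) (a b : V) : Set where
    field
      {w₂}     : V
      {ws}     : List V
      uq       : Unique (b ∷ w₂ ∷ ws)
      dj       : Disjoint (b ∷ w₂ ∷ ws) U
      in-D     : ∀ {c d} → (c , d) ∈ cyc a (b ∷ w₂ ∷ ws) → Arc D c d

  -- A path inside `E` from `v` back to `a` would close the excursion to a cycle. This cycle shares
  -- the arc `z → a` with a block of `E`, so by uniqueness it is that block, and `a → b` would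
  -- already be in `E`.
  no-shortcut : ∀ {U E q} → Built U E q → (∀ {c d} → (c , d) ∈ E → Arc D c d) →
    ∀ {a b v} pre post → (a , b) ∉ E → a ∈ U → v ∈ U → v ≢ a →
    All (_∉ U) pre → Unique pre → (a , b) ∈ pairs (a ∷ pre ++ [ v ]) →
    (∀ {c d} → (c , d) ∈ pairs (a ∷ pre ++ v ∷ post) → Arc D c d) → ⊥
  no-shortcut {U} {E} bt E⊆D {a} {b} {v} pre post ab∉ a∈ v∈ v≢a pre∉ uqp ab∈ in-D
    with loop-erase (built-connected bt v∈ a∈) v≢a
  ... | is , uqi , ali with pairs-has-head v (is ++ [ a ]) (∈-++⁺ʳ is (here refl))
  ... | z , za with Blocks.cover (blocks {D = D} bt E⊆D) (All.lookup ali za)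
  ... | i , zi with unique-cycle z a (E⊆D (All.lookup ali za))
  ... | Z₀ , _ , same = ab∉ (Blocks.within blks i (proj₁ (same (Blocks.block blks i) zi a b)
          (proj₂ (same Z zaZ a b) abZ)))
    where
    blks = blocks {D = D} bt E⊆D
    assoc : a ∷ (pre ++ v ∷ is) ++ [ a ] ≡ (a ∷ pre) ++ v ∷ is ++ [ a ]
    assoc = cong (a ∷_) (++-assoc pre (v ∷ is) [ a ])
    rest∈U : ∀ {w} → w ∈ v ∷ is → w ∈ U
    rest∈U j = let c , k = pairs-has-tail (v ∷ is) a j in proj₁ (built-arcs bt (All.lookup ali k))
    Z : Cycle D
    Z = record
      { start = a ; rest = pre ++ v ∷ is
      ; distinct = All.tabulate fresh ∷ Uniqueₚ.++⁺ uqp (unique-++ˡ (v ∷ is) uqi)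
          (λ (j , k) → All.lookup pre∉ j (rest∈U k))
      ; arcs = All.tabulate λ {e} j → arc (subst (λ l → e ∈ pairs l) assoc j) }
      where
      fresh : ∀ {w} → w ∈ pre ++ v ∷ is → a ≢ w
      fresh j refl with ∈-++⁻ pre j
      ... | inj₁ k = All.lookup pre∉ k a∈
      ... | inj₂ k = unique-++-disjoint (v ∷ is) uqi (k , here refl)
      arc : ∀ {e} → e ∈ pairs ((a ∷ pre) ++ v ∷ is ++ [ a ]) → ArcP D e
      arc {e} j with pairs-split (a ∷ pre) v (is ++ [ a ]) j
      ... | inj₁ k = in-D (subst (λ l → e ∈ pairs l) (++-assoc (a ∷ pre) [ v ] post) (pairs-++ˡ ((a ∷ pre) ++ [ v ]) post k))
      ... | inj₂ k = E⊆D (All.lookup ali k)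
    zaZ : ArcOfCycle Z z a
    zaZ = subst (λ l → (z , a) ∈ pairs l) (sym assoc) (pairs-++ʳ (a ∷ pre) (v ∷ is ++ [ a ]) za)
    abZ : ArcOfCycle Z a b
    abZ = subst (λ l → (a , b) ∈ pairs l) (trans (++-assoc (a ∷ pre) [ v ] (is ++ [ a ])) (sym assoc))
      (pairs-++ˡ ((a ∷ pre) ++ [ v ]) (is ++ [ a ]) ab∈)

  -- A path from `b` back to `a` is followed to its first vertex in `U`; `no-shortcut` leaves only
  -- `a` for it.
  ear : ∀ {U E q} → Built U E q → (∀ {c d} → (c , d) ∈ E → Arc D c d) →
    ∀ {a b} → Arc D a b → a ∈ U → (a , b) ∉ E → Ear U a b
  ear {U} {E} bt E⊆D {a} {b} ab a∈ ab∉ with connected b a (λ { refl → proj₁ oriented a ab })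
  ... | record { inner = is ; distinct = uqi ; arcs = ali }
    with first-hit (_∈ᵥ? U) (b ∷ is ++ [ a ]) (∈-++⁺ʳ (b ∷ is) (here refl)) a∈
  ... | pre , v , post , eq , pre∉ , v∈ with v ≟ a
  ... | no v≢a = ⊥-elim (no-shortcut bt E⊆D pre post ab∉ a∈ v∈ v≢a pre∉
        (unique-++ˡ pre (subst Unique eq uqi)) (first pre eq)
        λ {c} {d} j → arc (subst (λ l → (c , d) ∈ pairs (a ∷ l)) (sym eq) j))
    where
    first : ∀ pre → b ∷ is ++ [ a ] ≡ pre ++ v ∷ post → (a , b) ∈ pairs (a ∷ pre ++ [ v ])
    first [] e = here (cong (a ,_) (∷-injectiveˡ e))
    first (x ∷ pre) e = here (cong (a ,_) (∷-injectiveˡ e))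
    arc : ∀ {c d} → (c , d) ∈ pairs (a ∷ b ∷ is ++ [ a ]) → Arc D c d
    arc (here refl) = ab
    arc (there j) = All.lookup ali j
  ... | yes refl = build pre eq pre∉
    where
    arc : ∀ {c d} → (c , d) ∈ pairs (a ∷ b ∷ is ++ [ a ]) → Arc D c d
    arc (here refl) = ab
    arc (there j) = All.lookup ali j
    build : ∀ pre → b ∷ is ++ [ a ] ≡ pre ++ a ∷ post → All (_∉ U) pre → Ear U a b
    -- With fewer than two new vertices the arc would be a loop or have an opposite arc.
    build [] e _ = ⊥-elim (proj₁ oriented a (subst (Arc D a) (∷-injectiveˡ e) ab))
    build (x ∷ []) e _ with arc (there (subst (λ l → (b , a) ∈ pairs l) (sym e) (subst (λ x → (b , a) ∈ pairs (x ∷ a ∷ post)) (∷-injectiveˡ e) (here refl))))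
    ... | ba = ⊥-elim (proj₂ oriented a b ab ba)
    build (x ∷ y ∷ pre) e al with ∷-injectiveˡ e
    ... | refl = record
      { uq = unique-++ˡ (b ∷ y ∷ pre) (subst Unique e uqi)
      ; dj = λ (i , j) → All.lookup al i j
      ; in-D = λ {c} {d} i → arc (subst (λ l → (c , d) ∈ pairs (a ∷ l)) (sym e)
          (subst (λ l → (c , d) ∈ pairs l) (++-assoc (a ∷ b ∷ y ∷ pre) [ a ] post)
            (pairs-++ˡ (a ∷ b ∷ y ∷ pre ++ [ a ]) post i))) }

  record Exhausted (U : List V) (E : List (V × V)) : Set where
    field
      full : ∀ v → v ∈ U
      D⊆E  : ∀ {a b} → Arc D a b → (a , b) ∈ E

  -- If no arc with tail in `U` is missing from `E`, then `U` is closed under arcs, and strong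
  -- connectivity makes it everything.
  exit : ∀ {U E q} → Built U E q → (∃ λ a → ∃ λ b → Arc D a b × a ∈ U × (a , b) ∉ E) ⊎ Exhausted U E
  exit {U} {E} bt with Finₚ.any? (λ a → Finₚ.any? λ b → T? (Digraph.adj D a b) ×-dec (a ∈ᵥ? U) ×-dec ¬? ((a , b) ∈ₐ? E))
  ... | yes p = inj₁ p
  ... | no ¬p = inj₂ record { full = all-in ; D⊆E = λ {a} ab → covered ab (all-in a) }
    where
    covered : ∀ {a b} → Arc D a b → a ∈ U → (a , b) ∈ E
    covered {a} {b} ab a∈ with (a , b) ∈ₐ? E
    ... | yes i = i
    ... | no i∉ = ⊥-elim (¬p (a , b , ab , a∈ , i∉))
    root : ∀ {U E q} → Built {n} U E q → ∃ (_∈ U)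
    root (point r) = r , here refl
    root (attach _ _ _ _) = _ , here refl
    closed : ∀ {v w} → Star (Arc D) v w → v ∈ U → w ∈ U
    closed ε i = i
    closed (a ◅ s) i = closed s (proj₂ (built-arcs bt (covered a i)))
    all-in : ∀ v → v ∈ U
    all-in v with root bt
    ... | r , r∈ with r ≟ v
    ... | yes refl = r∈
    ... | no r≢v = let P = connected r v r≢v in closed (walk r (inner P) v (All.map id (Path.arcs P))) r∈

  -- The fuel bounds the number of vertices not yet reached; each ear adds at least two.
  exhaust : ∀ (Inv : List V → List (V × V) → Set) →
    (∀ {U E q u w₁ w₂ ws} → Built U E q → u ∈ U → Unique (w₁ ∷ w₂ ∷ ws) → Disjoint (w₁ ∷ w₂ ∷ ws) U →
      Inv U E → Inv ((w₁ ∷ w₂ ∷ ws) ++ U) (cyc u (w₁ ∷ w₂ ∷ ws) ++ E)) →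
    ∀ fuel {U E q} → n ≤ fuel + length U → Built U E q → (∀ {c d} → (c , d) ∈ E → Arc D c d) → Inv U E →
    ∃ λ U → ∃ λ E → ∃ λ q → Built U E q × Exhausted U E × Inv U E
  exhaust Inv step fuel {U} {E} {q} le bt E⊆D inv with exit bt
  ... | inj₂ done = U , E , q , bt , done , inv
  ... | inj₁ (a , b , ab , a∈ , ab∉) with ear bt E⊆D ab a∈ ab∉
  exhaust Inv step zero {U} le bt E⊆D inv | inj₁ (a , b , ab , a∈ , ab∉) | e =
    ⊥-elim (ℕₚ.<-irrefl refl (ℕₚ.<-≤-trans (s≤s le)
      (ℕₚ.≤-trans (s≤s (ℕₚ.≤-trans (ℕₚ.m≤n+m (length U) (length (Ear.ws e))) (ℕₚ.n≤1+n _)))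
      (subst (λ k → suc (suc k) ≤ n) (length-++ (Ear.ws e)) (unique-length (built-unique (attach bt a∈ (Ear.uq e) (Ear.dj e))))))))
  exhaust Inv step (suc fuel) {U} le bt E⊆D inv | inj₁ (a , b , ab , a∈ , ab∉) | e =
    exhaust Inv step fuel le' (attach bt a∈ uq dj)
      (λ i → [ in-D , E⊆D ]′ (∈-++⁻ (cyc a (b ∷ w₂ ∷ ws)) i)) (step bt a∈ uq dj inv)
    where
    open Ear e
    le' : n ≤ fuel + suc (suc (length (ws ++ U)))
    le' rewrite ℕₚ.+-suc fuel (suc (length (ws ++ U))) | length-++ ws {U} = ℕₚ.≤-trans le
      (s≤s (ℕₚ.+-monoʳ-≤ fuel (ℕₚ.m≤n⇒m≤1+n (ℕₚ.m≤n+m (length U) (length ws)))))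

ham-bound : ∀ n k → 3 ≤ n → n ≤ 2 + k → ¬ k + suc k ≤ 2 * n ∸ 4
ham-bound (suc (suc (suc m))) k (s≤s (s≤s (s≤s z≤n))) (s≤s (s≤s le)) le' = ℕₚ.<-irrefl refl (begin-strict
    2 * (3 + m) ∸ 4        ≡⟨ cong (_∸ 4) (solve 1 (λ m → con 2 :* (con 3 :+ m) := con 4 :+ (con 2 :+ con 2 :* m)) refl m) ⟩
    2 + 2 * m              <⟨ ℕₚ.n<1+n _ ⟩
    3 + 2 * m              ≡⟨ solve 1 (λ m → con 3 :+ con 2 :* m := con 1 :+ m :+ (con 2 :+ m)) refl m ⟩
    suc m + suc (suc m)    ≤⟨ ℕₚ.+-mono-≤ le (s≤s le) ⟩
    k + suc k              ≤⟨ le' ⟩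
    2 * (3 + m) ∸ 4        ∎)
  where
  open ℕₚ.≤-Reasoning
  open +-*-Solver

saved-bound : ∀ N M n → N + 3 ≡ n → M + 2 ≡ n → N + M < 2 * n ∸ 4
saved-bound N M n refl eM with ℕₚ.+-cancelʳ-≡ 2 M (N + 1) (trans eM (sym (ℕₚ.+-assoc N 1 2)))
... | refl = ℕₚ.≤-reflexive (sym (cong (_∸ 4)
    (solve 1 (λ N → con 2 :* (N :+ con 3) := con 4 :+ (con 1 :+ (N :+ (N :+ con 1)))) refl N)))
  where open +-*-Solver

step-state : ∀ {U : List (Fin n)} {E q u w₁ w₂ ws} → Built U E q → u ∈ U → Unique (w₁ ∷ w₂ ∷ ws) →
  Disjoint (w₁ ∷ w₂ ∷ ws) U → State U E → State ((w₁ ∷ w₂ ∷ ws) ++ U) (cyc u (w₁ ∷ w₂ ∷ ws) ++ E)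
step-state bt u∈ uq dj = Step.step bt u∈ uq dj

module _ {n : ℕ} {a w₁ w₂ x₁ x₂ : Fin n} {ws xs : List (Fin n)}
  (uqw : Unique (w₁ ∷ w₂ ∷ ws)) (djw : Disjoint (w₁ ∷ w₂ ∷ ws) [ a ])
  (a∈ : a ∈ (w₁ ∷ w₂ ∷ ws) ++ [ a ])
  (uqx : Unique (x₁ ∷ x₂ ∷ xs)) (djx : Disjoint (x₁ ∷ x₂ ∷ xs) ((w₁ ∷ w₂ ∷ ws) ++ [ a ])) where
  private
    module A₁ = Attach (point a) (here refl) uqw djw
    module M₁ = Step (point a) (here refl) uqw djw
    module A₂ = Attach A₁.built' a∈ uqx djx
    module M₂ = Step A₁.built' a∈ uqx djx

    trivial : Spread [ a ] [] a a
    trivial = (λ _ → 0) , (λ ()) , s≤s z≤n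

  -- Both Hamiltonian paths pass through `a`: one traverses the first cycle and then the second, the
  -- other the reverse.
  pair-of-leaves : Pair A₂.U' A₂.E'
  pair-of-leaves = record
    { ends = record { leaf₁ = M₂.leaf-keep (λ i → djw (i , here refl)) M₁.leaf-new ; leaf₂ = M₂.leaf-new
                    ; L₁#L₂ = λ (i , j) → djx (j , ∈-++⁺ˡ i)
                    ; spread₁ = A₂.spread-back (∈-++⁺ˡ A₁.w₁∈) (A₁.spread-front (here refl) trivial) }
    ; spread₂ = A₂.spread-front (∈-++⁺ˡ A₁.wₗ∈) (A₁.spread-back (here refl) trivial) }

-- Excluding the value 2n - 4

module _ {n : ℕ} {D : Digraph n} {q : ℕ} (2≤q : 2 ≤ q) (cactus : Cactus D q) where
  private
    V = Fin n
    oriented = proj₁ cactus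
    connected = proj₁ (proj₂ cactus)
    unique-cycle = proj₁ (proj₂ (proj₂ cactus))

    cycles : HasExactlyCycles D q
    cycles = proj₂ (proj₂ (proj₂ cactus))

  open Decomposition oriented connected unique-cycle

  distinct-blocks : ∃ λ (i : Fin q) → ∃ λ j → ¬ SameCycle (proj₁ cycles i) (proj₁ cycles j)
  distinct-blocks = i , j , λ same →
      let C , exactly = cycles
          k , _ , only = exactly (C i)
      in i≢j (trans (only i (λ u v → id , id)) (sym (only j same)))
    where
    two : ∀ {q} → 2 ≤ q → ∃ λ (i : Fin q) → ∃ λ j → i ≢ j
    two (s≤s (s≤s _)) = zero , suc zero , λ ()
    i = proj₁ (two 2≤q)
    j = proj₁ (proj₂ (two 2≤q))
    i≢j = proj₂ (proj₂ (two 2≤q))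

  -- Otherwise every cycle would equal the single block, against `distinct-blocks`.
  one-block-not-all : ∀ {U E} → Built U E 1 → (∀ {c d} → (c , d) ∈ E → Arc D c d) → ¬ Exhausted U E
  one-block-not-all {U} {E} bt E⊆D ex with distinct-blocks
  ... | i , j , differ = differ same
    where
    open Exhausted ex
    open Blocks (blocks {D = D} bt E⊆D)
    C = proj₁ cycles
    at-zero : ∀ Z → SameCycle Z (block zero)
    at-zero Z with complete Z (λ k → D⊆E (All.lookup (Cycle.arcs Z) k))
    ... | zero , s = s
    same : SameCycle (C i) (C j)
    same u v = let f , g = at-zero (C i) u v ; f' , g' = at-zero (C j) u v in g' ∘ f , g ∘ f'

  pair-at : ∀ {a b c} → Arc D a b → Arc D a c → b ≢ c →
    ∃ λ U → ∃ λ E → Built U E 2 × (∀ {c d} → (c , d) ∈ E → Arc D c d) × Pair U E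
  pair-at {a} {b} {c} ab ac b≢c with ear (point a) (λ ()) ab (here refl) (λ ())
  ... | e₁ = result
    where
    module e₁ = Ear e₁
    cs₁ = b ∷ e₁.w₂ ∷ e₁.ws
    bt₁ : Built (cs₁ ++ [ a ]) (cyc a cs₁ ++ []) 1
    bt₁ = attach (point a) (here refl) e₁.uq e₁.dj
    in-D₁ : ∀ {c d} → (c , d) ∈ cyc a cs₁ ++ [] → Arc D c d
    in-D₁ i with ∈-++⁻ (cyc a cs₁) i
    ... | inj₁ j = e₁.in-D j
    a∈ : a ∈ cs₁ ++ [ a ]
    a∈ = ∈-++⁺ʳ cs₁ (here refl)
    ac∉ : (a , c) ∉ cyc a cs₁ ++ []
    ac∉ i with ∈-++⁻ (cyc a cs₁) i
    ... | inj₁ j = b≢c (cyc-out-unique a cs₁ (attach-unique (here refl) e₁.uq e₁.dj) (here refl) j)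
    result : ∃ λ U → ∃ λ E → Built U E 2 × (∀ {c d} → (c , d) ∈ E → Arc D c d) × Pair U E
    result with ear bt₁ in-D₁ ac a∈ ac∉
    ... | e₂ = _ , _ , attach bt₁ a∈ e₂.uq e₂.dj , in-D₂ ,
        pair-of-leaves e₁.uq e₁.dj a∈ e₂.uq e₂.dj
      where
      module e₂ = Ear e₂
      cs₂ = c ∷ e₂.w₂ ∷ e₂.ws
      in-D₂ : ∀ {c d} → (c , d) ∈ cyc a cs₂ ++ cyc a cs₁ ++ [] → Arc D c d
      in-D₂ i with ∈-++⁻ (cyc a cs₂) i
      ... | inj₁ j = e₂.in-D j
      ... | inj₂ j = in-D₁ j

  -- A first cycle cannot exhaust the cactus, so some vertex on it has a further out-arc. The growth
  -- is then restarted with that vertex as root, so that both initial cycles hang at the root.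
  branching : ∃ λ a → ∃ λ b → ∃ λ c → Arc D a b × Arc D a c × b ≢ c
  branching with distinct-blocks
  ... | i , _ with cycle-first (proj₁ cycles i)
  ... | b , rb with ear (point (Cycle.start (proj₁ cycles i))) (λ ())
                      (All.lookup (Cycle.arcs (proj₁ cycles i)) rb) (here refl) (λ ())
  ... | e = go
    where
    r = Cycle.start (proj₁ cycles i)
    open Ear e
    cs = b ∷ w₂ ∷ ws
    bt : Built (cs ++ [ r ]) (cyc r cs ++ []) 1
    bt = attach (point r) (here refl) uq dj
    in-D' : ∀ {c d} → (c , d) ∈ cyc r cs ++ [] → Arc D c d
    in-D' i with ∈-++⁻ (cyc r cs) i
    ... | inj₁ j = in-D j
    go : ∃ λ a → ∃ λ b → ∃ λ c → Arc D a b × Arc D a c × b ≢ c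
    go with exit bt
    ... | inj₂ ex = ⊥-elim (one-block-not-all bt in-D' ex)
    ... | inj₁ (a , c , ac , a∈ , ac∉) with on-cycle (∈-++⁻ cs a∈)
      where
      on-cycle : a ∈ cs ⊎ a ∈ [ r ] → a ∈ r ∷ cs
      on-cycle (inj₁ i) = there i
      on-cycle (inj₂ (here p)) = here p
    ... | k with cyc-next r cs (attach-unique (here refl) uq dj) k
    ... | d , ad = a , d , c , in-D ad , ac , λ { refl → ac∉ (∈-++⁺ˡ ad) }

  Reached : Set
  Reached = ∃ λ U → ∃ λ E → Exhausted U E × State U E

  exhaust-pair : (∃ λ U → ∃ λ E → Built U E 2 × (∀ {c d} → (c , d) ∈ E → Arc D c d) × Pair U E) → Reached
  exhaust-pair (U , E , bt , E⊆D , pair) =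
    let U' , E' , _ , _ , ex , state = exhaust State step-state n (ℕₚ.m≤m+n n (length U)) bt E⊆D (inj₁ pair)
    in U' , E' , ex , state

  reached : Reached
  reached = from branching
    where
    from : (∃ λ a → ∃ λ b → ∃ λ c → Arc D a b × Arc D a c × b ≢ c) → Reached
    from (a , b , c , ab , ac , b≢c) = exhaust-pair (pair-at ab ac b≢c)

  trc≢2n∸4 : ¬ trc≡ D (2 * n ∸ 4)
  trc≢2n∸4 (colouring , minimal) = conclude reached
    where
    refute-ends : ∀ {U E} → Exhausted U E → Ends U E → ⊥
    refute-ends {U} ex e with trc-lower (Exhausted.D⊆E ex) (proj₁ (proj₂ (Ends.spread₁ e))) (Ends.L₁≢L₂ e (Ends.L₁.s∈ e) (Ends.L₂.p∈ e)) colouring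
    ... | k , le , le' = ham-bound n k 3≤n n≤ le'
      where
      open Ends e
      φ = proj₁ spread₁
      n≤ : n ≤ 2 + k
      n≤ = ℕₚ.+-cancelʳ-≤ (φ s₁) n (2 + k) (ℕₚ.≤-trans (ℕₚ.+-monoˡ-≤ (φ s₁) (covering-length (Exhausted.full ex)))
        (ℕₚ.≤-trans (proj₂ (proj₂ spread₁)) (s≤s le)))
      3≤n : 3 ≤ n
      3≤n = unique-length ((L₁.s≢p ∷ L₁≢L₂ L₁.s∈ L₂.s∈ ∷ []) ∷ (L₁≢L₂ L₁.p∈ L₂.s∈ ∷ []) ∷ [] ∷ [])
    refute-saved : ∀ {U E} → Exhausted U E → Saved U E → ⊥
    refute-saved ex (S , es , ep) with trc-upper (Exhausted.D⊆E ex) connected S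
    ... | N , M , eN , eM , col = minimal (N + M) (saved-bound N M n
        (trans (cong₂ (λ k l → N + (k ∸ 1 + l)) (sym ep) (sym es)) eN) (trans (cong (M +_) (sym es)) eM)) col
    refute : ∀ {U E} → Exhausted U E → State U E → ⊥
    refute ex (inj₁ e) = refute-ends ex (Pair.ends e)
    refute ex (inj₂ (inj₁ e)) = refute-ends ex (Chain.ends e)
    refute ex (inj₂ (inj₂ s)) = refute-saved ex s
    conclude : Reached → ⊥
    conclude (U , E , ex , state) = refute ex state

-- Cacti with prescribed savings

unique-insert : ∀ (xs : List A) {ys a} → Unique (xs ++ ys) → a ∉ xs ++ ys → Unique (xs ++ a ∷ ys)
unique-insert [] uq a∉ = All.tabulate (λ { i refl → a∉ i }) ∷ uq
unique-insert (x ∷ xs) {ys} {a} (x≢ ∷ uq) a∉ =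
  Allₚ.++⁺ (Allₚ.++⁻ˡ xs x≢) ((λ { refl → a∉ (here refl) }) ∷ Allₚ.++⁻ʳ xs x≢) ∷ unique-insert xs uq (a∉ ∘ there)

fresh-vertex : ∀ (U : List (Fin n)) → length U < n → ∃ (_∉ U)
fresh-vertex {n} U lt with Finₚ.any? (λ v → ¬? (v ∈ᵥ? U))
... | yes p = p
... | no ¬p = ⊥-elim (ℕₚ.<⇒≱ lt (covering-length λ v → decidable-stable (v ∈ᵥ? U) λ v∉ → ¬p (v , v∉)))

fresh-vertices : ∀ k (U : List (Fin n)) → length U + k ≤ n →
  ∃ λ ws → length ws ≡ k × Unique ws × Disjoint ws U
fresh-vertices zero U le = [] , refl , [] , λ ()
fresh-vertices {n} (suc k) U le with fresh-vertex U (ℕₚ.<-≤-trans (ℕₚ.m<m+n (length U) (s≤s z≤n)) le)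
... | v , v∉ with fresh-vertices k (v ∷ U) (subst (_≤ n) (ℕₚ.+-suc (length U) k) le)
... | ws , eq , uq , dj = v ∷ ws , cong suc eq , All.tabulate (λ { i refl → dj (i , here refl) }) ∷ uq ,
  λ { (here refl , j) → v∉ j ; (there i , j) → dj (i , there j) }

-- `R` is the initial segment of the path that ends at `a`.
prefix-cut : ∀ (x₀ : A) xs c → Unique (x₀ ∷ xs ++ [ c ]) → ∀ {a b} → (a , b) ∈ pairs (x₀ ∷ xs ++ [ c ]) →
  ∃ λ R → x₀ ∈ R × (∀ {v} → v ∈ R → v ∈ x₀ ∷ xs) ×
    (∀ {a' b'} → (a' , b') ∈ pairs (x₀ ∷ xs ++ [ c ]) → a' ∈ R → b' ∉ R → a' ≡ a × b' ≡ b)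
prefix-cut x₀ [] c uq (here refl) = [ x₀ ] , here refl , id , λ { (here refl) _ _ → refl , refl }
prefix-cut x₀ (x ∷ xs) c uq (here refl) = [ x₀ ] , here refl , (λ { (here p) → here p }) , λ
  { i (here refl) _ → refl , pairs-out-unique (x₀ ∷ x ∷ xs) c (unique-++ˡ (x₀ ∷ x ∷ xs) uq) i (here refl) }
prefix-cut x₀ (x ∷ xs) c uq (there i) with prefix-cut x xs c (unique-tail uq) i
... | R , x∈ , R⊆ , sole = x₀ ∷ R , here refl , (λ { (here p) → here p ; (there j) → there (R⊆ j) }) , λ
  { (here refl) _ b∉ → ⊥-elim (b∉ (there x∈))
  ; (there j) (here refl) b∉ → ⊥-elim (Unique[x∷xs]⇒x∉xs uq (proj₁ (pairs-∈ _ j)))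
  ; (there j) (there k) b∉ → sole j k (b∉ ∘ there) }

module _ {n : ℕ} where
  private V = Fin n

  -- A set avoiding the current cut vertex `c` survives an attachment at `c` unchanged and is
  -- disjoint from the new cycle.
  Avoiding : (V → V → Set) → List V → V → V → Set
  Avoiding A U c w = ∃ λ R → Cert A w R × (∀ {v} → v ∈ R → v ∈ U) × c ∉ R

  -- A cut certificate: `(a , b)` is the only arc leaving a set that contains `x₀` and no target in
  -- `ps`, so every path from `x₀` to a target uses it.
  Bridge : List V → List (V × V) → V → V → List V → V → V → Set
  Bridge U E x₀ c ps a b = ∃ λ R → x₀ ∈ R × (∀ {v} → v ∈ R → v ∈ U) × c ∉ R × Disjoint R ps ×
    (∀ {a' b'} → (a' , b') ∈ E → a' ∈ R → b' ∉ R → a' ≡ a × b' ≡ b)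

  record Triangle (E : List (V × V)) (c s p : V) : Set where
    field
      s≢c  : s ≢ c
      p≢c  : p ≢ c
      inS  : ∀ {a} → (a , s) ∈ E → a ≡ c
      inP  : ∀ {a} → (a , p) ∈ E → a ≡ s
      outS : ∀ {b} → (s , b) ∈ E → b ≡ p

  headsOf : List (V × V) → List (V × V) → List V
  headsOf Ls Xs = map proj₁ Ls ++ (map proj₂ Ls ++ map proj₂ Xs)

  -- Ls lists the end triangles c → s → p → c attached so far.
  record Partial (Ls : List (V × V)) (q ℓ t : ℕ) : Set where
    field
      {U}      : List V
      {E}      : List (V × V)
      built    : Built U E q
      {c x₀}   : V
      -- The trunk: its `ℓ` arcs are forced on every path from `x₀` to an end of the cactus.
      Xs       : List (V × V)
      -- These two classes are still open at the cut vertex `c`. `Cs` holds the classes closed by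
      -- the squares, each worth one saving.
      sC pC    : List V
      Cs       : List (List V)
      size     : length U ≡ suc ℓ + (length Ls + (length Ls + t))
      c∈       : c ∈ U
      x₀∈      : x₀ ∈ U
      bridges  : ∀ {a b} → (a , b) ∈ Xs → Bridge U E x₀ c (map proj₂ Ls) a b
      long     : length Xs ≡ ℓ
      heads    : Unique (headsOf Ls Xs)
      headsU   : ∀ {v} → v ∈ headsOf Ls Xs → v ∈ U
      x₀∉      : x₀ ∉ headsOf Ls Xs
      sAvoid   : ∀ {w} → w ∈ sC → Avoiding (ArcIn E) U c w
      pAvoid   : ∀ {w} → w ∈ pC → Avoiding (flip (ArcIn E)) U c w
      sClass   : Class (Independent (ArcIn E) U) sC
      pClass   : Class (Independent (flip (ArcIn E)) U) pC
      sSize    : length sC ≡ suc (length Ls)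
      pSize    : length pC ≡ suc (length Ls)
      classes  : All (Class (Independent (ArcIn E) U)) Cs
      CsU      : ∀ {v} → v ∈ concat Cs → v ∈ U
      c∉Cs     : c ∉ concat Cs
      excess-t : excess Cs ≡ t
      separate : Unique (pC ++ (sC ++ concat Cs))
      leaves   : ∀ {s p} → (s , p) ∈ Ls → Triangle E c s p
    members : ∀ {v} → v ∈ pC ++ (sC ++ concat Cs) → v ∈ U
    members i with ∈-++⁻ pC i
    ... | inj₁ j = let R , cR , R⊆U , _ = pAvoid j in R⊆U (proj₁ cR)
    ... | inj₂ j with ∈-++⁻ sC j
    ... | inj₁ k = let R , cR , R⊆U , _ = sAvoid k in R⊆U (proj₁ cR)
    ... | inj₂ k = CsU k

  module Extend {U : List V} {E : List (V × V)} {q : ℕ} {u w₁ w₂ : V} {ws : List V} (bt : Built U E q)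
    (u∈ : u ∈ U) (uq : Unique (w₁ ∷ w₂ ∷ ws)) (dj : Disjoint (w₁ ∷ w₂ ∷ ws) U) where
    open Attach bt u∈ uq dj public
    open Step bt u∈ uq dj using (grow-outside; only-keep) public

    up : ∀ {v} → v ∈ U → v ∈ U'
    up = ∈-++⁺ʳ cs

    avoid-keep : ∀ {A A' : V → V → Set} {c' w} → (∀ {a b} → A a b → a ∈ U × b ∈ U) →
      (∀ {a b} → A' a b → A a b ⊎ (a ∈ u ∷ cs × b ∈ u ∷ cs)) →
      c' ∈ u ∷ cs → Avoiding A U u w → Avoiding A' U' c' w
    avoid-keep {A} {A'} {c'} {w} A⊆U A'⊆ c'∈ (R , cR , R⊆U , u∉) = R ,
        subst (Cert A' w) (grow-outside u∉) (C.cert-grow R⊆U (λ { refl → u∉ (proj₁ cR) }) cR) ,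
        (λ i → up (R⊆U i)) , c'∉ c'∈
      where
      module C = Certs A A' A⊆U A'⊆
      c'∉ : c' ∈ u ∷ cs → c' ∉ R
      c'∉ (here refl) = u∉
      c'∉ (there i) j = dj (i , R⊆U j)

    bridge-keep : ∀ {x₀ c' ps ps' a b} → c' ∈ u ∷ cs → (∀ {v} → v ∈ ps' → v ∈ ps ⊎ v ∈ cs) →
      Bridge U E x₀ u ps a b → Bridge U' E' x₀ c' ps' a b
    bridge-keep {x₀} {c'} c'∈ ps'⊆ (R , x₀∈ , R⊆U , u∉ , R#ps , sole) = R , x₀∈ , (λ i → up (R⊆U i)) , c'∉ c'∈ ,
        (λ (i , j) → case ps'⊆ j of λ { (inj₁ k) → R#ps (i , k) ; (inj₂ k) → dj (k , R⊆U i) }) ,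
        sole'
      where
      c'∉ : c' ∈ u ∷ cs → c' ∉ R
      c'∉ (here refl) = u∉
      c'∉ (there i) j = dj (i , R⊆U j)
      sole' : ∀ {a' b'} → (a' , b') ∈ E' → a' ∈ R → b' ∉ R → _
      sole' i j k with arcs-split i
      ... | inj₁ o = sole o j k
      ... | inj₂ (l , _) = ⊥-elim (u∉ (subst (_∈ R) (cyc-old u∈ uq dj l (R⊆U j)) j))

    bridge-first : ∀ {x₀ ps} → x₀ ∈ U → (∀ {v} → v ∉ ps) → Bridge U' E' x₀ w₂ ps u w₁
    bridge-first x₀∈ none = U , x₀∈ , up , (λ i → dj (there (here refl) , i)) , (λ (_ , j) → none j) , sole
      where
      sole : ∀ {a' b'} → (a' , b') ∈ E' → a' ∈ U → b' ∉ U → a' ≡ u × b' ≡ w₁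
      sole i j k with new-arc i
      ... | inj₁ o = ⊥-elim (k (proj₂ (built-arcs bt o)))
      ... | inj₂ o with cyc-old u∈ uq dj (proj₁ (cyc-∈ u cs uq' o)) j
      ... | refl = refl , cyc-out-unique u cs uq' o (here refl)

    bridge-second : ∀ {x₀ ps} → x₀ ∈ U → (∀ {v} → v ∉ ps) → Bridge U' E' x₀ w₂ ps w₁ w₂
    bridge-second x₀∈ none = w₁ ∷ U , there x₀∈ , (λ { (here refl) → here refl ; (there i) → up i }) ,
        (λ { (here e) → Unique[x∷xs]⇒x∉xs uq (here (sym e)) ; (there i) → dj (there (here refl) , i) }) ,
        (λ (_ , j) → none j) , sole
      where
      sole : ∀ {a' b'} → (a' , b') ∈ E' → a' ∈ w₁ ∷ U → b' ∉ w₁ ∷ U → a' ≡ w₁ × b' ≡ w₂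
      sole i j k with new-arc i
      ... | inj₁ o = ⊥-elim (k (there (proj₂ (built-arcs bt o))))
      sole i (here refl) k | inj₂ o = refl , cyc-out-unique u cs uq' o (there (here refl))
      sole i (there j) k | inj₂ o with cyc-old u∈ uq dj (proj₁ (cyc-∈ u cs uq' o)) j
      ... | refl with cyc-out-unique u cs uq' o (here refl)
      ... | refl = ⊥-elim (k (here refl))

    class-keep : ∀ {A A' : V → V → Set} {C} → (∀ {a b} → A a b → a ∈ U × b ∈ U) →
      (∀ {a b} → A' a b → A a b ⊎ (a ∈ u ∷ cs × b ∈ u ∷ cs)) → u ∉ C →
      Class (Independent A U) C → Class (Independent A' U') C
    class-keep {A} {A'} A⊆U A'⊆ u∉ h i j v≢w =
      Certs.indep-keep A A' A⊆U A'⊆ (λ { refl → u∉ i }) (λ { refl → u∉ j }) (h i j v≢w)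

    classes-keep : ∀ {Cs} → u ∉ concat Cs → All (Class (Independent (ArcIn E) U)) Cs →
      All (Class (Independent (ArcIn E') U')) Cs
    classes-keep u∉ [] = []
    classes-keep {C ∷ Cs} u∉ (h ∷ hs) =
      class-keep (built-arcs bt) arcs-split (u∉ ∘ ∈-++⁺ˡ) h ∷ classes-keep (u∉ ∘ ∈-++⁺ʳ C) hs

    old-list : ∀ {xs} → (∀ {v} → v ∈ xs → v ∈ U) → ∀ {w} → w ∈ cs → w ∉ xs
    old-list h i j = dj (i , h j)

    out-keep : ∀ {w v} → w ∈ U → w ≢ u → (∀ {b} → (w , b) ∈ E → b ≡ v) → ∀ {b} → (w , b) ∈ E' → b ≡ v
    out-keep w∈ w≢u only i with arcs-split i
    ... | inj₁ j = only j
    ... | inj₂ (k , _) = ⊥-elim (w≢u (cyc-old u∈ uq dj k w∈))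

  -- The long end cycle has `m + 3` arcs; all but `r → w₁` form the first part of the trunk, which
  -- starts at `w₁`.
  start : ∀ m → suc (suc (suc m)) ≤ n → Partial [] 1 (suc (suc m)) 0
  start m room with fresh-vertices 1 [] (ℕₚ.≤-trans (s≤s z≤n) room)
  ... | r ∷ [] , _ , _ , _ with fresh-vertices (suc (suc m)) [ r ] room
  ... | w₁ ∷ w₂ ∷ ws , eq , uq , dj = record
      { built = built' ; c = r ; x₀ = w₁ ; Xs = pairs (cs ++ [ r ]) ; sC = [ w₁ ] ; pC = [ wₗ ] ; Cs = []
      ; size = trans (length-++ cs) (trans (ℕₚ.+-comm (length cs) 1) (cong suc (trans eq (sym (ℕₚ.+-identityʳ _)))))
      ; c∈ = up (here refl) ; x₀∈ = ∈-++⁺ˡ w₁∈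
      ; bridges = bridge
      ; long = trans (length-pairs w₁ (w₂ ∷ ws ++ [ r ])) (trans (length-++ (w₂ ∷ ws)) (trans (ℕₚ.+-comm _ 1) eq))
      ; heads = subst Unique (sym headsEq) (unique-tail (unique-rotate uq'))
      ; headsU = λ {v} i → heads⊆ (subst (v ∈_) headsEq i)
      ; x₀∉ = λ i → Unique[x∷xs]⇒x∉xs (unique-rotate uq') (subst (w₁ ∈_) headsEq i)
      ; sAvoid = λ { (here refl) → cs , S.cert-new w₁∈ into-w₁ , ∈-++⁺ˡ , r∉ }
      ; pAvoid = λ { (here refl) → cs , P.cert-new wₗ∈ from-wₗ , ∈-++⁺ˡ , r∉ }
      ; sClass = λ { (here refl) (here refl) ne → ⊥-elim (ne refl) }
      ; pClass = λ { (here refl) (here refl) ne → ⊥-elim (ne refl) }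
      ; sSize = refl ; pSize = refl ; classes = [] ; CsU = λ () ; c∉Cs = λ () ; excess-t = refl
      ; separate = ((λ e → w₁≢wₗ (sym e)) ∷ []) ∷ [] ∷ [] ; leaves = λ () }
    where
    open Extend (point r) (here refl) uq dj
    r∉ : r ∉ cs
    r∉ i = dj (i , here refl)
    headsEq : map proj₂ (pairs (cs ++ [ r ])) ≡ w₂ ∷ ws ++ [ r ]
    headsEq = map-proj₂-pairs w₁ (w₂ ∷ ws ++ [ r ])
    heads⊆ : ∀ {v} → v ∈ w₂ ∷ ws ++ [ r ] → v ∈ U'
    heads⊆ i = there i
    bridge : ∀ {a b} → (a , b) ∈ pairs (cs ++ [ r ]) → Bridge U' E' w₁ r [] a b
    bridge i with prefix-cut w₁ (w₂ ∷ ws) r (unique-rotate uq') i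
    ... | R , x∈ , R⊆ , sole = R , x∈ , (λ j → ∈-++⁺ˡ (R⊆ j)) , (λ j → r∉ (R⊆ j)) , (λ ()) , sole'
      where
      sole' : ∀ {a' b'} → (a' , b') ∈ E' → a' ∈ R → b' ∉ R → _
      sole' j k l with new-arc j
      ... | inj₂ (here refl) = ⊥-elim (r∉ (R⊆ k))
      ... | inj₂ (there j') = sole j' k l

  module ChainStep {q ℓ t} (Q : Partial [] q ℓ t) {w₁ w₂ : V} {ws : List V}
    (uq : Unique (w₁ ∷ w₂ ∷ ws)) (dj : Disjoint (w₁ ∷ w₂ ∷ ws) (Partial.U Q)) where
    open Partial Q
    open Extend built c∈ uq dj

    -- Only the two arcs up to the new cut vertex `w₂` join the trunk; the remaining arcs of the
    -- triangle or square lead back to `c`.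
    Xs' : List (V × V)
    Xs' = (w₁ , w₂) ∷ (c , w₁) ∷ Xs

    w₂∈ : w₂ ∈ cs
    w₂∈ = there (here refl)

    bridges' : ∀ {a b} → (a , b) ∈ Xs' → Bridge U' E' x₀ w₂ [] a b
    bridges' (here refl) = bridge-second x₀∈ λ ()
    bridges' (there (here refl)) = bridge-first x₀∈ λ ()
    bridges' (there (there i)) = bridge-keep (there w₂∈) inj₁ (bridges i)

    heads' : Unique (headsOf [] Xs')
    heads' = All.tabulate (λ { (here refl) refl → Unique[x∷xs]⇒x∉xs uq (here refl) ; (there i) refl → dj (w₂∈ , headsU i) })
      ∷ All.tabulate (λ { i refl → dj (w₁∈ , headsU i) }) ∷ heads

    headsU' : ∀ {v} → v ∈ headsOf [] Xs' → v ∈ U'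
    headsU' (here refl) = ∈-++⁺ˡ w₂∈
    headsU' (there (here refl)) = ∈-++⁺ˡ w₁∈
    headsU' (there (there i)) = up (headsU i)

    x₀∉' : x₀ ∉ headsOf [] Xs'
    x₀∉' (here refl) = dj (w₂∈ , x₀∈)
    x₀∉' (there (here refl)) = dj (w₁∈ , x₀∈)
    x₀∉' (there (there i)) = x₀∉ i

    w₂∉Cs : w₂ ∉ concat Cs
    w₂∉Cs i = dj (w₂∈ , CsU i)

    c∉pC : c ∉ pC
    c∉pC i = let R , cR , _ , c∉ = pAvoid i in c∉ (proj₁ cR)

    c∉sC : c ∉ sC
    c∉sC i = let R , cR , _ , c∉ = sAvoid i in c∉ (proj₁ cR)

    sAvoid' : ∀ {w} → w ∈ sC → Avoiding (ArcIn E') U' w₂ w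
    sAvoid' i = avoid-keep (built-arcs built) arcs-split (there w₂∈) (sAvoid i)

    pAvoid' : ∀ {w} → w ∈ pC → Avoiding (flip (ArcIn E')) U' w₂ w
    pAvoid' i = avoid-keep (swap ∘ built-arcs built) (map₂ swap ∘ arcs-split) (there w₂∈) (pAvoid i)

    pClass' : Class (Independent (flip (ArcIn E')) U') pC
    pClass' = class-keep (swap ∘ built-arcs built) (map₂ swap ∘ arcs-split) c∉pC pClass

  triangle-step : ∀ {q ℓ t} → Partial [] q ℓ t → suc ℓ + t + 2 ≤ n → Partial [] (suc q) (2 + ℓ) t
  triangle-step Q room with fresh-vertices 2 (Partial.U Q) (subst (λ k → k + 2 ≤ n) (sym (Partial.size Q)) room)
  ... | w₁ ∷ w₂ ∷ [] , _ , uq , dj = record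
      { built = built' ; c = w₂ ; x₀ = x₀ ; Xs = Xs' ; sC = sC ; pC = pC ; Cs = Cs
      ; size = cong (2 +_) size ; c∈ = ∈-++⁺ˡ w₂∈ ; x₀∈ = up x₀∈ ; bridges = bridges' ; long = cong (2 +_) long
      ; heads = heads' ; headsU = headsU' ; x₀∉ = x₀∉' ; sAvoid = sAvoid' ; pAvoid = pAvoid'
      ; sClass = class-keep (built-arcs built) arcs-split c∉sC sClass ; pClass = pClass'
      ; sSize = sSize ; pSize = pSize ; classes = classes-keep c∉Cs classes ; CsU = λ i → up (CsU i)
      ; c∉Cs = w₂∉Cs ; excess-t = excess-t ; separate = separate ; leaves = λ () }
    where
    open Partial Q
    open Extend built c∈ uq dj
    open ChainStep Q uq dj

  -- In `c → w₁ → w₂ → x → c` the vertex `w₁` joins the open class and closes it with one saving.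
  -- The vertex `x`, off the trunk and entered only from `w₂`, opens the next class, so every square
  -- yields a saving.
  square-step : ∀ {q ℓ t} → Partial [] q ℓ t → suc ℓ + t + 3 ≤ n → Partial [] (suc q) (2 + ℓ) (suc t)
  square-step {ℓ = ℓ} {t} Q room with fresh-vertices 3 (Partial.U Q) (subst (λ k → k + 3 ≤ n) (sym (Partial.size Q)) room)
  ... | w₁ ∷ w₂ ∷ x ∷ [] , _ , uq , dj = record
      { built = built' ; c = w₂ ; x₀ = x₀ ; Xs = Xs' ; sC = [ x ] ; pC = pC ; Cs = (w₁ ∷ sC) ∷ Cs
      ; size = trans (cong (3 +_) size) (sym (cong (3 +_) (ℕₚ.+-suc ℓ t)))
      ; c∈ = ∈-++⁺ˡ w₂∈ ; x₀∈ = up x₀∈ ; bridges = bridges' ; long = cong (2 +_) long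
      ; heads = heads' ; headsU = headsU' ; x₀∉ = x₀∉'
      ; sAvoid = λ { (here refl) → x ∷ w₁ ∷ U , x-cert , x-⊆ , w₂∉ } ; pAvoid = pAvoid'
      ; sClass = λ { (here refl) (here refl) ne → ⊥-elim (ne refl) } ; pClass = pClass'
      ; sSize = refl ; pSize = pSize
      ; classes = class-cons (λ i → let R , cR , R⊆U , c∉ = sAvoid i in S.indep-new w₁∈ into-w₁ R⊆U cR c∉)
                    (class-keep (built-arcs built) arcs-split c∉sC sClass) ∷ classes-keep c∉Cs classes
      ; CsU = CsU' ; c∉Cs = w₂∉Cs'
      ; excess-t = cong₂ _+_ sSize excess-t
      ; separate = unique-insert pC (unique-insert pC separate (old-list members w₁∈)) x∉
      ; leaves = λ () }
    where
    open Partial Q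
    open Extend built c∈ uq dj
    open ChainStep Q uq dj
    x∈ : x ∈ cs
    x∈ = there (there (here refl))
    x-cert : Cert (ArcIn E') x (x ∷ w₁ ∷ U)
    x-cert = here refl , w₂ , (λ i → cyc-in-unique c cs uq' (in-new x∈ i) (there (there (here refl)))) , λ i _ → closed i
      where
      closed : ∀ {a b} → (a , b) ∈ E' → b ∈ x ∷ w₁ ∷ U ⊎ b ≡ w₂
      closed i with arcs-split i
      ... | inj₁ o = inj₁ (there (there (proj₂ (built-arcs built o))))
      ... | inj₂ (_ , here refl) = inj₁ (there (there c∈))
      ... | inj₂ (_ , there (here refl)) = inj₁ (there (here refl))
      ... | inj₂ (_ , there (there (here refl))) = inj₂ refl
      ... | inj₂ (_ , there (there (there (here refl)))) = inj₁ (here refl)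
    x-⊆ : ∀ {v} → v ∈ x ∷ w₁ ∷ U → v ∈ U'
    x-⊆ (here refl) = ∈-++⁺ˡ x∈
    x-⊆ (there (here refl)) = ∈-++⁺ˡ w₁∈
    x-⊆ (there (there i)) = up i
    w₂∉ : w₂ ∉ x ∷ w₁ ∷ U
    w₂∉ (here refl) = Unique[x∷xs]⇒x∉xs (unique-tail uq) (here refl)
    w₂∉ (there (here refl)) = Unique[x∷xs]⇒x∉xs uq (here refl)
    w₂∉ (there (there i)) = dj (w₂∈ , i)
    sC∪Cs : ∀ {v} → v ∈ sC ++ concat Cs → v ∈ U
    sC∪Cs i = members (∈-++⁺ʳ pC i)
    CsU' : ∀ {v} → v ∈ w₁ ∷ sC ++ concat Cs → v ∈ U'
    CsU' (here refl) = ∈-++⁺ˡ w₁∈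
    CsU' (there i) = up (sC∪Cs i)
    w₂∉Cs' : w₂ ∉ w₁ ∷ sC ++ concat Cs
    w₂∉Cs' (here refl) = Unique[x∷xs]⇒x∉xs uq (here refl)
    w₂∉Cs' (there i) = dj (w₂∈ , sC∪Cs i)
    x∉ : x ∉ pC ++ w₁ ∷ sC ++ concat Cs
    x∉ i with ∈-++⁻ pC i
    ... | inj₁ j = dj (x∈ , members (∈-++⁺ˡ j))
    ... | inj₂ (here refl) = Unique[x∷xs]⇒x∉xs uq (there (here refl))
    ... | inj₂ (there j) = dj (x∈ , sC∪Cs j)

  -- The cut vertex stays in place, so all end triangles share it. Each enlarges both open classes
  -- by one and leaves the trunk as it is.
  leaf-step : ∀ {Ls q ℓ t} → Partial Ls q ℓ t → suc ℓ + (length Ls + (length Ls + t)) + 2 ≤ n →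
    ∃ λ e → Partial (e ∷ Ls) (suc q) ℓ t
  leaf-step {Ls} {ℓ = ℓ} {t} Q room with fresh-vertices 2 (Partial.U Q) (subst (λ k → k + 2 ≤ n) (sym (Partial.size Q)) room)
  ... | w₁ ∷ w₂ ∷ [] , _ , uq , dj = (w₁ , w₂) , record
      { built = built' ; c = c ; x₀ = x₀ ; Xs = Xs ; sC = w₁ ∷ sC ; pC = w₂ ∷ pC ; Cs = Cs
      ; size = trans (cong (2 +_) size) (cong suc (sym (trans (ℕₚ.+-suc ℓ _) (cong suc (trans (cong (ℓ +_) (ℕₚ.+-suc (length Ls) _)) (ℕₚ.+-suc ℓ _))))))
      ; c∈ = up c∈ ; x₀∈ = up x₀∈
      ; bridges = λ i → bridge-keep (here refl) (λ { (here refl) → inj₂ w₂∈ ; (there j) → inj₁ j }) (bridges i)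
      ; long = long
      ; heads = All.tabulate (λ { i refl → w₁∉ i }) ∷ unique-insert (map proj₁ Ls) heads (old-list headsU w₂∈)
      ; headsU = headsU'
      ; x₀∉ = x₀∉'
      ; sAvoid = λ { (here refl) → cs , S.cert-new w₁∈ into-w₁ , ∈-++⁺ˡ , c∉
                   ; (there i) → avoid-keep (built-arcs built) arcs-split (here refl) (sAvoid i) }
      ; pAvoid = λ { (here refl) → cs , P.cert-new w₂∈ from-wₗ , ∈-++⁺ˡ , c∉
                   ; (there i) → avoid-keep (swap ∘ built-arcs built) (map₂ swap ∘ arcs-split) (here refl) (pAvoid i) }
      ; sClass = class-cons (λ i → let R , cR , R⊆U , c∉ = sAvoid i in S.indep-new w₁∈ into-w₁ R⊆U cR c∉)
                   (class-keep (built-arcs built) arcs-split (λ i → let R , cR , _ , c∉ = sAvoid i in c∉ (proj₁ cR)) sClass)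
      ; pClass = class-cons (λ i → let R , cR , R⊆U , c∉ = pAvoid i in P.indep-new w₂∈ from-wₗ R⊆U cR c∉)
                   (class-keep (swap ∘ built-arcs built) (map₂ swap ∘ arcs-split)
                     (λ i → let R , cR , _ , c∉ = pAvoid i in c∉ (proj₁ cR)) pClass)
      ; sSize = cong suc sSize ; pSize = cong suc pSize ; classes = classes-keep c∉Cs classes ; CsU = λ i → up (CsU i)
      ; c∉Cs = c∉Cs ; excess-t = excess-t
      ; separate = All.tabulate (λ { i refl → w₂∉ i }) ∷ unique-insert pC separate (old-list members w₁∈)
      ; leaves = leaves' }
    where
    open Partial Q
    open Extend built c∈ uq dj
    w₂∈ : w₂ ∈ cs
    w₂∈ = there (here refl)
    c∉ : c ∉ cs
    c∉ i = dj (i , c∈)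
    w₁≢w₂ : w₁ ≢ w₂
    w₁≢w₂ e = Unique[x∷xs]⇒x∉xs uq (here e)
    inserted : ∀ {v} xs {ys : List V} {a} → v ∈ xs ++ a ∷ ys → v ≡ a ⊎ v ∈ xs ++ ys
    inserted [] (here p) = inj₁ p
    inserted [] (there i) = inj₂ i
    inserted (x ∷ xs) (here p) = inj₂ (here p)
    inserted (x ∷ xs) (there i) with inserted xs i
    ... | inj₁ p = inj₁ p
    ... | inj₂ j = inj₂ (there j)
    w₁∉ : w₁ ∉ map proj₁ Ls ++ w₂ ∷ (map proj₂ Ls ++ map proj₂ Xs)
    w₁∉ i with inserted (map proj₁ Ls) i
    ... | inj₁ p = w₁≢w₂ p
    ... | inj₂ j = dj (w₁∈ , headsU j)
    w₂∉ : w₂ ∉ pC ++ w₁ ∷ (sC ++ concat Cs)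
    w₂∉ i with inserted pC i
    ... | inj₁ p = w₁≢w₂ (sym p)
    ... | inj₂ j = dj (w₂∈ , members j)
    headsU' : ∀ {v} → v ∈ headsOf ((w₁ , w₂) ∷ Ls) Xs → v ∈ U'
    headsU' (here refl) = ∈-++⁺ˡ w₁∈
    headsU' (there i) with inserted (map proj₁ Ls) i
    ... | inj₁ refl = ∈-++⁺ˡ w₂∈
    ... | inj₂ j = up (headsU j)
    x₀∉' : x₀ ∉ headsOf ((w₁ , w₂) ∷ Ls) Xs
    x₀∉' (here refl) = dj (w₁∈ , x₀∈)
    x₀∉' (there i) with inserted (map proj₁ Ls) i
    ... | inj₁ refl = dj (w₂∈ , x₀∈)
    ... | inj₂ j = x₀∉ j
    leaves' : ∀ {s p} → (s , p) ∈ (w₁ , w₂) ∷ Ls → Triangle E' c s p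
    leaves' (here refl) = record
      { s≢c = apart w₁∈ c∈ ; p≢c = apart w₂∈ c∈ ; inS = into-w₁
      ; inP = λ i → cyc-in-unique c cs uq' (in-new w₂∈ i) (there (here refl))
      ; outS = λ i → case new-arc i of λ where
          (inj₁ o) → ⊥-elim (dj (w₁∈ , proj₁ (built-arcs built o)))
          (inj₂ o) → cyc-out-unique c cs uq' o (there (here refl)) }
    leaves' {s} {p} (there i) = record
      { s≢c = s≢c ; p≢c = p≢c ; inS = only-keep s∈ s≢c inS ; inP = only-keep p∈ p≢c inP
      ; outS = out-keep s∈ s≢c outS }
      where
      open Triangle (leaves i)
      s∈ : s ∈ U
      s∈ = headsU (∈-++⁺ˡ (∈-map⁺ proj₁ i))
      p∈ : p ∈ U
      p∈ = headsU (∈-++⁺ʳ (map proj₁ Ls) (∈-++⁺ˡ (∈-map⁺ proj₂ i)))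

-- Exact values for the constructed cacti

unique-map-injective : ∀ (f : A → B) {xs} → Unique (map f xs) → ∀ {x y} → x ∈ xs → y ∈ xs → f x ≡ f y → x ≡ y
unique-map-injective f uq i j e with ∈-AllPairs₂ (AllPairsₚ.map⁻ uq) i j
... | inj₁ p = p
... | inj₂ (inj₁ ne) = ⊥-elim (ne e)
... | inj₂ (inj₂ ne) = ⊥-elim (ne (sym e))

spanning : ∀ {U : List (Fin n)} → Unique U → length U ≡ n → ∀ v → v ∈ U
spanning {n} {U} uq eq v = decidable-stable (v ∈ᵥ? U) λ v∉ →
  ℕₚ.<-irrefl eq (unique-length (All.tabulate (λ { i refl → v∉ i }) ∷ uq))

module _ {n : ℕ} where
  private V = Fin n

  crossing : ∀ (R : List V) x is y → x ∈ R → y ∉ R →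
    ∃ λ a → ∃ λ b → (a , b) ∈ pairs (x ∷ is ++ [ y ]) × a ∈ R × b ∉ R
  crossing R x [] y x∈ y∉ = x , y , here refl , x∈ , y∉
  crossing R x (i ∷ is) y x∈ y∉ with i ∈ᵥ? R
  ... | no i∉ = x , i , here refl , x∈ , i∉
  ... | yes i∈ with crossing R i is y i∈ y∉
  ... | a , b , j , a∈ , b∉ = a , b , there j , a∈ , b∉

  Element : Set
  Element = V ⊎ (V × V)

  module _ {D : Digraph n} {x y : V} (P : Path D x y) where
    arcList : List (V × V)
    arcList = pairs (x ∷ inner P ++ [ y ])

    elements : List Element
    elements = map inj₁ (inner P) ++ map inj₂ arcList

    arc-element : ∀ {a b} → (a , b) ∈ arcList → inj₂ (a , b) ∈ elements
    arc-element i = ∈-++⁺ʳ (map inj₁ (inner P)) (∈-map⁺ inj₂ i)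

    inner-element : ∀ {v} → v ∈ inner P → inj₁ v ∈ elements
    inner-element i = ∈-++⁺ˡ (∈-map⁺ inj₁ i)

    head-inner : ∀ {a b} → (a , b) ∈ arcList → b ≢ y → b ∈ inner P
    head-inner i b≢y with ∈-++⁻ (inner P) (pairs-head-∈ x (inner P ++ [ y ]) i)
    ... | inj₁ j = j
    ... | inj₂ (here p) = ⊥-elim (b≢y p)

    tail-inner : ∀ {a b} → (a , b) ∈ arcList → a ≢ x → a ∈ inner P
    tail-inner i a≢x with pairs-tail-∈ (x ∷ inner P) y i
    ... | here p = ⊥-elim (a≢x p)
    ... | there j = j

  module _ {D : Digraph n} {E : List (V × V)} (D⊆E : ∀ {a b} → Arc D a b → (a , b) ∈ E) {x y : V} (P : Path D x y) where
    arcList⊆E : ∀ {a b} → (a , b) ∈ arcList P → (a , b) ∈ E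
    arcList⊆E i = D⊆E (All.lookup (Path.arcs P) i)

    entered : ∀ {a v} → v ∈ inner P ++ [ y ] → (∀ {b} → (b , v) ∈ E → b ≡ a) → (a , v) ∈ arcList P
    entered i only with pairs-has-head x (inner P ++ [ y ]) i
    ... | b , j with only (arcList⊆E j)
    ... | refl = j

    left : ∀ {b} → (∀ {c} → (x , c) ∈ E → c ≡ b) → (x , b) ∈ arcList P
    left only with pairs-has-tail (x ∷ inner P) y (here refl)
    ... | b , j with only (arcList⊆E j)
    ... | refl = j

  Forced : Digraph n → V → V → Element → Set
  Forced D x y e = (P : Path D x y) → e ∈ elements P

  -- Two such elements lie on one rainbow path in every total rainbow colouring, so their colours
  -- differ. A set of pairwise such elements is a clique of conflicts.
  Together : Digraph n → Element → Element → Set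
  Together D e e' = ∃ λ x → ∃ λ y → x ≢ y × Forced D x y e × Forced D x y e'

  together-sym : ∀ {D e e'} → Together D e e' → Together D e' e
  together-sym (x , y , ne , f , g) = x , y , ne , g , f

  module _ {D : Digraph n} (K : List Element) (uqK : Unique K)
    (together : ∀ {e e'} → e ∈ K → e' ∈ K → e ≢ e' → Together D e e') where

    together-lower : ∀ {j} → TotalRainbowConnected D j → length K ≤ j
    together-lower {j} (cv , ca , rainbow) =
      subst (_≤ j) (length-map col K) (unique-length (unique-map col uqK differ))
      where
      col : Element → Fin j
      col = [ cv , (λ e → ca (proj₁ e) (proj₂ e)) ]′
      differ : ∀ {e e'} → e ∈ K → e' ∈ K → e ≢ e' → col e ≢ col e'
      differ i j e≢e' same with together i j e≢e'
      ... | x , y , x≢y , f , g with rainbow x y x≢y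
      ... | P , uq = e≢e' (unique-map-injective col (subst Unique (sym colours) uq) (f P) (g P) same)
        where
        colours : map col (elements P) ≡ map cv (inner P) ++ map (λ e → ca (proj₁ e) (proj₂ e)) (arcList P)
        colours = trans (map-++ col (map inj₁ (inner P)) (map inj₂ (arcList P)))
          (cong₂ _++_ (sym (map-∘ (inner P))) (sym (map-∘ (arcList P))))

  module Final {Ls' : List (V × V)} {s₀ p₀ : V} {q ℓ t : ℕ} (Q : Partial ((s₀ , p₀) ∷ Ls') q ℓ t)
    (exact : suc ℓ + (suc (length Ls') + (suc (length Ls') + t)) ≡ n) where
    open Partial Q

    private
      Ls = (s₀ , p₀) ∷ Ls'
      k = length Ls

      D : Digraph n
      D = digraph E

      full : ∀ v → v ∈ U
      full = spanning (built-unique built) (trans size exact)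

      D⊆E : ∀ {a b} → Arc D a b → (a , b) ∈ E
      D⊆E = arc⇒∈ E

    cactus : Cactus D q
    cactus = built-cactus built full

    private
      savings : Savings U E
      savings = record { sClasses = sC ∷ Cs ; pClass = pC ; unique = separate ; members = members
                       ; sIndep = sClass ∷ classes ; pIndep = pClass }

      sExcess : excess (sC ∷ Cs) ≡ k + t
      sExcess = cong₂ (λ a b → a ∸ 1 + b) sSize excess-t

      pExcess : excess (pC ∷ sC ∷ Cs) ≡ k + (k + t)
      pExcess = cong₂ (λ a b → a ∸ 1 + b) pSize sExcess

      -- The `k` end triangles save `k` colours in each open class and the squares save `t`; exactly
      -- the trunk and one gate remain.
      vertex-count : ∀ N → N + excess (pC ∷ sC ∷ Cs) ≡ n → N ≡ suc ℓ
      vertex-count N eq = ℕₚ.+-cancelʳ-≡ (k + (k + t)) N (suc ℓ)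
        (trans (cong (N +_) (sym pExcess)) (trans eq (sym exact)))

      arc-count : ∀ M → M + excess (sC ∷ Cs) ≡ n → M ≡ suc ℓ + k
      arc-count M eq = ℕₚ.+-cancelʳ-≡ (k + t) M (suc ℓ + k)
        (trans (cong (M +_) (sym sExcess)) (trans eq (trans (sym exact) (sym (ℕₚ.+-assoc (suc ℓ) k (k + t))))))

    rvc-colouring : RainbowVertexConnected D (suc ℓ)
    rvc-colouring = let N , eq , col = rvc-upper D⊆E (proj₁ (proj₂ cactus)) savings in
      subst (RainbowVertexConnected D) (vertex-count N eq) col

    trc-colouring : TotalRainbowConnected D (suc ℓ + (suc ℓ + k))
    trc-colouring = let N , M , eN , eM , col = trc-upper D⊆E (proj₁ (proj₂ cactus)) savings in
      subst (TotalRainbowConnected D) (cong₂ _+_ (vertex-count N eN) (arc-count M eM)) col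

    private
      hX = map proj₂ Xs

      s-head : ∀ {s p} → (s , p) ∈ Ls → s ∈ map proj₁ Ls
      s-head = ∈-map⁺ proj₁

      p-head : ∀ {s p} → (s , p) ∈ Ls → p ∈ map proj₂ Ls
      p-head = ∈-map⁺ proj₂

      x₀≢s : ∀ {s p} → (s , p) ∈ Ls → x₀ ≢ s
      x₀≢s i refl = x₀∉ (∈-++⁺ˡ (s-head i))

      x₀≢p : ∀ {s p} → (s , p) ∈ Ls → x₀ ≢ p
      x₀≢p i refl = x₀∉ (∈-++⁺ʳ (map proj₁ Ls) (∈-++⁺ˡ (p-head i)))

      s≢p′ : ∀ {s p s' p'} → (s , p) ∈ Ls → (s' , p') ∈ Ls → s ≢ p'
      s≢p′ i j refl = unique-++-disjoint (map proj₁ Ls) heads (s-head i , ∈-++⁺ˡ (p-head j))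

      heads-ps : Unique (map proj₂ Ls ++ hX)
      heads-ps = unique-++ʳ (map proj₁ Ls) heads

      s₀∉ : s₀ ∉ map proj₂ Ls ++ hX
      s₀∉ i = unique-++-disjoint (map proj₁ Ls) heads (here refl , i)

      -- The ways an element is forced: `trunk` on paths from `x₀` to any end triangle, `gate` (`s₀`
      -- and the arc into it) on paths to `p₀` from anywhere else, `mid` on paths to the head or
      -- from the tail of a middle arc.
      data Kind (e : Element) : Set where
        trunk : (∀ {s p} → (s , p) ∈ Ls → Forced D x₀ p e) → Kind e
        gate  : (∀ {x p} → (s₀ , p) ∈ Ls → x ≢ s₀ → Forced D x p e) → Kind e
        mid   : ∀ {s p} → (s , p) ∈ Ls → e ≡ inj₂ (s , p) → Kind e

      mid-target : ∀ {s p x} → (s , p) ∈ Ls → (P : Path D x p) → (s , p) ∈ arcList P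
      mid-target i P = entered D⊆E P (∈-++⁺ʳ (inner P) (here refl)) (Triangle.inP (leaves i))

      mid-source : ∀ {s p y} → (s , p) ∈ Ls → (P : Path D s y) → (s , p) ∈ arcList P
      mid-source i P = left D⊆E P (Triangle.outS (leaves i))

      gate-vertex : ∀ {x p} → (s₀ , p) ∈ Ls → x ≢ s₀ → (P : Path D x p) → s₀ ∈ inner P
      gate-vertex i x≢s₀ P = tail-inner P (mid-target i P) (x≢s₀ ∘ sym)

      gate-arc : ∀ {x p} → (s₀ , p) ∈ Ls → x ≢ s₀ → (P : Path D x p) → (c , s₀) ∈ arcList P
      gate-arc i x≢s₀ P = entered D⊆E P (∈-++⁺ˡ (gate-vertex i x≢s₀ P)) (Triangle.inS (leaves (here refl)))

      trunk-arc : ∀ {a b s p} → (a , b) ∈ Xs → (s , p) ∈ Ls → (P : Path D x₀ p) → (a , b) ∈ arcList P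
      trunk-arc i j P with bridges i
      ... | R , x∈ , _ , _ , R#ps , sole with crossing R x₀ (inner P) _ x∈ (λ k → R#ps (k , p-head j))
      ... | a' , b' , k , a∈ , b∉ with sole (arcList⊆E D⊆E P k) a∈ b∉
      ... | refl , refl = k

      trunk-vertex : ∀ {b s p} → b ∈ hX → (s , p) ∈ Ls → (P : Path D x₀ p) → b ∈ inner P
      trunk-vertex i j P with ∈-map⁻ proj₂ i
      ... | (a , b) , k , refl = head-inner P (trunk-arc k j P)
        λ { refl → unique-++-disjoint (map proj₂ Ls) heads-ps (p-head j , i) }

      arcs' : List (V × V)
      arcs' = (c , s₀) ∷ (Ls ++ Xs)

      vertices' : List V
      vertices' = s₀ ∷ hX

      K : List Element
      K = map inj₂ arcs' ++ map inj₁ vertices'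

      arcs'-unique : Unique arcs'
      -- These arcs have distinct heads, so they are distinct.
      arcs'-unique = Uniqueₚ.map⁻ (subst (λ l → Unique (s₀ ∷ l)) (sym (map-++ proj₂ Ls Xs))
        (All.tabulate (λ { i refl → s₀∉ i }) ∷ heads-ps))

      vertices'-unique : Unique vertices'
      vertices'-unique = All.tabulate (λ { i refl → s₀∉ (∈-++⁺ʳ (map proj₂ Ls) i) }) ∷ unique-++ʳ (map proj₂ Ls) heads-ps

      K-unique : Unique K
      K-unique = Uniqueₚ.++⁺ (Uniqueₚ.map⁺ inj₂-injective arcs'-unique) (Uniqueₚ.map⁺ inj₁-injective vertices'-unique)
        λ (i , j) → case ∈-map⁻ inj₂ i of λ { (_ , _ , refl) → case ∈-map⁻ inj₁ j of λ { (_ , _ , ()) } }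

      kind : ∀ {e} → e ∈ K → Kind e
      kind i with ∈-++⁻ (map inj₂ arcs') i
      ... | inj₁ (here refl) = gate λ j x≢ P → arc-element P (gate-arc j x≢ P)
      ... | inj₁ (there j) with ∈-map⁻ inj₂ j
      ... | e , k , refl with ∈-++⁻ Ls k
      ... | inj₁ l = mid l refl
      ... | inj₂ l = trunk λ m P → arc-element P (trunk-arc l m P)
      kind i | inj₂ (here refl) = gate λ j x≢ P → inner-element P (gate-vertex j x≢ P)
      kind i | inj₂ (there j) with ∈-map⁻ inj₁ j
      ... | v , k , refl = trunk λ m P → inner-element P (trunk-vertex k m P)

      L₀ : (s₀ , p₀) ∈ Ls
      L₀ = here refl

      trunk-mid : ∀ {e s p} → (∀ {s p} → (s , p) ∈ Ls → Forced D x₀ p e) → (s , p) ∈ Ls → Together D e (inj₂ (s , p))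
      trunk-mid f i = x₀ , _ , x₀≢p i , f i , λ P → arc-element P (mid-target i P)

      gate-mid : ∀ {e s p} → (∀ {x p} → (s₀ , p) ∈ Ls → x ≢ s₀ → Forced D x p e) → (s , p) ∈ Ls → Together D e (inj₂ (s , p))
      gate-mid {s = s} f i with s ≟ s₀
      ... | yes refl = x₀ , _ , x₀≢p i , f i (x₀≢s i) , λ P → arc-element P (mid-target i P)
      -- A path from `s` to `p₀` begins with the middle arc at `s` and must enter the first triangle
      -- through the gate.
      ... | no s≢s₀ = s , p₀ , s≢p′ i L₀ , f L₀ s≢s₀ , λ P → arc-element P (mid-source i P)

      together : ∀ {e e'} → Kind e → Kind e' → Together D e e'
      together (trunk f) (trunk g) = x₀ , p₀ , x₀≢p L₀ , f L₀ , g L₀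
      together (trunk f) (gate g) = x₀ , p₀ , x₀≢p L₀ , f L₀ , g L₀ (x₀≢s L₀)
      together (trunk f) (mid i refl) = trunk-mid f i
      together (gate f) (trunk g) = x₀ , p₀ , x₀≢p L₀ , f L₀ (x₀≢s L₀) , g L₀
      together (gate f) (gate g) = x₀ , p₀ , x₀≢p L₀ , f L₀ (x₀≢s L₀) , g L₀ (x₀≢s L₀)
      together (gate f) (mid i refl) = gate-mid f i
      together (mid i refl) (trunk g) = together-sym (trunk-mid g i)
      together (mid i refl) (gate g) = together-sym (gate-mid g i)
      -- A path from the tail of one middle arc to the head of the other begins with the former and
      -- ends with the latter.
      together (mid i refl) (mid j refl) = _ , _ , s≢p′ i j ,
        (λ P → arc-element P (mid-source i P)) , λ P → arc-element P (mid-target j P)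

      K-length : length K ≡ suc ℓ + (suc ℓ + k)
      K-length = trans (length-++ (map inj₂ arcs')) (trans (cong₂ _+_
          (trans (length-map inj₂ arcs') (cong suc (trans (length-++ Ls) (cong (k +_) long))))
          (trans (length-map inj₁ vertices') (cong suc (trans (length-map proj₂ Xs) long))))
          (solve 2 (λ k ℓ → (con 1 :+ (k :+ ℓ)) :+ (con 1 :+ ℓ) := (con 1 :+ ℓ) :+ ((con 1 :+ ℓ) :+ k)) refl k ℓ))
        where open +-*-Solver

    trc-exact : trc≡ D (suc ℓ + (suc ℓ + k))
    trc-exact = trc-colouring , λ j lt col → ℕₚ.<⇒≱ lt (subst (_≤ j) K-length
      (together-lower K K-unique (λ i i' _ → together (kind i) (kind i')) col))

    -- All `ℓ` trunk heads and the gate `s₀` are inner vertices of every path from `x₀` to `p₀`.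
    rvc-exact : rvc≡ D (suc ℓ)
    rvc-exact = rvc-colouring , λ j lt col → ℕₚ.<⇒≱ lt (lower col)
      where
      lower : ∀ {j} → RainbowVertexConnected D j → suc ℓ ≤ j
      lower {j} (col , rainbow) with rainbow x₀ p₀ (x₀≢p L₀)
      ... | P , uq = subst (_≤ j) (trans (length-map col vertices') (cong suc (trans (length-map proj₂ Xs) long)))
          (unique-length (unique-map col vertices'-unique λ i j v≢w e →
            v≢w (unique-map-injective col uq (on i) (on j) e)))
        where
        on : ∀ {v} → v ∈ vertices' → v ∈ inner P
        on (here refl) = gate-vertex L₀ (x₀≢s L₀) P
        on (there i) = trunk-vertex i L₀ P

  squares : ∀ m t → suc (t * 2 + (2 + m)) + t ≤ n → Partial {n} [] (t + 1) (t * 2 + (2 + m)) t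
  squares m zero room = start m (subst (_≤ n) (ℕₚ.+-identityʳ _) room)
  squares m (suc t) room = square-step (squares m t (ℕₚ.≤-trans (ℕₚ.m≤m+n _ 3) room')) room'
    where
    room' : suc (t * 2 + (2 + m)) + t + 3 ≤ n
    room' = subst (_≤ n) (solve 2 (λ ℓ t → con 3 :+ ℓ :+ (con 1 :+ t) := con 1 :+ ℓ :+ t :+ con 3) refl (t * 2 + (2 + m)) t) room
      where open +-*-Solver

  triangles : ∀ m t d → suc (d * 2 + (t * 2 + (2 + m))) + t ≤ n →
    Partial {n} [] (d + (t + 1)) (d * 2 + (t * 2 + (2 + m))) t
  triangles m t zero room = squares m t room
  triangles m t (suc d) room = triangle-step (triangles m t d (ℕₚ.≤-trans (ℕₚ.m≤m+n _ 2) room')) room'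
    where
    room' : suc (d * 2 + (t * 2 + (2 + m))) + t + 2 ≤ n
    room' = subst (_≤ n) (solve 2 (λ ℓ t → con 3 :+ ℓ :+ t := con 1 :+ ℓ :+ t :+ con 2) refl (d * 2 + (t * 2 + (2 + m))) t) room
      where open +-*-Solver

  Ended : ℕ → ℕ → ℕ → ℕ → Set
  Ended k q ℓ t = ∃ λ (Ls : List (V × V)) → length Ls ≡ k × Partial Ls q ℓ t

  end-step : ∀ {k q ℓ t} → suc ℓ + (k + (k + t)) + 2 ≤ n → Ended k q ℓ t → Ended (suc k) (suc q) ℓ t
  end-step room (Ls , refl , Q) = let e , Q' = leaf-step Q room in e ∷ Ls , refl , Q'

  end-room : ∀ ℓ k t → suc ℓ + (suc k + (suc k + t)) ≤ n → suc ℓ + (k + (k + t)) + 2 ≤ n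
  end-room ℓ k t = subst (_≤ n) (solve 3 (λ ℓ k t → (con 1 :+ ℓ) :+ ((con 1 :+ k) :+ ((con 1 :+ k) :+ t))
      := (con 1 :+ ℓ) :+ (k :+ (k :+ t)) :+ con 2) refl ℓ k t)
    where open +-*-Solver

  end-triangles : ∀ {q ℓ t} k → Partial {n} [] q ℓ t → suc ℓ + (k + (k + t)) ≤ n → Ended k (k + q) ℓ t
  end-triangles zero Q room = [] , refl , Q
  end-triangles {ℓ = ℓ} {t} (suc k) Q room =
    end-step (end-room ℓ k t room) (end-triangles k Q (ℕₚ.≤-trans (ℕₚ.m≤m+n _ 2) (end-room ℓ k t room)))

realise : ∀ {q ℓ t k} → suc ℓ + (suc k + (suc k + t)) ≡ n →
  Ended {n} (suc k) q ℓ t →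
  Σ (Digraph n) λ D → Cactus D q × rvc≡ D (suc ℓ) × trc≡ D (suc ℓ + (suc ℓ + suc k))
realise exact (_ ∷ Ls , refl , Q) = digraph (Partial.E Q) , cactus , rvc-exact , trc-exact
  where open Final Q exact

family : ∀ m t d k n → let ℓ = d * 2 + (t * 2 + (2 + m)) in
  suc ℓ + (suc k + (suc k + t)) ≡ n →
  Σ (Digraph n) λ D → Cactus D (suc k + (d + (t + 1))) × rvc≡ D (suc ℓ) × trc≡ D (suc ℓ + (suc ℓ + suc k))
family m t d k n exact = realise exact (end-triangles (suc k) (triangles m t d room) (ℕₚ.≤-reflexive exact))
  where
  ℓ = d * 2 + (t * 2 + (2 + m))
  room : suc ℓ + t ≤ n
  room = ℕₚ.≤-trans (ℕₚ.+-monoʳ-≤ (suc ℓ) (ℕₚ.≤-trans (ℕₚ.m≤n+m t (suc k)) (ℕₚ.m≤n+m _ (suc k))))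
    (ℕₚ.≤-reflexive exact)

-- The parameters of parts (a) and (b)

-- One long cycle, `t` squares, `d` triangles in the chain and `r + 1` end triangles.
blocks-of : ℕ → ℕ → ℕ → ℕ
blocks-of t d r = 2 + (t + (d + r))

-- The long cycle has `3 + e` vertices, so `e` is the surplus of `n` over the smallest admissible
-- order `2q + 1 + t`.
order-of : ℕ → ℕ → ℕ → ℕ → ℕ
order-of t d r e = 2 * blocks-of t d r + (1 + t + e)

cactus-of : ∀ t d r e → let q = blocks-of t d r ; n = order-of t d r e in
  Σ (Digraph n) λ Q → Cactus Q q × rvc≡ Q (n ∸ 2 * q + (t + suc d * 2)) × trc≡ Q (2 * n ∸ 3 * q + (t + suc d * 3))
cactus-of t d r e with family e t d r (order-of t d r e) exact
  where
  open +-*-Solver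
  exact : suc (d * 2 + (t * 2 + (2 + e))) + (suc r + (suc r + t)) ≡ order-of t d r e
  exact = solve 4 (λ t d r e → con 1 :+ (d :* con 2 :+ (t :* con 2 :+ (con 2 :+ e))) :+ ((con 1 :+ r) :+ ((con 1 :+ r) :+ t))
    := con 2 :* (con 2 :+ (t :+ (d :+ r))) :+ (con 1 :+ t :+ e)) refl t d r e
... | D , cactus , rvc , trc = D , subst (Cactus D) blocks≡ cactus , subst (rvc≡ D) rvc≡′ rvc , subst (trc≡ D) trc≡′ trc
  where
  open +-*-Solver
  q = blocks-of t d r
  ℓ = d * 2 + (t * 2 + (2 + e))
  blocks≡ : suc r + (d + (t + 1)) ≡ q
  blocks≡ = solve 3 (λ t d r → con 1 :+ r :+ (d :+ (t :+ con 1)) := con 2 :+ (t :+ (d :+ r))) refl t d r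
  rvc≡′ : suc ℓ ≡ order-of t d r e ∸ 2 * q + (t + suc d * 2)
  rvc≡′ = trans
    (solve 3 (λ t d e → con 1 :+ (d :* con 2 :+ (t :* con 2 :+ (con 2 :+ e))) := con 1 :+ t :+ e :+ (t :+ (con 1 :+ d) :* con 2)) refl t d e)
    (cong (_+ (t + suc d * 2)) (sym (ℕₚ.m+n∸m≡n (2 * q) (1 + t + e))))
  excess-arcs : ℕ
  excess-arcs = 4 + (t * 3 + d + r + e * 2)
  twice : 2 * order-of t d r e ≡ 3 * q + excess-arcs
  twice = solve 4 (λ t d r e → con 2 :* (con 2 :* (con 2 :+ (t :+ (d :+ r))) :+ (con 1 :+ t :+ e))
    := con 3 :* (con 2 :+ (t :+ (d :+ r))) :+ (con 4 :+ (t :* con 3 :+ d :+ r :+ e :* con 2))) refl t d r e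
  trc≡′ : suc ℓ + (suc ℓ + suc r) ≡ 2 * order-of t d r e ∸ 3 * q + (t + suc d * 3)
  trc≡′ = trans
    (solve 4 (λ t d r e → (con 1 :+ (d :* con 2 :+ (t :* con 2 :+ (con 2 :+ e)))) :+ ((con 1 :+ (d :* con 2 :+ (t :* con 2 :+ (con 2 :+ e)))) :+ (con 1 :+ r))
      := con 4 :+ (t :* con 3 :+ d :+ r :+ e :* con 2) :+ (t :+ (con 1 :+ d) :* con 3)) refl t d r e)
    (cong (_+ (t + suc d * 3)) (sym (trans (cong (_∸ 3 * q) twice) (ℕₚ.m+n∸m≡n (3 * q) excess-arcs))))

quotient-positive : ∀ m k t h → k ≡ t + h * m → t < k → ∃ λ d → h ≡ suc d
quotient-positive m k t zero refl lt = ⊥-elim (ℕₚ.<-irrefl (sym (ℕₚ.+-identityʳ t)) lt)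
quotient-positive m k t (suc d) _ _ = d , refl

-- The slack in the first inequality becomes `r`, that in the second becomes `e`; neither affects
-- `k`.
cactus-for : ∀ {t d q n} → 2 + (t + d) ≤ q → 2 * q + (1 + t) ≤ n →
  Σ (Digraph n) λ Q → Cactus Q q × rvc≡ Q (n ∸ 2 * q + (t + suc d * 2)) × trc≡ Q (2 * n ∸ 3 * q + (t + suc d * 3))
cactus-for {t} {d} q≥ n≥ with ℕₚ.m≤n⇒∃[o]m+o≡n q≥ | ℕₚ.m≤n⇒∃[o]m+o≡n n≥
... | r , refl | e , refl = subst₂ Goal (cong (2 +_) (sym (ℕₚ.+-assoc t d r)))
      (trans (sym (ℕₚ.+-assoc (2 * blocks-of t d r) (1 + t) e))
        (cong (λ k → 2 * (2 + k) + (1 + t) + e) (sym (ℕₚ.+-assoc t d r))))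
      (cactus-of t d r e)
  where
  Goal : ℕ → ℕ → Set
  Goal q n = Σ (Digraph n) λ Q → Cactus Q q × rvc≡ Q (n ∸ 2 * q + (t + suc d * 2)) × trc≡ Q (2 * n ∸ 3 * q + (t + suc d * 3))

blocks-bound₂ : ∀ t d q → t < 2 → t + suc d * 2 + 2 ≤ 2 * q → 2 + (t + d) ≤ q
blocks-bound₂ t d q (s≤s t≤1) le = ℕₚ.*-cancelˡ-< 2 (1 + (t + d)) q (begin
    suc (2 * (1 + (t + d)))  ≡⟨ solve 2 (λ t d → con 1 :+ con 2 :* (con 1 :+ (t :+ d)) := t :+ (t :+ d :* con 2 :+ con 3)) refl t d ⟩
    t + (t + d * 2 + 3)      ≤⟨ ℕₚ.+-monoˡ-≤ (t + d * 2 + 3) t≤1 ⟩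
    1 + (t + d * 2 + 3)      ≡⟨ solve 2 (λ t d → con 1 :+ (t :+ d :* con 2 :+ con 3) := t :+ (con 1 :+ d) :* con 2 :+ con 2) refl t d ⟩
    t + suc d * 2 + 2        ≤⟨ le ⟩
    2 * q                    ∎)
  where
  open ℕₚ.≤-Reasoning
  open +-*-Solver

-- For `t` at most 1 the bound on `k` is enough. For `t = 2` it gives only `3 + d ≤ q`, one block
-- short, and equality there is precisely `k = 3q - 4`.
blocks-bound₃ : ∀ t d q → t < 3 → t + suc d * 3 ≢ 3 * q ∸ 4 → t + suc d * 3 + 3 ≤ 3 * q → 2 + (t + d) ≤ q
blocks-bound₃ t d q t<3 ne le = go t t<3 ne le
  where
  open ℕₚ.≤-Reasoning
  open +-*-Solver
  go : ∀ t → t < 3 → t + suc d * 3 ≢ 3 * q ∸ 4 → t + suc d * 3 + 3 ≤ 3 * q → 2 + (t + d) ≤ q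
  go 0 _ _ le = ℕₚ.*-cancelˡ-≤ 3 (begin
    3 * (2 + d)        ≡⟨ solve 1 (λ d → con 3 :* (con 2 :+ d) := (con 1 :+ d) :* con 3 :+ con 3) refl d ⟩
    suc d * 3 + 3      ≤⟨ le ⟩
    3 * q              ∎)
  go 1 _ _ le = ℕₚ.*-cancelˡ-< 3 (2 + d) q (begin
    suc (3 * (2 + d))    ≡⟨ solve 1 (λ d → con 1 :+ con 3 :* (con 2 :+ d) := con 1 :+ (con 1 :+ d) :* con 3 :+ con 3) refl d ⟩
    1 + suc d * 3 + 3    ≤⟨ le ⟩
    3 * q                ∎)
  go 2 _ ne le = ℕₚ.≤∧≢⇒< (ℕₚ.*-cancelˡ-< 3 (2 + d) q (begin
    suc (3 * (2 + d))    ≤⟨ ℕₚ.n≤1+n _ ⟩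
    2 + 3 * (2 + d)      ≡⟨ solve 1 (λ d → con 2 :+ con 3 :* (con 2 :+ d) := con 2 :+ (con 1 :+ d) :* con 3 :+ con 3) refl d ⟩
    2 + suc d * 3 + 3    ≤⟨ le ⟩
    3 * q                ∎))
    λ { refl → ne (sym (cong (_∸ 4) (solve 1 (λ d → con 3 :* (con 3 :+ d) := con 4 :+ (con 2 :+ (con 1 :+ d) :* con 3)) refl d))) }
  go (suc (suc (suc _))) (s≤s (s≤s (s≤s ()))) _ _

rvc-realised : ∀ t q k n → t < 2 → k % 2 ≡ t → 2 ≤ q → 2 ≤ k → k ≤ 2 * q ∸ 2 → 2 * q + (1 + t) ≤ n →
  Σ (Digraph n) λ Q → Cactus Q q × rvc≡ Q (n ∸ 2 * q + k)
rvc-realised t q k n t<2 k%2 q≥ k≥ k≤ n≥ = go (k / 2) (trans (m≡m%n+[m/n]*n k 2) (cong (_+ k / 2 * 2) k%2))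
  where
  k+2≤ : k + 2 ≤ 2 * q
  k+2≤ = ℕₚ.m≤o∸n⇒m+n≤o k (ℕₚ.≤-trans q≥ (ℕₚ.m≤m+n q _)) k≤
  go : ∀ h → k ≡ t + h * 2 → Σ (Digraph n) λ Q → Cactus Q q × rvc≡ Q (n ∸ 2 * q + k)
  go h k≡ with quotient-positive 2 k t h k≡ (ℕₚ.<-≤-trans t<2 k≥)
  ... | d , refl = let Q , cactus , rvc , _ = cactus-for (blocks-bound₂ t d q t<2 (subst (λ k → k + 2 ≤ 2 * q) k≡ k+2≤)) n≥
    in Q , cactus , subst (λ k → rvc≡ Q (n ∸ 2 * q + k)) (sym k≡) rvc

trc-realised : ∀ t q k n → t < 3 → k % 3 ≡ t → 2 ≤ q → 3 ≤ k → k ≤ 3 * q ∸ 3 → k ≢ 3 * q ∸ 4 → 2 * q + (1 + t) ≤ n →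
  Σ (Digraph n) λ Q → Cactus Q q × trc≡ Q (2 * n ∸ 3 * q + k)
trc-realised t q k n t<3 k%3 q≥ k≥ k≤ k≢ n≥ = go (k / 3) (trans (m≡m%n+[m/n]*n k 3) (cong (_+ k / 3 * 3) k%3))
  where
  k+3≤ : k + 3 ≤ 3 * q
  k+3≤ = ℕₚ.m≤o∸n⇒m+n≤o k (ℕₚ.≤-trans (ℕₚ.n≤1+n 3) (ℕₚ.≤-trans (ℕₚ.+-mono-≤ q≥ q≥) (ℕₚ.+-monoʳ-≤ q (ℕₚ.m≤m+n q _)))) k≤
  go : ∀ h → k ≡ t + h * 3 → Σ (Digraph n) λ Q → Cactus Q q × trc≡ Q (2 * n ∸ 3 * q + k)
  go h k≡ with quotient-positive 3 k t h k≡ (ℕₚ.<-≤-trans t<3 k≥)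
  ... | d , refl = let Q , cactus , _ , trc = cactus-for (blocks-bound₃ t d q t<3 (subst (_≢ 3 * q ∸ 4) k≡ k≢)
                                                (subst (λ k → k + 3 ≤ 3 * q) k≡ k+3≤)) n≥
    in Q , cactus , subst (λ k → trc≡ Q (2 * n ∸ 3 * q + k)) (sym k≡) trc

theorem29 : ∀ (q : ℕ) → 2 ≤ q →
    (∀ (k : ℕ) → 2 ≤ k → k ≤ 2 * q ∸ 2 → ∀ (n : ℕ) →
    ((k % 2 ≡ 0 × 2 * q + 1 ≤ n) ⊎ (k % 2 ≡ 1 × 2 * q + 2 ≤ n)) →
    Σ (Digraph n) λ Q → Cactus Q q × rvc≡ Q (n ∸ 2 * q + k))
    × (∀ (k : ℕ) → 3 ≤ k → k ≤ 3 * q ∸ 3 → k ≢ 3 * q ∸ 4 → ∀ (n : ℕ) →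
    ((k % 3 ≡ 0 × 2 * q + 1 ≤ n) ⊎ (k % 3 ≡ 1 × 2 * q + 2 ≤ n) ⊎ (k % 3 ≡ 2 × 2 * q + 3 ≤ n)) →
    Σ (Digraph n) λ Q → Cactus Q q × trc≡ Q (2 * n ∸ 3 * q + k))
    × (∀ (n : ℕ) (Q : Digraph n) → Cactus Q q → ¬ trc≡ Q (2 * n ∸ 4))
theorem29 q 2≤q =
    (λ k 2≤k k≤ n → λ where
      (inj₁ (eq , n≥)) → rvc-realised 0 q k n (s≤s z≤n) eq 2≤q 2≤k k≤ n≥
      (inj₂ (eq , n≥)) → rvc-realised 1 q k n (s≤s (s≤s z≤n)) eq 2≤q 2≤k k≤ n≥)
  , (λ k 3≤k k≤ k≢ n → λ where
      (inj₁ (eq , n≥)) → trc-realised 0 q k n (s≤s z≤n) eq 2≤q 3≤k k≤ k≢ n≥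
      (inj₂ (inj₁ (eq , n≥))) → trc-realised 1 q k n (s≤s (s≤s z≤n)) eq 2≤q 3≤k k≤ k≢ n≥
      (inj₂ (inj₂ (eq , n≥))) → trc-realised 2 q k n (s≤s (s≤s (s≤s z≤n))) eq 2≤q 3≤k k≤ k≢ n≥)
  , λ n Q cactus → trc≢2n∸4 2≤q cactus
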